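{- Let $f(x)\in\mathbf{Z}[x]$ be a separable nonconstant polynomial, and consider the assertion (*) for all but finitely many primes $p$, the set $\mathcal{S}(f)$ contains infinitely many elements from every nonzero residue class modulo $p$. Assertion (*) holds unconditionally if $f(x)$ has degree 1 or 2. If $f(x)$ has degree 3, or if it has degree 4 and has a rational root, then (*) follows from the Parity Conjecture.
   Context: Squarefree integers may be negative and are nonzero. For a nonzero rational number $r$, its squarefree part $S(r)$ is the unique squarefree integer $d$ such that $r/d$ is a square in $\mathbf{Q}$. For a separable nonconstant $f(x)\in\mathbf{Z}[x]$, $\mathcal{S}(f)=\{S(f(r)) : r\in\mathbf{Q},\ f(r)\neq 0\}$. For an elliptic curve $E: y^2=g(x)$ over $\mathbf{Q}$ and a squarefree integer $d$, $E_d: dy^2=g(x)$ denotes the quadratic twist of $E$ by $d$. The Parity Conjecture is used in the following form, for quadratic twists: Let $E$ be an elliptic curve over $\mathbf{Q}$ with conductor $N_E$, and let $d$ be a squarefree integer coprime to $2N_E$. Then $(-1)^{\operatorname{rank} E_d(\mathbf{Q})}=(-1)^{\operatorname{rank} E(\mathbf{Q})}\cdot\chi_d(-N_E)$, where $\chi_d$ is the quadratic Dirichlet character associated to the field $\mathbf{Q}(\sqrt d)$. Here, if $D$ is the discriminant of $\mathbf{Q}(\sqrt d)$, $\chi_d$ is given by the Kronecker symbol $\chi_d(n)=\left(\frac{D}{n}\right)$. -}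

module Defs where

open import Data.Bool.Base using (Bool; true; false; if_then_else_; _∧_; not)
open import Data.Fin.Base using (Fin)
open import Data.Integer.Base as ℤ using (ℤ; +_; -[1+_]; 0ℤ; 1ℤ; -1ℤ; ∣_∣)
import Data.Integer.Divisibility as ℤDiv
open import Data.Integer.DivMod using (_%ℕ_; _/ℕ_)
open import Data.List.Base
  using (List; []; _∷_; map; foldr; upTo; concatMap)
open import Data.List.Membership.Propositional using (_∉_)
open import Data.Nat.Base as ℕ using (ℕ; zero; suc; NonZero)
open import Data.Nat.Coprimality using (Coprime)
import Data.Nat.Divisibility as ℕDiv
import Data.Nat.DivMod as ℕDivMod
open import Data.Nat.ListAction using (product)
open import Data.Nat.Primality using (Prime; prime?)
open import Data.Nat.Primality.Factorisation using (factorise; factors)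
open import Data.Nat.Properties using (anyUpTo?; m^n≢0; _≟_)
open import Data.Product.Base using (Σ; ∃; _×_; _,_)
open import Data.Rational.Base as ℚ using (ℚ; 0ℚ; 1ℚ; ↥_; ↧ₙ_)
import Data.Rational.Properties as ℚₚ
open import Data.Unit.Base using (⊤)
import Data.Vec.Functional as Vector
open import Relation.Binary.PropositionalEquality using (_≡_; _≢_)
open import Relation.Nullary using (¬_; does; yes; no)

fromℤ : ℤ → ℚ
fromℤ n = n ℚ./ 1

-- Total division, with p ∕ 0 = 0.
infixl 7 _∕_
_∕_ : ℚ → ℚ → ℚ
p ∕ q with q ℚₚ.≟ 0ℚ
... | yes _  = 0ℚ
... | no q≢0 = ℚ._÷_ p q {{ℚ.≢-nonZero q≢0}}

-- Polynomials are coefficient lists, constant term first; trailing zeros are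
-- allowed, so they are compared coefficientwise by _≈_.
module Polynomials where
  open import Data.Rational.Base using (_+_; _*_)

  ℤ[x] ℚ[x] : Set
  ℤ[x] = List ℤ
  ℚ[x] = List ℚ

  toℚ[x] : ℤ[x] → ℚ[x]
  toℚ[x] = map fromℤ

  coeff : ℚ[x] → ℕ → ℚ
  coeff []      _       = 0ℚ
  coeff (a ∷ f) zero    = a
  coeff (a ∷ f) (suc i) = coeff f i

  infix 4 _≈_
  _≈_ : ℚ[x] → ℚ[x] → Set
  f ≈ g = ∀ i → coeff f i ≡ coeff g i

  infixl 6 _⊕_
  _⊕_ : ℚ[x] → ℚ[x] → ℚ[x]
  []      ⊕ g       = g
  f       ⊕ []      = f
  (a ∷ f) ⊕ (b ∷ g) = (a + b) ∷ (f ⊕ g)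

  infixl 7 _⊗_
  _⊗_ : ℚ[x] → ℚ[x] → ℚ[x]
  []      ⊗ g = []
  (a ∷ f) ⊗ g = map (a *_) g ⊕ (0ℚ ∷ (f ⊗ g))

  eval : ℚ[x] → ℚ → ℚ
  eval f x = foldr (λ a s → a + x * s) 0ℚ f

  -- (a + x f)′ = f + x f′
  deriv : ℚ[x] → ℚ[x]
  deriv []      = []
  deriv (a ∷ f) = f ⊕ (0ℚ ∷ deriv f)

  HasDegree : ℚ[x] → ℕ → Set
  HasDegree f n = coeff f n ≢ 0ℚ × (∀ m → n ℕ.< m → coeff f m ≡ 0ℚ)

  Nonconstant : ℚ[x] → Set
  Nonconstant f = ∃ λ n → 1 ℕ.≤ n × HasDegree f n

  -- f and f′ generate the unit ideal of ℚ[x].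
  Separable : ℚ[x] → Set
  Separable f = ∃ λ u → ∃ λ v → u ⊗ f ⊕ v ⊗ deriv f ≈ 1ℚ ∷ []

open Polynomials public

-- Excludes d = 0, as witnessed by k = 2.
Squarefree : ℤ → Set
Squarefree d = ∀ (k : ℕ) → k ℕ.* k ℕDiv.∣ ∣ d ∣ → k ≡ 1

IsSquarefreePart : ℚ → ℤ → Set
IsSquarefreePart r d = Squarefree d × ∃ λ q → r ≡ fromℤ d ℚ.* (q ℚ.* q)

_∈𝒮_ : ℤ → ℤ[x] → Set
d ∈𝒮 f = ∃ λ r → eval (toℚ[x] f) r ≢ 0ℚ × IsSquarefreePart (eval (toℚ[x] f) r) d

Infinite : (ℤ → Set) → Set
Infinite P = ∀ (xs : List ℤ) → ∃ λ d → P d × d ∉ xs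

ForAllButFinitelyManyPrimes : (ℕ → Set) → Set
ForAllButFinitelyManyPrimes P =
  ∃ λ (exceptions : List ℕ) → ∀ p → Prime p → p ∉ exceptions → P p

-- The nonzero residue classes modulo p are given by representatives a.
HitsAllNonzeroClasses : ℤ[x] → Set
HitsAllNonzeroClasses f = ForAllButFinitelyManyPrimes λ p →
  ∀ (a : ℤ) → ¬ (+ p ℤDiv.∣ a) →
  Infinite (λ d → d ∈𝒮 f × + p ℤDiv.∣ d ℤ.- a)

module QuadraticCharacter where

  legendre : ℤ → ℕ → ℤ
  legendre a p =
    if does (p ℕDiv.∣? ∣ a ∣) then 0ℤ
    else if does (anyUpTo? (λ x → p ℕDiv.∣? ∣ + (x ℕ.* x) ℤ.- a ∣) p) then 1ℤ
    else -1ℤ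

  kronecker₂ : ℤ → ℤ
  kronecker₂ a with a %ℕ 8
  ... | 1 = 1ℤ
  ... | 7 = 1ℤ
  ... | 3 = -1ℤ
  ... | 5 = -1ℤ
  ... | _ = 0ℤ

  kroneckerPrime : ℤ → ℕ → ℤ
  kroneckerPrime a 2 = kronecker₂ a
  kroneckerPrime a p = legendre a p

  kroneckerPositive : ℤ → (n : ℕ) → .{{NonZero n}} → ℤ
  kroneckerPositive a n =
    foldr ℤ._*_ 1ℤ (map (kroneckerPrime a) (factors (factorise n)))

  kronecker₋₁ : ℤ → ℤ
  kronecker₋₁ (+ _)    = 1ℤ
  kronecker₋₁ -[1+ _ ] = -1ℤ

  kronecker : ℤ → ℤ → ℤ
  kronecker a (+ zero)  = if does (∣ a ∣ ≟ 1) then 1ℤ else 0ℤ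
  kronecker a (+ suc n) = kroneckerPositive a (suc n)
  kronecker a -[1+ n ]  = kronecker₋₁ a ℤ.* kroneckerPositive a (suc n)

  -- For squarefree d.  When d = 1 the field is ℚ, and the value is 1.
  discQuadraticField : ℤ → ℤ
  discQuadraticField d with d %ℕ 4
  ... | 1 = d
  ... | _ = + 4 ℤ.* d

  χ : ℤ → ℤ → ℤ
  χ d n = kronecker (discQuadraticField d) n

open QuadraticCharacter public

-- The conductor exponent at p is ord_p(Δ_min) + 1 - m (Ogg's formula), m being
-- the number of geometric components of the special fibre of the minimal
-- regular model.  Δ_min and m are read off by Tate's algorithm, as in
-- Silverman, Advanced Topics in the Arithmetic of Elliptic Curves, IV.9.4.
-- The changes of coordinates it asks for exist, so each is found by trying
-- all residues.
module Conductor where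
  open import Data.Integer.Base using (_+_; _*_; _-_; _^_)

  -- y² + a₁ x y + a₃ y = x³ + a₂ x² + a₄ x + a₆
  record Model : Set where
    constructor model
    field a₁ a₂ a₃ a₄ a₆ : ℤ

    b₂ b₄ b₆ b₈ Δ : ℤ
    b₂ = a₁ * a₁ + + 4 * a₂
    b₄ = a₁ * a₃ + + 2 * a₄
    b₆ = a₃ * a₃ + + 4 * a₆
    b₈ = a₁ * a₁ * a₆ - a₁ * a₃ * a₄ + + 4 * a₂ * a₆ + a₂ * a₃ * a₃ - a₄ * a₄
    Δ  = + 9 * b₂ * b₄ * b₆ - b₂ * b₂ * b₈ - + 8 * b₄ ^ 3 - + 27 * b₆ * b₆

  open Model

  -- x = x′ + r,  y = y′ + s x′ + t
  shift : ℤ → ℤ → ℤ → Model → Model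
  shift r s t (model a₁ a₂ a₃ a₄ a₆) = model
    (a₁ + + 2 * s)
    (a₂ - s * a₁ + + 3 * r - s * s)
    (a₃ + r * a₁ + + 2 * t)
    (a₄ - s * a₃ + + 2 * r * a₂ - (t + r * s) * a₁ + + 3 * r * r - + 2 * s * t)
    (a₆ + r * a₄ + r * r * a₂ + r * r * r - t * a₃ - t * t - r * t * a₁)

  data Kodaira : Set where
    I I*                : ℕ → Kodaira
    II III IV IV* III* II* : Kodaira

  components : Kodaira → ℕ
  components (I zero)    = 1
  components (I (suc n)) = suc n
  components (I* n)      = 5 ℕ.+ n
  components II          = 1
  components III         = 2
  components IV          = 3
  components IV*         = 7
  components III*        = 8
  components II*         = 9

  firstSuchThat : (Model → Bool) → Model → List Model → Model
  firstSuchThat P default []       = default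
  firstSuchThat P default (W ∷ Ws) =
    if P W then W else firstSuchThat P default Ws

  module AtPrime (p : ℕ) {{p≢0 : NonZero p}} where

    p^_∣_ : ℕ → ℤ → Bool
    p^ k ∣ n = does (p ℕ.^ k ℕDiv.∣? ∣ n ∣)

    p^_∤_ : ℕ → ℤ → Bool
    p^ k ∤ n = not (p^ k ∣ n)

    -- ord_p n, for n ≢ 0 and p > 1
    ord : ℤ → ℕ
    ord n = go ∣ n ∣ ∣ n ∣
      where
      go : ℕ → ℕ → ℕ
      go zero       _ = 0
      go (suc fuel) m =
        if does (p ℕDiv.∣? m) then suc (go fuel (m ℕDivMod./ p)) else 0

    -- representatives of p^k ℤ / p^(k+1) ℤ
    digits : ℕ → List ℤ
    digits k = map (λ j → + (j ℕ.* p ℕ.^ k)) (upTo p)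

    shiftBy : List ℤ → List ℤ → List ℤ → (Model → Bool) → Model → Model
    shiftBy rs ss ts P W = firstSuchThat P W
      (concatMap (λ r → concatMap (λ s → map (λ t → shift r s t W) ts) ss) rs)

    [0] : List ℤ
    [0] = 0ℤ ∷ []

    singularPointToOrigin : Model → Model
    singularPointToOrigin = shiftBy (digits 0) [0] (digits 0)
      λ W → p^ 1 ∣ a₃ W ∧ p^ 1 ∣ a₄ W ∧ p^ 1 ∣ a₆ W

    prepareCubic : Model → Model
    prepareCubic = shiftBy [0] (digits 0) (digits 1)
      λ W → p^ 1 ∣ a₁ W ∧ p^ 1 ∣ a₂ W ∧ p^ 2 ∣ a₃ W ∧ p^ 2 ∣ a₄ W ∧ p^ 3 ∣ a₆ W

    -- For the cubic T³ + (a₂/p) T² + (a₄/p²) T + (a₆/p³): its discriminant is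
    -- cubicDisc / p⁶, and when that vanishes mod p the cubic has a triple root
    -- mod p exactly if tripleTest / p² vanishes mod p.
    cubicDisc tripleTest : Model → ℤ
    cubicDisc (model _ b _ c d) =
      b * b * c * c - + 4 * c ^ 3 - + 4 * b ^ 3 * d - + 27 * d * d + + 18 * b * c * d
    tripleTest (model _ b _ c _) = b * b - + 3 * c

    doubleRootToZero : Model → Model
    doubleRootToZero = shiftBy (digits 1) [0] [0]
      λ W → p^ 3 ∣ a₄ W ∧ p^ 4 ∣ a₆ W

    tripleRootToZero : Model → Model
    tripleRootToZero = shiftBy (digits 1) [0] [0]
      λ W → p^ 2 ∣ a₂ W ∧ p^ 3 ∣ a₄ W ∧ p^ 4 ∣ a₆ W

    -- Types I*_(2k+1), I*_(2k+2), …: alternately test whether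
    -- Y² + (a₃/p^(k+2)) Y - a₆/p^(2k+4) and
    -- (a₂/p) X² + (a₄/p^(k+3)) X + a₆/p^(2k+5)
    -- have distinct roots mod p, moving the double root to 0 if not.
    starOdd starEven : ℕ → ℕ → Model → Kodaira × Model
    starOdd zero       k W = I* (2 ℕ.* k ℕ.+ 1) , W
    starOdd (suc fuel) k W =
      if p^ (2 ℕ.* k ℕ.+ 5) ∤ b₆ W
      then I* (2 ℕ.* k ℕ.+ 1) , W
      else starEven fuel k (shiftBy [0] [0] (digits (k ℕ.+ 2))
        (λ W′ → p^ (k ℕ.+ 3) ∣ a₃ W′ ∧ p^ (2 ℕ.* k ℕ.+ 5) ∣ a₆ W′) W)
    starEven zero       k W = I* (2 ℕ.* k ℕ.+ 2) , W
    starEven (suc fuel) k W =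
      if p^ (2 ℕ.* k ℕ.+ 7) ∤ (a₄ W * a₄ W - + 4 * a₂ W * a₆ W)
      then I* (2 ℕ.* k ℕ.+ 2) , W
      else starOdd fuel (suc k) (shiftBy (digits (k ℕ.+ 2)) [0] [0]
        (λ W′ → p^ (k ℕ.+ 4) ∣ a₄ W′ ∧ p^ (2 ℕ.* k ℕ.+ 6) ∣ a₆ W′) W)

    quadraticRootToZero : Model → Model
    quadraticRootToZero = shiftBy [0] [0] (digits 2)
      λ W → p^ 3 ∣ a₃ W ∧ p^ 5 ∣ a₆ W

    divideOut : Model → Model
    divideOut (model a₁ a₂ a₃ a₄ a₆) =
      model (a₁ ÷p^ 1) (a₂ ÷p^ 2) (a₃ ÷p^ 3) (a₄ ÷p^ 4) (a₆ ÷p^ 6)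
      where
      _÷p^_ : ℤ → ℕ → ℤ
      n ÷p^ k = (n /ℕ (p ℕ.^ k)) {{m^n≢0 p k}}

    -- Returns the Kodaira type and a model minimal at p.  The fuel bounds the
    -- number of passes through a non-minimal model, each of which lowers
    -- ord Δ by 12.
    tate pass additive cubicPhase cubicSingular triplePhase lastPhase :
      ℕ → Model → Kodaira × Model
    tate fuel W =
      if p^ 1 ∤ Δ W then I 0 , W else pass fuel (singularPointToOrigin W)
    pass fuel W =
      if p^ 1 ∤ b₂ W then I (ord (Δ W)) , W else additive fuel W
    additive fuel W =
      if p^ 2 ∤ a₆ W then II , W else
      if p^ 3 ∤ b₈ W then III , W else
      if p^ 3 ∤ b₆ W then IV , W else
      cubicPhase fuel (prepareCubic W)
    cubicPhase fuel W =
      if p^ 7 ∤ cubicDisc W then I* 0 , W else cubicSingular fuel W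
    cubicSingular fuel W =
      if p^ 3 ∤ tripleTest W
      then starOdd (ord (Δ W)) 0 (doubleRootToZero W)
      else triplePhase fuel (tripleRootToZero W)
    triplePhase fuel W =
      if p^ 5 ∤ b₆ W then IV* , W else lastPhase fuel (quadraticRootToZero W)
    lastPhase zero       W = II* , W
    lastPhase (suc fuel) W =
      if p^ 4 ∤ a₄ W then III* , W else
      if p^ 6 ∤ a₆ W then II* , W else
      tate fuel (divideOut W)

    ogg : Kodaira × Model → ℕ
    ogg (K , W) = (ord (Δ W) ℕ.+ 1) ℕ.∸ components K

    exponent : Model → ℕ
    exponent W = ogg (tate (suc (ord (Δ W))) W)

  localFactor : Model → (p : ℕ) → {{NonZero p}} → ℕ
  localFactor W p =
    if does (prime? p) then p ℕ.^ AtPrime.exponent p W else 1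

  -- Primes not dividing Δ have exponent 0, so p = suc k with k < ∣Δ∣ suffices.
  conductorOfModel : Model → ℕ
  conductorOfModel W = product (map (λ k → localFactor W (suc k)) (upTo ∣ Δ W ∣))

-- The curve y² = g(x).
record EllipticCurve : Set where
  field
    g         : ℚ[x]
    degree    : HasDegree g 3
    separable : Separable g

module EllipticCurves where
  open import Data.Rational.Base using (_+_; _*_; _-_; -_)
  open EllipticCurve

  -- Multiplying y² = c₃x³ + c₂x² + c₁x + c₀ by c₃² gives a monic equation in
  -- c₃x, c₃y.  Then clear denominators: with D a common denominator,
  -- (x, y) ↦ (D²x, D³y) multiplies aᵢ by Dⁱ.
  integralModel : EllipticCurve → Conductor.Model
  integralModel E = Conductor.model 0ℤ (↥ (A₂ * D²)) 0ℤ (↥ (A₄ * (D² * D²)))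
                                    (↥ (A₆ * (D² * D² * D²)))
    where
    c₃ A₂ A₄ A₆ D D² : ℚ
    c₃ = coeff (g E) 3
    A₂ = coeff (g E) 2
    A₄ = coeff (g E) 1 * c₃
    A₆ = coeff (g E) 0 * (c₃ * c₃)
    D  = fromℤ (+ (↧ₙ A₂ ℕ.* ↧ₙ A₄ ℕ.* ↧ₙ A₆))
    D² = D * D

  conductor : EllipticCurve → ℕ
  conductor E = Conductor.conductorOfModel (integralModel E)

  data Point : Set where
    O   : Point
    aff : (x y : ℚ) → Point

  neg : Point → Point
  neg O         = O
  neg (aff x y) = aff x (- y)

  -- The quadratic twist E_d : d y² = g(x); E itself is E_1.
  module Twist (E : EllipticCurve) (d : ℤ) where

    δ : ℚ
    δ = fromℤ d

    OnCurve : Point → Set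
    OnCurve O         = ⊤
    OnCurve (aff x y) = δ * (y * y) ≡ eval (g E) x

    -- The line of slope l through (x₁, y₁) and (x₂, y₂) meets the curve where
    -- c₃x³ + (c₂ - d l²)x² + … = 0, which gives the third root.
    chord : (l x₁ y₁ x₂ : ℚ) → Point
    chord l x₁ y₁ x₂ = aff x₃ (- (y₁ + l * (x₃ - x₁)))
      where
      x₃ : ℚ
      x₃ = (δ * (l * l) - coeff (g E) 2) ∕ coeff (g E) 3 - x₁ - x₂

    infixl 6 _⊞_
    _⊞_ : Point → Point → Point
    O         ⊞ Q = Q
    P         ⊞ O = P
    aff x₁ y₁ ⊞ aff x₂ y₂ with x₁ ℚₚ.≟ x₂ | y₁ + y₂ ℚₚ.≟ 0ℚ
    ... | no _  | _     = chord ((y₂ - y₁) ∕ (x₂ - x₁)) x₁ y₁ x₂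
    ... | yes _ | yes _ = O
    ... | yes _ | no _  =
      chord (eval (deriv (g E)) x₁ ∕ (δ * (y₁ + y₁))) x₁ y₁ x₂

    infixl 7 _×ℕ_ _×ℤ_
    _×ℕ_ : ℕ → Point → Point
    zero  ×ℕ P = O
    suc n ×ℕ P = P ⊞ (n ×ℕ P)

    _×ℤ_ : ℤ → Point → Point
    (+ n)    ×ℤ P = n ×ℕ P
    -[1+ n ] ×ℤ P = neg (suc n ×ℕ P)

    Independent : ∀ {r} → (Fin r → Point) → Set
    Independent {r} P = ∀ (n : Fin r → ℤ) →
      Vector.foldr _⊞_ O (λ i → n i ×ℤ P i) ≡ O → ∀ i → n i ≡ 0ℤ

    IndependentFamily : ℕ → Set
    IndependentFamily r = Σ (Fin r → Point) λ P → (∀ i → OnCurve (P i)) × Independent P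

    -- rank E_d(ℚ) = r
    HasRank : ℕ → Set
    HasRank r = IndependentFamily r × ¬ IndependentFamily (suc r)

  open Twist public using (HasRank)

open EllipticCurves public using (conductor; HasRank)

-- The ranks are asserted to exist (Mordell–Weil) as part of the statement that
-- mentions them.  Besides d being coprime to 2N, the discriminant of ℚ(√d) is
-- required to be coprime to N: for N even and d ≡ 3 (mod 4) one has χ_d(-N) = 0,
-- and the asserted equality would be absurd.
ParityConjecture : Set
ParityConjecture =
  ∀ (E : EllipticCurve) (d : ℤ) → Squarefree d →
  Coprime ∣ d ∣ (2 ℕ.* conductor E) →
  Coprime ∣ discQuadraticField d ∣ (conductor E) →
  ∃ λ r → ∃ λ r_d → HasRank E 1ℤ r × HasRank E d r_d ×
    -1ℤ ℤ.^ r_d ≡ -1ℤ ℤ.^ r ℤ.* χ d (ℤ.- (+ conductor E))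

{-# OPTIONS --safe #-}
-- A linear f takes every rational value, so squarefree numbers in arithmetic progressions suffice.
--
-- If f = a x² + b x + c has discriminant Δ, then a (X² - Δ v²) lies in f(ℚ) up to squares for all integers X and
-- v ≠ 0.  The form X² - Δ v² represents every class mod p, by the pigeonhole principle, and a sieve finds squarefree
-- values of it in a prescribed class: let X run through a long progression and v through a fixed number of columns.
-- A prime k divides X² - Δ v² twice only on two lines mod k².  Small k therefore spoil a small proportion of each
-- column.  For large k two points on the same line have a determinant less than k², hence zero, so k spoils at most
-- two points in all columns together; as there are O(|X|) such k, they are outnumbered once there are enough columns.
--
-- In degree 3, take d ≡ 1 modulo 24 times the conductor.  Then the Parity Conjecture relates the ranks of E and
-- E_d through the sign of d alone, so a suitable sign makes rank(E_d) odd.  A non-torsion point of E_d has y ≠ 0,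
-- since points with y = 0 are 2-torsion, and so d lies in S(f).  A quartic with a rational root ρ becomes a cubic
-- under x = ρ + 1/t.

module Submission where

open import Data.Bool.Base using (Bool; true; false; if_then_else_)
open import Data.Empty using (⊥)
open import Data.Fin.Base as Fin
  using (Fin; zero; suc; toℕ; fromℕ<; combine; remQuot; splitAt; join)
import Data.Fin.Properties as Fin
open import Data.Integer.Base as ℤ using (ℤ; +_; -[1+_]; 0ℤ; 1ℤ; ∣_∣)
open import Data.Integer.DivMod as ℤ using (_%ℕ_; _/ℕ_; n%ℕd<d; a≡a%ℕn+[a/ℕn]*n)
open import Data.Integer.Divisibility.Signed as ℤ∣
  using (∣ᵤ⇒∣; ∣⇒∣ᵤ; ∣m∣n⇒∣m+n; ∣m∣n⇒∣m-n; ∣n⇒∣m*n; ∣m⇒∣m*n)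
  renaming (_∣_ to _∣ᶻ_)
import Data.Integer.Properties as ℤ
import Data.Integer.Tactic.RingSolver as ℤSolver
open import Data.List.Base using (List; []; _∷_; upTo; map; foldr)
open import Data.List.Membership.Propositional using (_∈_)
open import Data.List.Membership.Propositional.Properties using (∈-upTo⁺)
open import Data.List.Relation.Unary.All using (All; []; _∷_)
open import Data.List.Relation.Unary.Any using (here; there)
open import Data.Nat.Base as ℕ hiding (∣_-_∣)
open import Data.Nat.Coprimality as Coprimality using (Coprime; coprime-Bézout; coprime-divisor)
open import Data.Nat.DivMod using (_/_; m/n*n≤m; m*n/n≡m; /-monoˡ-≤; m%n<n; m≡m%n+[m/n]*n; _%_)
open import Data.Nat.Divisibility
  using (_∣_; _∣?_; ∣⇒≤; ∣-trans; m∣m*n; divides; n∣m*n; ∣1⇒≡1; 0∣⇒≡0; *-pres-∣; ∣m+n∣m⇒∣n;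
    ∣-refl)
open import Data.Nat.GCD using (module Bézout)
open import Data.Nat.Induction using (<-rec)
open import Data.Nat.ListAction using (product)
open import Data.Nat.Primality
  using (Prime; prime?; ¬prime[0]; ¬prime[1]; composite[4]; composite⇒¬prime; euclidsLemma;
    prime⇒nonZero; prime⇒irreducible; prime[2]; prime⇒nonTrivial)
open import Data.Nat.Primality.Factorisation using (factorise; PrimeFactorisation)
open import Data.Nat.Properties
import Data.Nat.Tactic.RingSolver as ℕSolver
open import Data.Product.Base using (∃; _×_; _,_; proj₁; proj₂; ∃₂; uncurry)
open import Data.Rational.Base as ℚ using (ℚ; 0ℚ; 1ℚ; toℚᵘ; mkℚ)
import Data.Rational.Properties as ℚ
import Data.Rational.Unnormalised.Base as ℚᵘ
import Data.Rational.Unnormalised.Properties as ℚᵘ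
open import Data.Sum.Base as Sum using (_⊎_; inj₁; inj₂; [_,_]′)
import Data.Vec.Functional as Vector
open import Defs
open import Function.Base using (_∘_; it)
open import Relation.Binary.Definitions using (tri<; tri≈; tri>)
open import Relation.Binary.PropositionalEquality hiding (J)
open import Relation.Nullary hiding (det)
open import Relation.Nullary.Decidable
  using (from-yes; dec⇒maybe; dec-true; dec-false; decidable-stable)
import Tactic.RingSolver as RingSolver
open import Tactic.RingSolver.Core.AlmostCommutativeRing
  using (AlmostCommutativeRing; fromCommutativeRing)
open import Algebra.Properties.CommutativeMonoid.Sum +-0-commutativeMonoid
  using (sum; ∑-comm; ∑-distrib-+; sum-cong-≗)

-- Counting

-- The constants come from one budget. Over k ≥ 5 the terms 1/k² telescope to at most 1/4, and each
-- k has two bad lines, so the small k cost at most half of the points, up to lower-order terms.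
-- Starting at k = 3 the same bound would already cost all of them; hence all sieved values are kept
-- prime to 6. When a column has N points with X in steps of W, the large k run up to about W N and
-- cost 2 W N. With 8 W columns this is a quarter of the points, and the last quarter absorbs the
-- lower-order terms. Further columns help only if no two points of the box are proportional. So the
-- column coordinates are v times powers of some T prime to every X. Taking T ≡ 1 mod p keeps all
-- columns in one class mod p, and taking T divisible by M makes the form congruent to X², hence to
-- 1, mod M. In the elliptic part the sign of d has to be chosen from the rank of E, and that rank
-- is available only through the conjecture: it is read off at d = 1, and uniqueness of the rank
-- carries it over to the other d.

sum-mono : ∀ {n} {f g : Fin n → ℕ} → (∀ i → f i ≤ g i) → sum f ≤ sum g
sum-mono {zero}  f≤g = ≤-refl
sum-mono {suc n} f≤g = +-mono-≤ (f≤g zero) (sum-mono (f≤g ∘ suc))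

sum-const≤ : ∀ {n} (f : Fin n → ℕ) {c : ℕ} → (∀ i → f i ≤ c) → sum f ≤ n * c
sum-const≤ {zero}  f f≤c = ≤-refl
sum-const≤ {suc n} f f≤c = +-mono-≤ (f≤c zero) (sum-const≤ (f ∘ suc) (f≤c ∘ suc))

sum-≥n : ∀ {n} {f : Fin n → ℕ} → (∀ i → 1 ≤ f i) → n ≤ sum f
sum-≥n {zero}  1≤f = z≤n
sum-≥n {suc n} 1≤f = +-mono-≤ (1≤f zero) (sum-≥n (1≤f ∘ suc))

term≤sum : ∀ {n} (f : Fin n → ℕ) (i : Fin n) → f i ≤ sum f
term≤sum f zero    = m≤m+n _ _
term≤sum f (suc i) = ≤-trans (term≤sum (f ∘ suc) i) (m≤n+m _ (f zero))

sum-*ˡ : ∀ {n} (c : ℕ) (f : Fin n → ℕ) → sum (λ i → c * f i) ≡ c * sum f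
sum-*ˡ {zero}  c f = sym (*-zeroʳ c)
sum-*ˡ {suc n} c f =
  trans (cong (λ x → c * f zero + x) (sum-*ˡ c (f ∘ suc))) (sym (*-distribˡ-+ c (f zero) _))

indicator : {P : Set} → Dec P → ℕ
indicator (yes _) = 1
indicator (no  _) = 0

indicator-yes : {P : Set} (P? : Dec P) → P → 1 ≤ indicator P?
indicator-yes (yes _) _ = ≤-refl
indicator-yes (no ¬p) p = contradiction p ¬p

count : ∀ {n} {P : Fin n → Set} → (∀ i → Dec (P i)) → ℕ
count P? = sum (indicator ∘ P?)

count≡0 : ∀ {n} {P : Fin n → Set} (P? : ∀ i → Dec (P i)) → (∀ i → ¬ P i) → count P? ≡ 0
count≡0 {zero}  P? ¬P = refl
count≡0 {suc n} P? ¬P with P? zero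
... | yes p = contradiction p (¬P zero)
... | no  _ = count≡0 (P? ∘ suc) (¬P ∘ suc)

count≤1 : ∀ {n} {P : Fin n → Set} (P? : ∀ i → Dec (P i)) →
  (∀ i j → P i → P j → i ≡ j) → count P? ≤ 1
count≤1 {zero}  P? unique = z≤n
count≤1 {suc n} P? unique with P? zero
... | no  _ = count≤1 (P? ∘ suc) λ i j p q → Fin.suc-injective (unique (suc i) (suc j) p q)
... | yes p = s≤s (≤-reflexive (count≡0 (P? ∘ suc) λ i q → contradiction (unique zero (suc i) p q) λ ()))

-- Phrased through coincidences among three indices, because that is what two lines give: of three
-- points, two lie on the same line.
AtMostTwo : ∀ {n} → (Fin n → Set) → Set
AtMostTwo P = ∀ i j k → P i → P j → P k → i ≡ j ⊎ j ≡ k ⊎ i ≡ k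

count≤2 : ∀ {n} {P : Fin n → Set} (P? : ∀ i → Dec (P i)) → AtMostTwo P → count P? ≤ 2
count≤2 {zero}  P? two = z≤n
count≤2 {suc n} {P} P? two with P? zero
... | no  _ = count≤2 (P? ∘ suc) two′
  where
  two′ : AtMostTwo (P ∘ suc)
  two′ i j k p q r with two (suc i) (suc j) (suc k) p q r
  ... | inj₁ refl        = inj₁ refl
  ... | inj₂ (inj₁ refl) = inj₂ (inj₁ refl)
  ... | inj₂ (inj₂ refl) = inj₂ (inj₂ refl)
... | yes p = s≤s (count≤1 (P? ∘ suc) unique)
  where
  unique : ∀ i j → P (suc i) → P (suc j) → i ≡ j
  unique i j q r with two zero (suc i) (suc j) p q r
  ... | inj₂ (inj₁ refl) = refl

-- Each point is counted in the fibre over its own image; exchanging the two sums then bounds the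
-- count fibre by fibre.
count-fibres : ∀ {n m} {P : Fin n → Set} (P? : ∀ i → Dec (P i)) (φ : Fin n → Fin m) →
  (∀ t → AtMostTwo (λ i → P i × φ i ≡ t)) → count P? ≤ m * 2
count-fibres {n} {m} {P} P? φ two = begin
  count P?                                        ≤⟨ sum-mono bound ⟩
  sum (λ i → sum (λ t → indicator (Pφ? t i)))     ≡⟨ ∑-comm (λ i t → indicator (Pφ? t i)) ⟩
  sum (λ t → count (Pφ? t))                       ≤⟨ sum-const≤ (λ t → count (Pφ? t)) (λ t → count≤2 (Pφ? t) (two t)) ⟩
  m * 2                                           ∎
  where
  open ≤-Reasoning
  Pφ? : ∀ t i → Dec (P i × φ i ≡ t)
  Pφ? t i = P? i ×-dec (φ i Fin.≟ t)
  bound : ∀ i → indicator (P? i) ≤ sum (λ t → indicator (Pφ? t i))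
  bound i = ≤-trans (split (P? i)) (term≤sum (λ t → indicator (Pφ? t i)) (φ i))
    where
    split : (p? : Dec (P i)) → indicator p? ≤ indicator (p? ×-dec (φ i Fin.≟ φ i))
    split (no  _) = z≤n
    split (yes p) = indicator-yes (yes p ×-dec (φ i Fin.≟ φ i)) (p , refl)

-- The integral form of 1/k² ≤ 1/(k-1) - 1/k.
floor-telescope : ∀ N c → N / (suc (suc c) * suc (suc c)) + N / suc (suc c) ≤ N / suc c
floor-telescope N c = sum≤quot
  where
  k = suc (suc c)
  a = N / (k * k)
  b = N / k
  ≤quot : ∀ x d .{{_ : NonZero d}} → x * d ≤ N → x ≤ N / d
  ≤quot x d le = subst (_≤ N / d) (m*n/n≡m x d) (/-monoˡ-≤ d le)
  ak≤b : a * k ≤ b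
  ak≤b = ≤quot (a * k) k (subst (_≤ N) (sym (*-assoc a k k)) (m/n*n≤m N (k * k)))
  sum≤quot : a + b ≤ N / suc c
  sum≤quot = ≤quot (a + b) (suc c) (begin
    (a + b) * suc c         ≡⟨ *-distribʳ-+ (suc c) a b ⟩
    a * suc c + b * suc c   ≤⟨ +-monoˡ-≤ (b * suc c) (*-monoʳ-≤ a (n≤1+n (suc c))) ⟩
    a * k + b * suc c       ≤⟨ +-monoˡ-≤ (b * suc c) ak≤b ⟩
    b + b * suc c           ≡⟨ sym (*-suc b (suc c)) ⟩
    b * k                   ≤⟨ m/n*n≤m N k ⟩
    N                       ∎)
    where open ≤-Reasoning

sum-floor-squares : ∀ K N c →
  sum {K} (λ i → N / (suc (suc (c + toℕ i)) * suc (suc (c + toℕ i)))) ≤ N / suc c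
sum-floor-squares zero    N c = z≤n
sum-floor-squares (suc K) N c = begin
  N / (suc (suc (c + 0)) * suc (suc (c + 0))) + sum {K} (λ i → t (c + suc (toℕ i)))
    ≡⟨ cong₂ _+_ (cong t (+-identityʳ c)) (sum-cong-≗ {K} (λ i → cong t (+-suc c (toℕ i)))) ⟩
  t c + sum {K} (λ i → t (suc c + toℕ i))
    ≤⟨ +-monoʳ-≤ (t c) (sum-floor-squares K N (suc c)) ⟩
  t c + N / suc (suc c)
    ≤⟨ floor-telescope N c ⟩
  N / suc c ∎
  where
  open ≤-Reasoning
  t : ℕ → ℕ
  t x = N / (suc (suc x) * suc (suc x))

-- A union bound over primes k, for `L` columns of `N` points. A fibre of `φ` stands for a block of
-- k² points in one column, where k kills at most two. From `Q` on, k kills at most two points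
-- altogether, and beyond `Q + R` its square exceeds every value. The last hypothesis says that the
-- total of the kills is less than `n`. Writing a small prime as 2 + k makes the divisor k² visibly
-- nonzero.
sieve : ∀ {n} (G : Fin n → ℕ) (L N Q R : ℕ) →
  (∀ i → 0 < G i) → (∀ i → G i < (Q + R) * (Q + R)) →
  (∀ i → ¬ 2 ∣ G i) → (∀ i → ¬ 3 ∣ G i) →
  (∀ k → Prime (2 + k) → ∃ λ (φ : Fin n → Fin (L * suc (N / ((2 + k) * (2 + k))))) →
    ∀ t → AtMostTwo (λ i → (2 + k) * (2 + k) ∣ G i × φ i ≡ t)) →
  (∀ k → Prime k → Q ≤ k → AtMostTwo (λ i → k * k ∣ G i)) →
  2 * L * (N / 4) + Q * (2 * L) + R * 2 < n →
  ∃ λ i → ∀ k → Prime k → ¬ k * k ∣ G i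
sieve {n} G L N Q R G>0 G< 2∤G 3∤G small large total<n =
  conclude (Fin.any? (λ i → sum (killedSmall i) + sum (killedLarge i) ≟ 0))
  where
  open ≤-Reasoning
  kills? : ∀ k i → Dec (Prime k × k * k ∣ G i)
  kills? k i = prime? k ×-dec (k * k ∣? G i)
  -- Counting starts at 5, as 2 and 3 never divide a value and 4 is not prime.
  killedSmall : Fin n → Fin Q → ℕ
  killedSmall i e = indicator (kills? (5 + toℕ e) i)
  killedLarge : Fin n → Fin R → ℕ
  killedLarge i e = indicator (kills? (5 + (Q + toℕ e)) i)
  large-bound : ∀ e → sum (λ i → killedLarge i e) ≤ 2
  large-bound e = count≤2 (kills? (5 + (Q + toℕ e))) λ i j k (pr , p) (_ , q) (_ , r) →
    large (5 + (Q + toℕ e)) pr (≤-trans (m≤m+n Q (toℕ e)) (m≤n+m _ 5)) i j k p q r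
  w : ℕ → ℕ
  w e = N / ((5 + e) * (5 + e))
  expand : ∀ L x → L * suc x * 2 ≡ 2 * L * x + 2 * L
  expand = ℕSolver.solve-∀
  small-bound : ∀ e → sum (λ i → killedSmall i e) ≤ 2 * L * w (toℕ e) + 2 * L
  small-bound e with prime? (5 + toℕ e)
  ... | no  _  = ≤-trans (≤-reflexive (count≡0 {n} (λ _ → no (λ (p : ⊥) → p)) λ _ p → p)) z≤n
  ... | yes pr = ≤-trans
    (count-fibres (λ i → (yes pr ×-dec ((5 + toℕ e) * (5 + toℕ e) ∣? G i))) (proj₁ sm) λ t i j k ((_ , p) , a) ((_ , q) , b)
        ((_ , r) , c) → proj₂ sm t i j k (p , a) (q , b) (r , c))
    (≤-reflexive (expand L (w (toℕ e))))
    where sm = small (3 + toℕ e) pr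
  small-total : sum (λ e → sum (λ i → killedSmall i e)) ≤ 2 * L * (N / 4) + Q * (2 * L)
  small-total = begin
    sum (λ e → sum (λ i → killedSmall i e))
      ≤⟨ sum-mono small-bound ⟩
    sum {Q} (λ e → 2 * L * w (toℕ e) + 2 * L)
      ≡⟨ ∑-distrib-+ {Q} (λ e → 2 * L * w (toℕ e)) (λ _ → 2 * L) ⟩
    sum {Q} (λ e → 2 * L * w (toℕ e)) + sum {Q} (λ _ → 2 * L)
      -- The sum runs over all integers k ≥ 5, prime or not; 5 = 2 + 3, so the telescope starts at c
      -- = 3 and yields `N / 4`.
      ≤⟨ +-mono-≤ (≤-trans (≤-reflexive (sum-*ˡ {Q} (2 * L) (w ∘ toℕ))) (*-monoʳ-≤ (2 * L) (sum-floor-squares Q N 3)))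
                  (sum-const≤ {Q} (λ _ → 2 * L) (λ _ → ≤-refl)) ⟩
    2 * L * (N / 4) + Q * (2 * L) ∎
  conclude : Dec (∃ λ i → sum (killedSmall i) + sum (killedLarge i) ≡ 0) →
    ∃ λ i → ∀ k → Prime k → ¬ k * k ∣ G i
  conclude (no all-killed) = contradiction total<n (≤⇒≯ (begin
    n
      ≤⟨ sum-≥n (λ i → n≢0⇒n>0 λ eq → all-killed (i , eq)) ⟩
    sum (λ i → sum (killedSmall i) + sum (killedLarge i))
      ≡⟨ ∑-distrib-+ (λ i → sum (killedSmall i)) (λ i → sum (killedLarge i)) ⟩
    sum (λ i → sum (killedSmall i)) + sum (λ i → sum (killedLarge i))
      ≡⟨ cong₂ _+_ (∑-comm killedSmall) (∑-comm killedLarge) ⟩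
    sum (λ e → sum (λ i → killedSmall i e)) + sum (λ e → sum (λ i → killedLarge i e))
      ≤⟨ +-mono-≤ small-total (sum-const≤ (λ e → sum (λ i → killedLarge i e)) large-bound) ⟩
    2 * L * (N / 4) + Q * (2 * L) + R * 2 ∎))
  conclude (yes (i , none)) = i , survives
    where
    large-prime : ∀ e → Prime (5 + e) → ¬ (5 + e) * (5 + e) ∣ G i
    large-prime e pr k²∣G with e <? Q
    ... | yes e<Q = 1+n≰n (begin
      1                                               ≤⟨ indicator-yes (kills? (5 + e) i) (pr , k²∣G) ⟩
      indicator (kills? (5 + e) i)                    ≡⟨ cong (λ x → indicator (kills? (5 + x) i)) (sym (Fin.toℕ-fromℕ< e<Q)) ⟩
      indicator (kills? (5 + toℕ (fromℕ< e<Q)) i)     ≤⟨ term≤sum {Q} (λ e → indicator (kills? (5 + toℕ e) i)) (fromℕ< e<Q) ⟩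
      _                                               ≡⟨ m+n≡0⇒m≡0 _ none ⟩
      0                                               ∎)
    ... | no e≮Q = 1+n≰n (begin
      1                                                 ≤⟨ indicator-yes (kills? (5 + e) i) (pr , k²∣G) ⟩
      indicator (kills? (5 + e) i)                      ≡⟨ cong (λ x → indicator (kills? (5 + x) i)) e≡ ⟩
      indicator (kills? (5 + (Q + toℕ (fromℕ< e<R))) i) ≤⟨ term≤sum {R} (λ e → indicator (kills? (5 + (Q + toℕ e)) i)) (fromℕ< e<R) ⟩
      _                                                 ≡⟨ m+n≡0⇒n≡0 (sum {Q} (λ e → indicator (kills? (5 + toℕ e) i))) none ⟩
      0                                                 ∎)
      where
      Q≤e = ≮⇒≥ e≮Q
      -- The value is positive, so its divisor k² is at most `G i` and thus below (Q + R)².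
      k<Q+R : 5 + e < Q + R
      k<Q+R = ≰⇒> λ le → <⇒≱ (G< i)
        (≤-trans (*-mono-≤ le le) (∣⇒≤ {{>-nonZero (G>0 i)}} k²∣G))
      e<R : e ∸ Q < R
      e<R = +-cancelˡ-< Q _ _ (subst (_< Q + R) (sym (m+[n∸m]≡n Q≤e)) (≤-<-trans (m≤n+m e 5) k<Q+R))
      e≡ : e ≡ Q + toℕ (fromℕ< e<R)
      e≡ = trans (sym (m+[n∸m]≡n Q≤e)) (cong (λ x → Q + x) (sym (Fin.toℕ-fromℕ< e<R)))
    survives : ∀ k → Prime k → ¬ k * k ∣ G i
    survives 0 pr k²∣G = ¬prime[0] pr
    survives 1 pr k²∣G = ¬prime[1] pr
    survives 2 pr k²∣G = 2∤G i (∣-trans (m∣m*n 2) k²∣G)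
    survives 3 pr k²∣G = 3∤G i (∣-trans (m∣m*n 3) k²∣G)
    survives 4 pr k²∣G = composite⇒¬prime composite[4] pr
    survives (suc (suc (suc (suc (suc e))))) = large-prime e

-- Primes and congruences

prime-divisor : ∀ n → n ≢ 0 → n ≢ 1 → ∃ λ q → Prime q × q ∣ n
prime-divisor zero    n≢0 n≢1 = contradiction refl n≢0
prime-divisor (suc n) n≢0 n≢1 = first (factorise (suc n))
  where
  open PrimeFactorisation
  first : PrimeFactorisation (suc n) → _
  first record { factors = []     ; isFactorisation = eq } = contradiction eq n≢1
  first record { factors = q ∷ qs ; isFactorisation = eq ; factorsPrime = pq ∷ _ } =
    q , pq , subst (q ∣_) (sym eq) (m∣m*n (product qs))

coprime-by-primes : ∀ {m n} → m ≢ 0 → (∀ q → Prime q → q ∣ m → ¬ q ∣ n) → Coprime m n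
coprime-by-primes {m} m≢0 apart {d} (d∣m , d∣n) with d ≟ 1
... | yes d≡1 = d≡1
... | no  d≢1 with prime-divisor d (λ { refl → m≢0 (0∣⇒≡0 d∣m) }) d≢1
...   | q , pq , q∣d = contradiction (∣-trans q∣d d∣n) (apart q pq (∣-trans q∣d d∣m))

prime∣prime : ∀ {q p} → Prime q → Prime p → q ∣ p → q ≡ p
prime∣prime pq pp q∣p with prime⇒irreducible pp q∣p
... | inj₁ refl = contradiction pq ¬prime[1]
... | inj₂ q≡p  = q≡p

prime-coprime : ∀ {p m} → Prime p → ¬ p ∣ m → Coprime p m
prime-coprime {p} pp p∤m = coprime-by-primes (≢-nonZero⁻¹ p {{prime⇒nonZero pp}}) λ q pq q∣p q∣m →
  p∤m (subst (_∣ _) (prime∣prime pq pp q∣p) q∣m)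

squarefree-by-primes : ∀ d → ∣ d ∣ ≢ 0 → (∀ q → Prime q → ¬ q * q ∣ ∣ d ∣) → Squarefree d
squarefree-by-primes d d≢0 none k k²∣d with k ≟ 1
... | yes k≡1 = k≡1
... | no  k≢1 with prime-divisor k (λ { refl → d≢0 (0∣⇒≡0 k²∣d) }) k≢1
...   | q , pq , q∣k = contradiction (∣-trans (*-pres-∣ q∣k q∣k) k²∣d) (none q pq)

+∣+ : ∀ {m n} → m ∣ n → + m ∣ᶻ + n
+∣+ = ∣ᵤ⇒∣

euclidℤ : ∀ {k} x y → Prime k → + k ∣ᶻ x ℤ.* y → + k ∣ᶻ x ⊎ + k ∣ᶻ y
euclidℤ {k} x y pk k∣xy =
  Sum.map ∣ᵤ⇒∣ ∣ᵤ⇒∣ (euclidsLemma ∣ x ∣ ∣ y ∣ pk (subst (k ∣_) (ℤ.abs-* x y) (∣⇒∣ᵤ k∣xy)))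

euclidℤ² : ∀ {k} x → Prime k → + k ∣ᶻ x ℤ.* x → + k ∣ᶻ x
euclidℤ² x pk k∣x² = [ (λ d → d) , (λ d → d) ]′ (euclidℤ x x pk k∣x²)

square-∣ : ∀ {k z} → + (k * k) ∣ᶻ z → + k ∣ᶻ z
square-∣ {k} = ℤ∣.∣-trans (∣ᵤ⇒∣ (m∣m*n k))

prime²-cancel : ∀ {k} m x → Prime k → ¬ + k ∣ᶻ m → + (k * k) ∣ᶻ m ℤ.* x → + (k * k) ∣ᶻ x
prime²-cancel {k} m x pk k∤m k²∣mx with euclidℤ m x pk (square-∣ k²∣mx)
... | inj₁ k∣m = contradiction k∣m k∤m
... | inj₂ (ℤ∣.divides y refl) with euclidℤ m y pk k∣my
  where
  instance
    _ = prime⇒nonZero pk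
  k∣my : + k ∣ᶻ m ℤ.* y
  k∣my = ℤ∣.*-cancelʳ-∣ (+ k) (subst₂ _∣ᶻ_ (ℤ.pos-* k k) (sym (ℤ.*-assoc m y (+ k))) k²∣mx)
...   | inj₁ k∣m = contradiction k∣m k∤m
...   | inj₂ k∣y = subst (_∣ᶻ y ℤ.* + k) (sym (ℤ.pos-* k k)) (ℤ∣.*-monoˡ-∣ (+ k) k∣y)

≡-of-∣<-ℤ : ∀ D x → D ∣ ∣ x ∣ → ∣ x ∣ < D → x ≡ 0ℤ
≡-of-∣<-ℤ D x D∣x x<D with ∣ x ∣ ≟ 0
... | yes eq = ℤ.∣i∣≡0⇒i≡0 eq
... | no neq = contradiction (∣⇒≤ {{≢-nonZero neq}} D∣x) (<⇒≱ x<D)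

∣m-n∣≤⊔ : ∀ m n → ∣ + m ℤ.- + n ∣ ≤ m ⊔ n
∣m-n∣≤⊔ m n = subst (λ z → ∣ z ∣ ≤ m ⊔ n) (sym (ℤ.m-n≡m⊖n m n)) (ℤ.∣m⊝n∣≤m⊔n m n)

congruent-close : ∀ {D m n} → + D ∣ᶻ + m ℤ.- + n → m < D → n < D → m ≡ n
congruent-close {D} {m} {n} d m<D n<D = ℤ.+-injective
  (ℤ.i-j≡0⇒i≡j (+ m) (+ n) (≡-of-∣<-ℤ D _ (∣⇒∣ᵤ d) (≤-<-trans (∣m-n∣≤⊔ m n) (⊔-lub m<D n<D))))

-- The quotient by `D` names the block of length `D` that contains the number, and a block meets
-- each class once. With D = k² the quotient serves as fibre map in the sieve.
congruent-same-quotient : ∀ {D m n} .{{_ : NonZero D}} →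
  + D ∣ᶻ + m ℤ.- + n → m / D ≡ n / D → m ≡ n
congruent-same-quotient {D} {m} {n} d quot = begin
  m                  ≡⟨ m≡m%n+[m/n]*n m D ⟩
  m % D + m / D * D  ≡⟨ cong₂ (λ r q → r + q * D) same-rem quot ⟩
  n % D + n / D * D  ≡⟨ m≡m%n+[m/n]*n n D ⟨
  n                  ∎
  where
  open ≡-Reasoning
  as-ℤ : ∀ m → + m ≡ + (m % D) ℤ.+ + (m / D) ℤ.* + D
  as-ℤ m = trans (cong +_ (m≡m%n+[m/n]*n m D)) (trans (ℤ.pos-+ (m % D) _) (cong (λ z → + (m % D) ℤ.+ z) (ℤ.pos-* (m / D) D)))
  rearrange : ∀ r q r′ D → r ℤ.- r′ ≡ (r ℤ.+ q ℤ.* D) ℤ.- (r′ ℤ.+ q ℤ.* D)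
  rearrange = ℤSolver.solve-∀
  same-rem : m % D ≡ n % D
  same-rem = congruent-close (subst (+ D ∣ᶻ_)
    (trans (cong₂ ℤ._-_ (as-ℤ m) (trans (as-ℤ n) (cong (λ q → + (n % D) ℤ.+ + q ℤ.* + D) (sym quot))))
           (sym (rearrange (+ (m % D)) (+ (m / D)) (+ (n % D)) (+ D)))) d) (m%n<n m D) (m%n<n n D)

large-representative : ∀ W B x → .{{NonZero W}} → ∃ λ n → B ≤ n × + W ∣ᶻ + n ℤ.- x
large-representative W@(suc w) B (+ a) = a + W * B , ≤-trans (m≤n*m B W) (m≤n+m _ a) ,
  subst (+ W ∣ᶻ_) (sym (trans (cong (ℤ._- + a) (ℤ.pos-+ a (W * B))) (cancel (+ a) (+ (W * B))))) (∣ᵤ⇒∣ (m∣m*n B))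
  where
  cancel : ∀ a b → a ℤ.+ b ℤ.- a ≡ b
  cancel = ℤSolver.solve-∀
-- Modulo W = w + 1, the number -(a + 1) is congruent to w (a + 1), which is a natural number.
large-representative W@(suc w) B -[1+ a ] = w * suc a + W * B , ≤-trans (m≤n*m B W) (m≤n+m _ (w * suc a)) ,
  ∣ᵤ⇒∣ (subst (W ∣_) (regroup w (suc a) B) (m∣m*n (suc a + B)))
  where
  regroup : ∀ w a B → suc w * (a + B) ≡ w * a + suc w * B + a
  regroup = ℕSolver.solve-∀

Bézoutℤ : ∀ {m n} → Coprime m n → ∃₂ λ u w → u ℤ.* + m ℤ.+ w ℤ.* + n ≡ 1ℤ
Bézoutℤ {m} {n} c with coprime-Bézout c
... | Bézout.+- x y eq = + x , ℤ.- + y , trans (cong (ℤ._+ _) (sym (trans (sym (cong (λ z → 1ℤ ℤ.+ z) (ℤ.pos-* y n))) (trans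
    (cong +_ eq) (ℤ.pos-* x m))))) (cancel (+ y) (+ n))
  where
  cancel : ∀ y n → 1ℤ ℤ.+ y ℤ.* n ℤ.+ (ℤ.- y) ℤ.* n ≡ 1ℤ
  cancel = ℤSolver.solve-∀
... | Bézout.-+ x y eq = ℤ.- + x , + y , trans (cong (λ z → (ℤ.- + x) ℤ.* + m ℤ.+ z) (sym (trans (sym (cong (λ z → 1ℤ ℤ.+ z)
    (ℤ.pos-* x m))) (trans (cong +_ eq) (ℤ.pos-* y n))))) (cancel (+ x) (+ m))
  where
  cancel : ∀ y n → (ℤ.- y) ℤ.* n ℤ.+ (1ℤ ℤ.+ y ℤ.* n) ≡ 1ℤ
  cancel = ℤSolver.solve-∀

shift-∣ : ∀ {c} x y z → c ∣ᶻ x ℤ.- y → c ∣ᶻ y ℤ.- z → c ∣ᶻ x ℤ.- z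
shift-∣ {c} x y z p q = subst (c ∣ᶻ_) (telescope x y z) (∣m∣n⇒∣m+n p q)
  where
  telescope : ∀ x y z → (x ℤ.- y) ℤ.+ (y ℤ.- z) ≡ x ℤ.- z
  telescope = ℤSolver.solve-∀

chineseRemainder : ∀ m n B → .{{NonZero m}} → .{{NonZero n}} → Coprime m n → ∀ a b →
  ∃ λ x → B ≤ x × + m ∣ᶻ + x ℤ.- a × + n ∣ᶻ + x ℤ.- b
chineseRemainder m n B c a b with Bézoutℤ c
... | u , w , bez with large-representative (m * n) B (a ℤ.* (w ℤ.* + n) ℤ.+ b ℤ.* (u ℤ.* + m)) {{m*n≢0 m n}}
...   | x , B≤x , d = x , B≤x ,
        shift-∣ (+ x) x₀ a (ℤ∣.∣-trans (∣ᵤ⇒∣ (m∣m*n n)) d) (ℤ∣.divides ((b ℤ.- a) ℤ.* u) (trans (cong (λ z → x₀ ℤ.- z)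
            (trans (sym (ℤ.*-identityʳ a)) (cong (a ℤ.*_) (sym bez)))) (e₁ a b u w (+ m) (+ n)))) ,
        shift-∣ (+ x) x₀ b (ℤ∣.∣-trans (∣ᵤ⇒∣ (n∣m*n m)) d) (ℤ∣.divides ((a ℤ.- b) ℤ.* w) (trans (cong (λ z → x₀ ℤ.- z)
            (trans (sym (ℤ.*-identityʳ b)) (cong (b ℤ.*_) (sym bez)))) (e₂ a b u w (+ m) (+ n))))
  where
  x₀ = a ℤ.* (w ℤ.* + n) ℤ.+ b ℤ.* (u ℤ.* + m)
  e₁ : ∀ a b u w m n → a ℤ.* (w ℤ.* n) ℤ.+ b ℤ.* (u ℤ.* m) ℤ.- a ℤ.* (u ℤ.* m ℤ.+ w ℤ.* n) ≡ (b ℤ.- a) ℤ.* u ℤ.* m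
  e₁ = ℤSolver.solve-∀
  e₂ : ∀ a b u w m n → a ℤ.* (w ℤ.* n) ℤ.+ b ℤ.* (u ℤ.* m) ℤ.- b ℤ.* (u ℤ.* m ℤ.+ w ℤ.* n) ≡ (a ℤ.- b) ℤ.* w ℤ.* n
  e₂ = ℤSolver.solve-∀

-- Squarefree numbers in arithmetic progressions

prime[3] : Prime 3
prime[3] = from-yes (prime? 3)

-- One column suffices here: over h² terms the values stay below Q² with Q = (r + m) h + 1, of order
-- h only, so R = 0. The loss 2 Q has to fit into the half of h² that the main term leaves, that is
-- 4 Q < h², and h = 4 (r + m) + 5 achieves this.
squarefree-in-progression : ∀ r m .{{_ : NonZero m}} → 6 ∣ m →
  (∀ q → Prime q → q ∣ m → ¬ q ∣ r) → ∃ λ n → Squarefree (+ (r + m * n))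
squarefree-in-progression r m 6∣m apart =
  toℕ (proj₁ survivor) , squarefree-by-primes (+ (r + m * toℕ (proj₁ survivor))) (λ eq → G≢0 (toℕ (proj₁ survivor)) eq) (proj₂ survivor)
  where
  h = 4 * (r + m) + 5
  N = h * h
  Q = suc ((r + m) * h)
  G : ℕ → ℕ
  G n = r + m * n
  q∤G : ∀ {q} → Prime q → q ∣ m → ∀ n → ¬ q ∣ G n
  q∤G {q} pq q∣m n q∣G = apart _ pq q∣m (∣m+n∣m⇒∣n (subst (λ x → q ∣ x) (+-comm r (m * n)) q∣G) (∣-trans q∣m (m∣m*n n)))
  G≢0 : ∀ n → G n ≢ 0
  G≢0 n eq = q∤G prime[2] (∣-trans (divides 3 refl) 6∣m) n (subst (2 ∣_) (sym eq) (divides 0 refl))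
  G< : ∀ (i : Fin N) → G (toℕ i) < (Q + 0) * (Q + 0)
  G< i = begin-strict
    r + m * toℕ i                 ≤⟨ +-monoʳ-≤ r (*-monoʳ-≤ m (<⇒≤ (Fin.toℕ<n i))) ⟩
    r + m * (h * h)               ≤⟨ +-monoˡ-≤ _ (m≤m*n r (h * h) {{m*n≢0 h h {{h≢0}} {{h≢0}}}}) ⟩
    r * (h * h) + m * (h * h)     ≡⟨ *-distribʳ-+ (h * h) r m ⟨
    (r + m) * (h * h)             ≤⟨ m≤n*m _ (r + m) {{>-nonZero (≤-trans (>-nonZero⁻¹ m) (m≤n+m m r))}} ⟩
    (r + m) * ((r + m) * (h * h)) ≡⟨ regroup (r + m) h ⟩
    (r + m) * h * ((r + m) * h)   <⟨ *-mono-< (n<1+n ((r + m) * h)) (n<1+n ((r + m) * h)) ⟩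
    Q * Q                         ≡⟨ cong (λ x → x * x) (+-identityʳ Q) ⟨
    (Q + 0) * (Q + 0) ∎
    where
    open ≤-Reasoning
    h≢0 : NonZero h
    h≢0 = >-nonZero (≤-trans (s≤s z≤n) (m≤n+m 5 (4 * (r + m))))
    regroup : ∀ s h → s * (s * (h * h)) ≡ s * h * (s * h)
    regroup = ℕSolver.solve-∀
  congruent : ∀ k → Prime k → ∀ {n n′} → k * k ∣ G n → k * k ∣ G n′ → + (k * k) ∣ᶻ + n ℤ.- + n′
  congruent k pk {n} {n′} p q = prime²-cancel (+ m) _ pk k∤m
    (subst (+ (k * k) ∣ᶻ_) (trans (cong₂ ℤ._-_ (as-ℤ n) (as-ℤ n′)) (difference (+ r) (+ m) (+ n) (+ n′)))
      (∣m∣n⇒∣m-n {_} {+ (r + m * n)} {+ (r + m * n′)} (∣ᵤ⇒∣ p) (∣ᵤ⇒∣ q)))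
    where
    as-ℤ : ∀ n → + (r + m * n) ≡ + r ℤ.+ + m ℤ.* + n
    as-ℤ n = cong (λ z → + r ℤ.+ z) (ℤ.pos-* m n)
    difference : ∀ r m n n′ → (r ℤ.+ m ℤ.* n) ℤ.- (r ℤ.+ m ℤ.* n′) ≡ m ℤ.* (n ℤ.- n′)
    difference = ℤSolver.solve-∀
    k∤m : ¬ + k ∣ᶻ + m
    k∤m k∣m = q∤G pk (∣⇒∣ᵤ k∣m) n (∣-trans (m∣m*n k) p)
  small : ∀ k → Prime (2 + k) → ∃ λ (φ : Fin N → Fin (1 * suc (N / ((2 + k) * (2 + k))))) →
    ∀ t → AtMostTwo (λ i → (2 + k) * (2 + k) ∣ G (toℕ i) × φ i ≡ t)
  -- A linear value has one bad class mod k² instead of two lines, so the first two of any three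
  -- indices in a fibre already agree.
  small k pk = φ , λ t i j _ (p , φi) (q , φj) _ → inj₁ (Fin.toℕ-injective
    (congruent-same-quotient (congruent (2 + k) pk {toℕ i} {toℕ j} p q)
      (trans (sym (Fin.toℕ-fromℕ< (φ< i))) (trans (cong toℕ (trans φi (sym φj))) (Fin.toℕ-fromℕ< (φ< j))))))
    where
    φ< : ∀ (i : Fin N) → toℕ i / ((2 + k) * (2 + k)) < 1 * suc (N / ((2 + k) * (2 + k)))
    φ< i = ≤-trans (s≤s (/-monoˡ-≤ _ (<⇒≤ (Fin.toℕ<n i)))) (≤-reflexive (sym (*-identityˡ _)))
    φ : Fin N → Fin (1 * suc (N / ((2 + k) * (2 + k))))
    φ i = fromℕ< (φ< i)
  large : ∀ k → Prime k → Q ≤ k → AtMostTwo (λ (i : Fin N) → k * k ∣ G (toℕ i))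
  large k pk Q≤k i j _ p q _ = inj₁ (Fin.toℕ-injective (congruent-close (congruent k pk {toℕ i} {toℕ j} p q) (i<k² i) (i<k² j)))
    where
    open ≤-Reasoning
    i<k² : ∀ (i : Fin N) → toℕ i < k * k
    i<k² i = begin-strict
      toℕ i                  <⟨ Fin.toℕ<n i ⟩
      h * h                  ≤⟨ *-mono-≤ h≤Q h≤Q ⟩
      Q * Q                  ≤⟨ *-mono-≤ Q≤k Q≤k ⟩
      k * k                  ∎
      where
      h≤Q : h ≤ Q
      h≤Q = ≤-trans (m≤n*m h (r + m) {{>-nonZero (≤-trans (>-nonZero⁻¹ m) (m≤n+m m r))}}) (n≤1+n _)
  total : 2 * 1 * (N / 4) + Q * (2 * 1) + 0 * 2 < N
  total = *-cancelˡ-< 2 _ _ (begin-strict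
    2 * (2 * 1 * (N / 4) + Q * (2 * 1) + 0 * 2) ≡⟨ expand (N / 4) Q ⟩
    N / 4 * 4 + 4 * Q                           ≤⟨ +-monoˡ-≤ (4 * Q) (m/n*n≤m N 4) ⟩
    N + 4 * Q                                   <⟨ +-monoʳ-< N (≤-trans (s≤s (m≤m+n (4 * Q) (20 * s + 20))) (≤-reflexive (square s))) ⟩
    N + N                                       ≡⟨ cong (λ x → N + x) (+-identityʳ N) ⟨
    2 * N ∎)
    where
    open ≤-Reasoning
    s = r + m
    expand : ∀ x Q → 2 * (2 * 1 * x + Q * (2 * 1) + 0 * 2) ≡ x * 4 + 4 * Q
    expand = ℕSolver.solve-∀
    square : ∀ s → suc (4 * suc (s * (4 * s + 5)) + (20 * s + 20)) ≡ (4 * s + 5) * (4 * s + 5)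
    square = ℕSolver.solve-∀
  survivor : ∃ λ (i : Fin N) → ∀ k → Prime k → ¬ k * k ∣ G (toℕ i)
  survivor = sieve (G ∘ toℕ) 1 N Q 0 (λ i → n≢0⇒n>0 (G≢0 (toℕ i))) G<
    (λ i → q∤G prime[2] (∣-trans (divides 3 refl) 6∣m) (toℕ i))
    (λ i → q∤G prime[3] (∣-trans (divides 2 refl) 6∣m) (toℕ i))
    small large total

-- Squarefree values of X² - Δ v²

normForm : ℤ → ℤ → ℤ → ℤ
normForm Δ x v = x ℤ.* x ℤ.- Δ ℤ.* (v ℤ.* v)

det : ℤ × ℤ → ℤ × ℤ → ℤ
det (x , v) (x′ , v′) = x ℤ.* v′ ℤ.- x′ ℤ.* v

-- k² divides (x v′ - x′ v)(x v′ + x′ v), while k divides at most one of the factors, their sum being 2 x v′.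
det-or-conjugate : ∀ Δ k x v x′ v′ → Prime k → ¬ + k ∣ᶻ (+ 2 ℤ.* (x ℤ.* v′)) →
  + (k * k) ∣ᶻ normForm Δ x v → + (k * k) ∣ᶻ normForm Δ x′ v′ →
  + (k * k) ∣ᶻ det (x , v) (x′ , v′) ⊎ + (k * k) ∣ᶻ x ℤ.* v′ ℤ.+ x′ ℤ.* v
det-or-conjugate Δ k x v x′ v′ pk k∤ p q with + k ℤ∣.∣? det (x , v) (x′ , v′)
... | no k∤det = inj₂ (prime²-cancel (det (x , v) (x′ , v′)) _ pk k∤det
  (subst (+ (k * k) ∣ᶻ_) (factor Δ x v x′ v′) (∣m∣n⇒∣m-n (∣m⇒∣m*n (v′ ℤ.* v′) p) (∣m⇒∣m*n (v ℤ.* v) q))))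
  where
  factor : ∀ Δ x v x′ v′ →
    (x ℤ.* x ℤ.- Δ ℤ.* (v ℤ.* v)) ℤ.* (v′ ℤ.* v′) ℤ.- (x′ ℤ.* x′ ℤ.- Δ ℤ.* (v′ ℤ.* v′)) ℤ.* (v ℤ.* v)
    ≡ (x ℤ.* v′ ℤ.- x′ ℤ.* v) ℤ.* (x ℤ.* v′ ℤ.+ x′ ℤ.* v)
  factor = ℤSolver.solve-∀
... | yes k∣det = inj₁ (prime²-cancel (x ℤ.* v′ ℤ.+ x′ ℤ.* v) _ pk k∤sum
  (subst (+ (k * k) ∣ᶻ_) (factor Δ x v x′ v′) (∣m∣n⇒∣m-n (∣m⇒∣m*n (v′ ℤ.* v′) p) (∣m⇒∣m*n (v ℤ.* v) q))))
  where
  factor : ∀ Δ x v x′ v′ →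
    (x ℤ.* x ℤ.- Δ ℤ.* (v ℤ.* v)) ℤ.* (v′ ℤ.* v′) ℤ.- (x′ ℤ.* x′ ℤ.- Δ ℤ.* (v′ ℤ.* v′)) ℤ.* (v ℤ.* v)
    ≡ (x ℤ.* v′ ℤ.+ x′ ℤ.* v) ℤ.* (x ℤ.* v′ ℤ.- x′ ℤ.* v)
  factor = ℤSolver.solve-∀
  double : ∀ x v x′ v′ → (x ℤ.* v′ ℤ.- x′ ℤ.* v) ℤ.+ (x ℤ.* v′ ℤ.+ x′ ℤ.* v) ≡ x ℤ.* v′ ℤ.+ x ℤ.* v′
  double = ℤSolver.solve-∀
  two : ∀ y → y ℤ.+ y ≡ + 2 ℤ.* y
  two y = sym (trans (ℤ.*-distribʳ-+ y 1ℤ 1ℤ) (cong₂ ℤ._+_ (ℤ.*-identityˡ y) (ℤ.*-identityˡ y)))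
  k∤sum : ¬ + k ∣ᶻ x ℤ.* v′ ℤ.+ x′ ℤ.* v
  k∤sum k∣sum = k∤ (subst (+ k ∣ᶻ_) (trans (double x v x′ v′) (two _)) (∣m∣n⇒∣m+n k∣det k∣sum))

-- The zeros of the form mod k² lie on two lines.
two-lines : ∀ Δ k → Prime k → ¬ + k ∣ᶻ + 2 → ∀ x₁ v₁ x₂ v₂ x₃ v₃ →
  ¬ + k ∣ᶻ x₁ → ¬ + k ∣ᶻ x₂ → ¬ + k ∣ᶻ v₂ → ¬ + k ∣ᶻ v₃ →
  + (k * k) ∣ᶻ normForm Δ x₁ v₁ → + (k * k) ∣ᶻ normForm Δ x₂ v₂ → + (k * k) ∣ᶻ normForm Δ x₃ v₃ →
  + (k * k) ∣ᶻ det (x₁ , v₁) (x₂ , v₂) ⊎ + (k * k) ∣ᶻ det (x₂ , v₂) (x₃ , v₃) ⊎ + (k * k) ∣ᶻ det (x₁ , v₁) (x₃ , v₃)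
two-lines Δ k pk k∤2 x₁ v₁ x₂ v₂ x₃ v₃ k∤x₁ k∤x₂ k∤v₂ k∤v₃ p q r
  with det-or-conjugate Δ k x₁ v₁ x₂ v₂ pk (∤2xv k∤x₁ k∤v₂) p q | det-or-conjugate Δ k x₂ v₂ x₃ v₃ pk (∤2xv k∤x₂ k∤v₃) q r
  where
  ∤2xv : ∀ {x v} → ¬ + k ∣ᶻ x → ¬ + k ∣ᶻ v → ¬ + k ∣ᶻ (+ 2 ℤ.* (x ℤ.* v))
  ∤2xv {x} {v} k∤x k∤v d = [ k∤2 , [ k∤x , k∤v ]′ ∘ euclidℤ x v pk ]′ (euclidℤ (+ 2) (x ℤ.* v) pk d)
... | inj₁ d  | _      = inj₁ d
... | inj₂ _  | inj₁ d = inj₂ (inj₁ d)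
... | inj₂ c₁ | inj₂ c₂ = inj₂ (inj₂ (prime²-cancel v₂ _ pk k∤v₂
  (subst (+ (k * k) ∣ᶻ_) (combination x₁ v₁ x₂ v₂ x₃ v₃) (∣m∣n⇒∣m-n (∣n⇒∣m*n v₃ c₁) (∣n⇒∣m*n v₁ c₂)))))
  where
  combination : ∀ x₁ v₁ x₂ v₂ x₃ v₃ →
    v₃ ℤ.* (x₁ ℤ.* v₂ ℤ.+ x₂ ℤ.* v₁) ℤ.- v₁ ℤ.* (x₂ ℤ.* v₃ ℤ.+ x₃ ℤ.* v₂) ≡ v₂ ℤ.* (x₁ ℤ.* v₃ ℤ.- x₃ ℤ.* v₁)
  combination = ℤSolver.solve-∀

prime∣^ : ∀ {k} → Prime k → ∀ T n → k ∣ T ^ n → k ∣ T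
prime∣^ pk T zero    k∣1 = contradiction (subst Prime (∣1⇒≡1 k∣1) pk) ¬prime[1]
prime∣^ pk T (suc n) k∣  = [ (λ d → d) , prime∣^ pk T n ]′ (euclidsLemma T (T ^ n) pk k∣)

-- Determinants of points in the box are differences of such products. The threshold on the right is
-- of order h while a column has h² points, so the primes below it add only a lower-order loss.
product-bound : ∀ X₀ W Vmax h → NonZero Vmax → NonZero W → NonZero h →
  (X₀ + W * (h * h)) * Vmax < suc (Vmax * (X₀ + W) * h) * suc (Vmax * (X₀ + W) * h)
product-bound X₀ W Vmax h Vmax≢0 W≢0 h≢0 = begin-strict
  (X₀ + W * (h * h)) * Vmax           ≤⟨ *-monoˡ-≤ Vmax (+-monoˡ-≤ _ (m≤m*n X₀ (h * h) {{m*n≢0 h h {{h≢0}} {{h≢0}}}})) ⟩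
  (X₀ * (h * h) + W * (h * h)) * Vmax ≡⟨ regroup X₀ W (h * h) Vmax ⟩
  Y * (h * h)                         ≤⟨ *-monoˡ-≤ (h * h) (m≤m*n Y Y {{Y≢0}}) ⟩
  Y * Y * (h * h)                     ≡⟨ regroup′ Y h ⟩
  Y * h * (Y * h)                     <⟨ *-mono-< (n<1+n (Y * h)) (n<1+n (Y * h)) ⟩
  suc (Y * h) * suc (Y * h)           ∎
  where
  open ≤-Reasoning
  Y = Vmax * (X₀ + W)
  Y≢0 : NonZero Y
  Y≢0 = m*n≢0 Vmax (X₀ + W) {{Vmax≢0}} {{>-nonZero (≤-trans (>-nonZero⁻¹ W {{W≢0}}) (m≤n+m W X₀))}}
  regroup : ∀ x w s m → (x * s + w * s) * m ≡ m * (x + w) * s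
  regroup = ℕSolver.solve-∀
  regroup′ : ∀ y h → y * y * (h * h) ≡ y * h * (y * h)
  regroup′ = ℕSolver.solve-∀

-- Of the 8 W h² points, 4 W h² pay for the main term of the small primes and 2 W h² for the large
-- ones. What remains has to cover 16 W Y h + 16 W + 2 X₀ + 2; writing the remainder as 2 W h · h
-- and comparing coefficients gives the value of `h`.
box-large : ∀ W Y X₀ h .{{_ : NonZero W}} → h ≡ 8 * Y + X₀ + 10 →
  2 * (8 * W) * (h * h / 4) + suc (Y * h) * (2 * (8 * W)) + suc (X₀ + W * (h * h)) * 2 < 8 * W * (h * h)
box-large W@(suc w) Y X₀ h h≡ = begin-strict
  2 * (8 * W) * (N / 4) + suc (Y * h) * (2 * (8 * W)) + suc (X₀ + W * N) * 2
    ≡⟨ expand W (N / 4) (Y * h) X₀ N ⟩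
  4 * W * (N / 4 * 4) + 2 * W * N + (16 * (W * (Y * h)) + 16 * W + (2 * X₀ + 2))
    ≤⟨ +-monoˡ-≤ _ (+-monoˡ-≤ (2 * W * N) (*-monoʳ-≤ (4 * W) (m/n*n≤m N 4))) ⟩
  4 * W * N + 2 * W * N + (16 * (W * (Y * h)) + 16 * W + (2 * X₀ + 2))
    <⟨ +-monoʳ-< (4 * W * N + 2 * W * N) (+-mono-≤-< (+-monoʳ-≤ (16 * (W * (Y * h))) (*-monoʳ-≤ 16 (m≤m*n W h {{h≢0}})))
         (<-≤-trans (≤-trans (m≤m+n (suc (2 * X₀ + 2)) 1) (≤-reflexive (two X₀))) (m≤n*m (2 * (X₀ + 2)) (W * h) {{m*n≢0 W h {{W≢0}} {{h≢0}}}}))) ⟩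
  4 * W * N + 2 * W * N + (16 * (W * (Y * h)) + 16 * (W * h) + W * h * (2 * (X₀ + 2)))
    ≡⟨ collect W N Y h X₀ ⟩
  6 * (W * N) + 2 * W * (h * (8 * Y + X₀ + 10))
    ≡⟨ cong (λ x → 6 * (W * N) + 2 * W * (h * x)) h≡ ⟨
  6 * (W * N) + 2 * W * N
    ≡⟨ eight W N ⟩
  8 * W * N ∎
  where
  open ≤-Reasoning
  N = h * h
  W≢0 : NonZero W
  W≢0 = _
  h≢0 : NonZero h
  h≢0 = subst NonZero (sym h≡) (>-nonZero (≤-trans (s≤s z≤n) (m≤n+m 10 (8 * Y + X₀))))
  expand : ∀ W q y x N → 2 * (8 * W) * q + suc y * (2 * (8 * W)) + suc (x + W * N) * 2 ≡
    4 * W * (q * 4) + 2 * W * N + (16 * (W * y) + 16 * W + (2 * x + 2))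
  expand = ℕSolver.solve-∀
  two : ∀ x → suc (2 * x + 2) + 1 ≡ 2 * (x + 2)
  two = ℕSolver.solve-∀
  collect : ∀ W N Y h x → 4 * W * N + 2 * W * N + (16 * (W * (Y * h)) + 16 * (W * h) + W * h * (2 * (x + 2))) ≡
    6 * (W * N) + 2 * W * (h * (8 * Y + x + 10))
  collect = ℕSolver.solve-∀
  eight : ∀ W N → 6 * (W * N) + 2 * W * N ≡ 8 * W * N
  eight = ℕSolver.solve-∀

-- The second coordinates are multiples of v by powers of T, so that coprimality to v T makes (X n , V j) primitive.
module NormFormSieve (Δ : ℤ) (W v T X₀ : ℕ) {{_ : NonZero W}} {{_ : NonZero v}}
  (6∣W : 6 ∣ W) (Δ∣W : ∣ Δ ∣ ∣ W) (vT∣W : v * T ∣ W) (2≤T : 2 ≤ T) where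

  X V : ℕ → ℕ
  X n = X₀ + W * n
  -- The exponent is positive even in column 0, so that `T` divides every `V j`.
  V j = v * T ^ suc j

  G : ℕ → ℕ → ℤ
  G j n = normForm Δ (+ X n) (+ V j)

  -- Since 6, `Δ`, `v` and `T` all divide `W`, a prime that divides a value is prime to each of
  -- them. This is what permits the cancellations modulo k² below.
  module _ (W-apart : ∀ q → Prime q → q ∣ W → ∀ j n → ¬ + q ∣ᶻ G j n) where

    instance
      T≢0 : NonZero T
      T≢0 = >-nonZero (≤-trans (s≤s z≤n) 2≤T)

    V∣V : ∀ {q} → q ∣ T → ∀ j → q ∣ V j
    V∣V q∣T j = ∣-trans q∣T (∣-trans (m∣m*n (T ^ j)) (n∣m*n v))

    module Killed {k} (pk : Prime k) where
      Kills : ℕ → ℕ → Set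
      Kills j n = k * k ∣ ∣ G j n ∣

      k∣G : ∀ {j n} → Kills j n → + k ∣ᶻ G j n
      k∣G {j} {n} kill = square-∣ {k} {G j n} (∣ᵤ⇒∣ kill)

      k∤W : ∀ {j n} → Kills j n → ¬ k ∣ W
      k∤W {j} {n} kill k∣W = W-apart k pk k∣W j n (k∣G {j} {n} kill)

      k∤V : ∀ {j n} → Kills j n → ∀ i → ¬ + k ∣ᶻ + V i
      k∤V {j} {n} kill i k∣V = k∤W {j} {n} kill (∣-trans ([ (λ k∣v → ∣-trans k∣v (m∣m*n T)) , (λ k∣Tⁱ → ∣-trans
          (prime∣^ pk T (suc i) k∣Tⁱ) (n∣m*n v)) ]′
        (euclidsLemma v (T ^ suc i) pk (∣⇒∣ᵤ k∣V))) vT∣W)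

      k∤2 : ∀ {j n} → Kills j n → ¬ + k ∣ᶻ + 2
      k∤2 {j} {n} kill k∣2 = k∤W {j} {n} kill (∣-trans (∣⇒∣ᵤ k∣2) (∣-trans (divides 3 refl) 6∣W))

      k∤X : ∀ {j n} → Kills j n → ¬ + k ∣ᶻ + X n
      k∤X {j} {n} kill k∣X =
        [ (λ k∣Δ → k∤W {j} {n} kill (∣-trans (∣⇒∣ᵤ k∣Δ) Δ∣W)) , (λ k∣VV → k∤V {j} {n} kill j (euclidℤ² (+ V j) pk k∣VV)) ]′
        (euclidℤ Δ (+ V j ℤ.* + V j) pk
          (subst (+ k ∣ᶻ_) (rest (+ X n) (+ V j) Δ) (∣m∣n⇒∣m-n (∣m⇒∣m*n (+ X n) k∣X) (k∣G {j} {n} kill))))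
        where
        rest : ∀ x v Δ → x ℤ.* x ℤ.- (x ℤ.* x ℤ.- Δ ℤ.* (v ℤ.* v)) ≡ Δ ℤ.* (v ℤ.* v)
        rest = ℤSolver.solve-∀

      Det : ℕ × ℕ → ℕ × ℕ → Set
      Det (j , n) (j′ , n′) = + (k * k) ∣ᶻ det (+ X n , + V j) (+ X n′ , + V j′)

      three-killed : ∀ j₁ n₁ j₂ n₂ j₃ n₃ → Kills j₁ n₁ → Kills j₂ n₂ → Kills j₃ n₃ →
        Det (j₁ , n₁) (j₂ , n₂) ⊎ Det (j₂ , n₂) (j₃ , n₃) ⊎ Det (j₁ , n₁) (j₃ , n₃)
      three-killed j₁ n₁ j₂ n₂ j₃ n₃ a b c = two-lines Δ k pk (k∤2 {j₁} {n₁} a) (+ X n₁) (+ V j₁) (+ X n₂) (+ V j₂) (+ X n₃) (+ V j₃)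
        (k∤X {j₁} {n₁} a) (k∤X {j₂} {n₂} b) (k∤V {j₁} {n₁} a j₂) (k∤V {j₁} {n₁} a j₃) (∣ᵤ⇒∣ a) (∣ᵤ⇒∣ b) (∣ᵤ⇒∣ c)

      -- Within a column the determinant is V j · W · (n - n′), and k divides neither of the first
      -- two factors.
      same-column : ∀ j n n′ → Kills j n → Det (j , n) (j , n′) → + (k * k) ∣ᶻ + n ℤ.- + n′
      same-column j n n′ kill d = prime²-cancel (+ W) _ pk (k∤W {j} {n} kill ∘ ∣⇒∣ᵤ) (prime²-cancel (+ V j) _ pk (k∤V {j} {n} kill j)
        (subst (+ (k * k) ∣ᶻ_) (trans (cong₂ (λ x x′ → x ℤ.* + V j ℤ.- x′ ℤ.* + V j) (as-ℤ n) (as-ℤ n′)) (difference (+ X₀)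
            (+ W) (+ n) (+ n′) (+ V j))) d))
        where
        as-ℤ : ∀ n → + X n ≡ + X₀ ℤ.+ + W ℤ.* + n
        as-ℤ n = cong (λ z → + X₀ ℤ.+ z) (ℤ.pos-* W n)
        difference : ∀ r m n n′ v → (r ℤ.+ m ℤ.* n) ℤ.* v ℤ.- (r ℤ.+ m ℤ.* n′) ℤ.* v ≡ v ℤ.* (m ℤ.* (n ℤ.- n′))
        difference = ℤSolver.solve-∀

    T∤X : ∀ n → ¬ T ∣ X n
    T∤X n T∣X with prime-divisor T (m<n⇒n≢0 2≤T) (>⇒≢ 2≤T)
    ... | q , pq , q∣T = W-apart q pq (∣-trans q∣T (∣-trans (n∣m*n v) vT∣W)) 0 n
      (∣m∣n⇒∣m-n (∣m⇒∣m*n (+ X n) (+∣+ (∣-trans q∣T T∣X))) (∣n⇒∣m*n Δ (∣m⇒∣m*n (+ V 0) (+∣+ (V∣V q∣T 0)))))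

    X-cancel : ∀ {j j′ n n′} → X n * V j′ ≡ X n′ * V j → X n * T ^ suc j′ ≡ X n′ * T ^ suc j
    X-cancel {j} {j′} {n} {n′} eq = *-cancelˡ-≡ _ _ v (trans (swap v (X n) (T ^ suc j′)) (trans eq (sym (swap v (X n′) (T ^ suc j)))))
      where
      swap : ∀ v x t → v * (x * t) ≡ x * (v * t)
      swap = ℕSolver.solve-∀

    -- Cancelling v and the smaller power of `T` leaves X n · T^(j′ - j) = X n′, whereas `T` does
    -- not divide `X n′`.
    parallel-≮ : ∀ {j j′ n n′} → X n * V j′ ≡ X n′ * V j → ¬ j < j′
    parallel-≮ {j} {j′} {n} {n′} eq j<j′ = T∤X n′ (subst (T ∣_) X-multiple (∣-trans (m∣m*n (T ^ d)) (n∣m*n (X n))))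
      where
      d = j′ ∸ suc j
      X-multiple : X n * T ^ suc d ≡ X n′
      X-multiple = *-cancelʳ-≡ _ _ (T ^ suc j) {{m^n≢0 T (suc j)}} (begin
        X n * T ^ suc d * T ^ suc j   ≡⟨ *-assoc (X n) _ _ ⟩
        X n * (T ^ suc d * T ^ suc j) ≡⟨ cong (X n *_) (^-distribˡ-+-* T (suc d) (suc j)) ⟨
        X n * T ^ suc (d + suc j)     ≡⟨ cong (λ e → X n * T ^ suc e) (m∸n+n≡m j<j′) ⟩
        X n * T ^ suc j′              ≡⟨ X-cancel {j} {j′} {n} {n′} eq ⟩
        X n′ * T ^ suc j              ∎)
        where open ≡-Reasoning

    parallel⇒≡ : ∀ {j j′ n n′} → X n * V j′ ≡ X n′ * V j → j ≡ j′ × n ≡ n′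
    parallel⇒≡ {j} {j′} {n} {n′} eq with <-cmp j j′
    ... | tri< j<j′ _ _ = contradiction j<j′ (parallel-≮ {j} {j′} {n} {n′} eq)
    ... | tri> _ _ j>j′ = contradiction j>j′ (parallel-≮ {j′} {j} {n′} {n} (sym eq))
    ... | tri≈ _ refl _ = refl , *-cancelˡ-≡ n n′ W (+-cancelˡ-≡ X₀ _ _ (*-cancelʳ-≡ (X n) (X n′) (T ^ suc j) {{m^n≢0 T
        (suc j)}} (X-cancel {j} {j} {n} {n′} eq)))

    module Box (L N Q R Vmax : ℕ)
      (V≤Vmax : ∀ j → j < L → V j ≤ Vmax)
      (X<R : ∀ n → n < N → X n < R)
      (XV<Q² : ∀ j n → j < L → n < N → X n * V j < Q * Q)
      (X₀-large : ∣ Δ ∣ * (Vmax * Vmax) ≤ X₀)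
      (total : 2 * L * (N / 4) + Q * (2 * L) + R * 2 < L * N) where

      columnFin : Fin (L * N) → Fin L
      columnFin i = proj₁ (remQuot {L} N i)

      rowFin : Fin (L * N) → Fin N
      rowFin i = proj₂ (remQuot {L} N i)

      column row : Fin (L * N) → ℕ
      column i = toℕ (columnFin i)
      row    i = toℕ (rowFin i)

      column<L : ∀ i → column i < L
      column<L i = Fin.toℕ<n (columnFin i)

      row<N : ∀ i → row i < N
      row<N i = Fin.toℕ<n (rowFin i)

      index-injective : ∀ i i′ → column i ≡ column i′ → row i ≡ row i′ → i ≡ i′
      index-injective i i′ c r = begin
        i                                  ≡⟨ Fin.combine-remQuot {L} N i ⟨
        combine (columnFin i) (rowFin i)   ≡⟨ cong₂ combine (Fin.toℕ-injective {i = columnFin i} {j = columnFin i′} c)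
            (Fin.toℕ-injective {i = rowFin i} {j = rowFin i′} r) ⟩
        combine (columnFin i′) (rowFin i′) ≡⟨ Fin.combine-remQuot {L} N i′ ⟩
        i′                                 ∎
        where open ≡-Reasoning

      open ≤-Reasoning

      -- The choice of a large `X₀` makes the term Δ V² at most X in absolute value, and X² + X = X
      -- (X + 1) is at most X R.
      G-bound : ∀ i → ∣ G (column i) (row i) ∣ < (Q + R) * (Q + R)
      G-bound i = begin-strict
        ∣ + x ℤ.* + x ℤ.- Δ ℤ.* (+ u ℤ.* + u) ∣   ≤⟨ ℤ.∣i-j∣≤∣i∣+∣j∣ (+ x ℤ.* + x) (Δ ℤ.* (+ u ℤ.* + u)) ⟩
        ∣ + x ℤ.* + x ∣ + ∣ Δ ℤ.* (+ u ℤ.* + u) ∣  ≡⟨ cong₂ _+_ (ℤ.abs-* (+ x) (+ x)) (trans (ℤ.abs-* Δ _) (cong (∣ Δ ∣ *_) (ℤ.abs-* (+ u) (+ u)))) ⟩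
        x * x + ∣ Δ ∣ * (u * u)                    ≤⟨ +-monoʳ-≤ (x * x) (*-monoʳ-≤ ∣ Δ ∣ (*-mono-≤ u≤ u≤)) ⟩
        x * x + ∣ Δ ∣ * (Vmax * Vmax)              ≤⟨ +-monoʳ-≤ (x * x) (≤-trans X₀-large (m≤m+n X₀ _)) ⟩
        x * x + x                                  ≡⟨ +-comm (x * x) x ⟩
        suc x * x                                  ≤⟨ *-monoˡ-≤ x (X<R _ (row<N i)) ⟩
        R * x                                      <⟨ *-monoʳ-< R {{>-nonZero (≤-trans (s≤s z≤n) (X<R _ (row<N i)))}} (X<R _ (row<N i)) ⟩
        R * R                                      ≤⟨ *-mono-≤ (m≤n+m R Q) (m≤n+m R Q) ⟩
        (Q + R) * (Q + R)                          ∎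
        where
        x = X (row i)
        u = V (column i)
        u≤ = V≤Vmax (column i) (column<L i)

      W-apart-abs : ∀ q → Prime q → q ∣ W → ∀ (i : Fin (L * N)) → ¬ q ∣ ∣ G (column i) (row i) ∣
      W-apart-abs q pq q∣W i q∣G = W-apart q pq q∣W (column i) (row i) (∣ᵤ⇒∣ q∣G)

      G>0 : ∀ i → 0 < ∣ G (column i) (row i) ∣
      G>0 i = n≢0⇒n>0 λ eq → W-apart-abs 2 prime[2] (∣-trans (divides 3 refl) 6∣W) i (subst (2 ∣_) (sym eq) (divides 0 refl))

      -- A fibre is one block of k² rows in one column. Of three killed points in it, two have
      -- determinant divisible by k²; their rows are then congruent mod k² and hence equal.
      small : ∀ k → Prime (2 + k) → ∃ λ (φ : Fin (L * N) → Fin (L * suc (N / ((2 + k) * (2 + k))))) →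
        ∀ t → AtMostTwo (λ i → (2 + k) * (2 + k) ∣ ∣ G (column i) (row i) ∣ × φ i ≡ t)
      small k pk = φ , λ t i₁ i₂ i₃ (a , e₁) (b , e₂) (c , e₃) →
        Sum.map (coincide i₁ i₂ (trans e₁ (sym e₂)) a)
          (Sum.map (coincide i₂ i₃ (trans e₂ (sym e₃)) b) (coincide i₁ i₃ (trans e₁ (sym e₃)) a))
          (three-killed (column i₁) (row i₁) (column i₂) (row i₂) (column i₃) (row i₃) a b c)
        where
        open Killed pk
        D = (2 + k) * (2 + k)
        quot< : ∀ i → row i / D < suc (N / D)
        quot< i = s≤s (/-monoˡ-≤ D (<⇒≤ (row<N i)))
        φ : Fin (L * N) → Fin (L * suc (N / D))
        φ i = combine (columnFin i) (fromℕ< (quot< i))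
        coincide : ∀ i i′ → φ i ≡ φ i′ → Kills (column i) (row i) → Det (column i , row i) (column i′ , row i′) → i ≡ i′
        coincide i i′ eq kill d = index-injective i i′ (cong toℕ same-col)
          (congruent-same-quotient (same-column (column i) (row i) (row i′) kill
              (subst (λ c → Det (column i , row i) (toℕ c , row i′)) (sym same-col) d))
            (trans (sym (Fin.toℕ-fromℕ< (quot< i))) (trans (cong toℕ same-quot) (Fin.toℕ-fromℕ< (quot< i′)))))
          where
          same = Fin.combine-injective (columnFin i) (fromℕ< (quot< i)) (columnFin i′) (fromℕ< (quot< i′)) eq
          same-col : columnFin i ≡ columnFin i′
          same-col = proj₁ same
          same-quot : fromℕ< (quot< i) ≡ fromℕ< (quot< i′)
          same-quot = proj₂ same

      large : ∀ k → Prime k → Q ≤ k → AtMostTwo (λ (i : Fin (L * N)) → k * k ∣ ∣ G (column i) (row i) ∣)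
      large k pk Q≤k i₁ i₂ i₃ a b c = Sum.map (coincide i₁ i₂) (Sum.map (coincide i₂ i₃) (coincide i₁ i₃))
        (three-killed (column i₁) (row i₁) (column i₂) (row i₂) (column i₃) (row i₃) a b c)
        where
        open Killed pk
        XV<k² : ∀ i i′ → X (row i) * V (column i′) < k * k
        XV<k² i i′ = <-≤-trans (XV<Q² (column i′) (row i) (column<L i′) (row<N i)) (*-mono-≤ Q≤k Q≤k)
        coincide : ∀ i i′ → Det (column i , row i) (column i′ , row i′) → i ≡ i′
        coincide i i′ d = uncurry (index-injective i i′) (parallel⇒≡ {column i} {column i′} {row i} {row i′}
          (congruent-close {k * k} {X (row i) * V (column i′)} {X (row i′) * V (column i)} (subst (+ (k * k) ∣ᶻ_) (sym
              (cong₂ ℤ._-_ (ℤ.pos-* (X (row i)) (V (column i′))) (ℤ.pos-* (X (row i′)) (V (column i))))) d)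
            (XV<k² i i′) (XV<k² i′ i)))

      survivor : ∃₂ λ j n → j < L × (∀ k → Prime k → ¬ k * k ∣ ∣ G j n ∣)
      survivor = let i , free = found in column i , row i , column<L i , free
        where
        found : ∃ λ i → ∀ k → Prime k → ¬ k * k ∣ ∣ G (column i) (row i) ∣
        found = sieve (λ i → ∣ G (column i) (row i) ∣) L N Q R G>0 G-bound
          (W-apart-abs 2 prime[2] (∣-trans (divides 3 refl) 6∣W))
          (W-apart-abs 3 prime[3] (∣-trans (divides 2 refl) 6∣W)) small large total

    boxed-survivor : ∀ Vmax → Vmax ≡ V (8 * W) → ∣ Δ ∣ * (Vmax * Vmax) ≤ X₀ →
      ∃₂ λ j n → V j ≤ Vmax × (∀ k → Prime k → ¬ k * k ∣ ∣ G j n ∣)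
    boxed-survivor Vmax Vmax≡ X₀-large =
      let j , n , j<L , free = Box.survivor (8 * W) N Q R Vmax V≤Vmax X<R XV<Q² X₀-large total in j , n , V≤Vmax j j<L , free
      where
      Y h N Q R : ℕ
      Y = Vmax * (X₀ + W)
      h = 8 * Y + X₀ + 10
      N = h * h
      Q = suc (Y * h)
      R = suc (X₀ + W * N)
      V≤Vmax : ∀ j → j < 8 * W → V j ≤ Vmax
      V≤Vmax j j<L = ≤-trans (*-monoʳ-≤ v (^-monoʳ-≤ T (s≤s (<⇒≤ j<L)))) (≤-reflexive (sym Vmax≡))
      X<R : ∀ n → n < N → X n < R
      X<R n n<N = s≤s (+-monoʳ-≤ X₀ (*-monoʳ-≤ W (<⇒≤ n<N)))
      Vmax≢0 : NonZero Vmax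
      Vmax≢0 = subst NonZero (sym Vmax≡) (m*n≢0 v (T ^ suc (8 * W)) {{it}} {{m^n≢0 T (suc (8 * W))}})
      XV<Q² : ∀ j n → j < 8 * W → n < N → X n * V j < Q * Q
      XV<Q² j n j<L n<N = ≤-<-trans (*-mono-≤ (s≤s⁻¹ (X<R n n<N)) (V≤Vmax j j<L)) (product-bound X₀ W Vmax h Vmax≢0 it
          (>-nonZero (≤-trans (s≤s z≤n) (m≤n+m 10 (8 * Y + X₀)))))
      total : 2 * (8 * W) * (N / 4) + Q * (2 * (8 * W)) + R * 2 < 8 * W * N
      total = box-large W Y X₀ h refl

-- The norm form modulo a prime

module _ {p : ℕ} (pp : Prime p) where
  private instance
    p≢0 : NonZero p
    p≢0 = prime⇒nonZero pp

  residue : ℤ → Fin p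
  residue z = fromℕ< (n%ℕd<d z p)

  residue-≡ : ∀ z z′ → residue z ≡ residue z′ → + p ∣ᶻ z ℤ.- z′
  residue-≡ z z′ eq = ℤ∣.divides (z /ℕ p ℤ.- z′ /ℕ p) (begin
    z ℤ.- z′
      ≡⟨ cong₂ ℤ._-_ (a≡a%ℕn+[a/ℕn]*n z p) (a≡a%ℕn+[a/ℕn]*n z′ p) ⟩
    (+ (z %ℕ p) ℤ.+ z /ℕ p ℤ.* + p) ℤ.- (+ (z′ %ℕ p) ℤ.+ z′ /ℕ p ℤ.* + p)
      ≡⟨ cong (λ r → (+ r ℤ.+ z /ℕ p ℤ.* + p) ℤ.- (+ (z′ %ℕ p) ℤ.+ z′ /ℕ p ℤ.* + p)) same ⟩
    (+ (z′ %ℕ p) ℤ.+ z /ℕ p ℤ.* + p) ℤ.- (+ (z′ %ℕ p) ℤ.+ z′ /ℕ p ℤ.* + p)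
      ≡⟨ cancel (+ (z′ %ℕ p)) (z /ℕ p) (z′ /ℕ p) (+ p) ⟩
    (z /ℕ p ℤ.- z′ /ℕ p) ℤ.* + p ∎)
    where
    open ≡-Reasoning
    same : z %ℕ p ≡ z′ %ℕ p
    same = trans (sym (Fin.toℕ-fromℕ< (n%ℕd<d z p))) (trans (cong toℕ eq) (Fin.toℕ-fromℕ< (n%ℕd<d z′ p)))
    cancel : ∀ r q q′ p → (r ℤ.+ q ℤ.* p) ℤ.- (r ℤ.+ q′ ℤ.* p) ≡ (q ℤ.- q′) ℤ.* p
    cancel = ℤSolver.solve-∀

  private
    half : ℕ
    half = p / 2

  -- Equal squares force a ≡ b or a ≡ -b mod p. Both numbers are at most (p - 1)/2, so a + b < p and
  -- the second case leaves only a = b = 0.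
  half-squares-injective : ¬ 2 ∣ p → ∀ (a b : Fin (suc half)) →
    + p ∣ᶻ + toℕ a ℤ.* + toℕ a ℤ.- + toℕ b ℤ.* + toℕ b → a ≡ b
  half-squares-injective 2∤p a b d = Fin.toℕ-injective ([ same , opposite ]′
    (euclidℤ (+ toℕ a ℤ.- + toℕ b) (+ (toℕ a + toℕ b)) pp (subst (+ p ∣ᶻ_) (factor (+ toℕ a) (+ toℕ b)) d)))
    where
    factor : ∀ a b → a ℤ.* a ℤ.- b ℤ.* b ≡ (a ℤ.- b) ℤ.* (a ℤ.+ b)
    factor = ℤSolver.solve-∀
    2half<p : half * 2 < p
    2half<p = ≤∧≢⇒< (m/n*n≤m p 2) λ eq → 2∤p (divides half (sym eq))
    sum< : toℕ a + toℕ b < p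
    sum< = ≤-<-trans (≤-trans (+-mono-≤ (s≤s⁻¹ (Fin.toℕ<n a)) (s≤s⁻¹ (Fin.toℕ<n b)))
      (≤-reflexive (trans (cong (λ x → half + x) (sym (+-identityʳ half))) (*-comm 2 half)))) 2half<p
    same : + p ∣ᶻ + toℕ a ℤ.- + toℕ b → toℕ a ≡ toℕ b
    same d = congruent-close d (≤-<-trans (m≤m+n (toℕ a) (toℕ b)) sum<) (≤-<-trans (m≤n+m (toℕ b) (toℕ a)) sum<)
    opposite : + p ∣ᶻ + (toℕ a + toℕ b) → toℕ a ≡ toℕ b
    opposite d = trans (m+n≡0⇒m≡0 (toℕ a) sum≡0) (sym (m+n≡0⇒n≡0 (toℕ a) sum≡0))
      where
      sum≡0 : toℕ a + toℕ b ≡ 0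
      sum≡0 = ℤ.+-injective (≡-of-∣<-ℤ p _ (∣⇒∣ᵤ d) sum<)

  -- The (p + 1)/2 values x² and the (p + 1)/2 values β + Δ v² share one mod p.
  normForm-surjective-mod : ¬ 2 ∣ p → ∀ Δ → ¬ + p ∣ᶻ Δ → ∀ β →
    ∃₂ λ x v → + p ∣ᶻ normForm Δ (+ x) (+ v) ℤ.- β
  normForm-surjective-mod 2∤p Δ p∤Δ β = from-collision (Fin.pigeonhole more (value ∘ splitAt (suc half)))
    where
    square shifted : Fin (suc half) → ℤ
    square  a = + toℕ a ℤ.* + toℕ a
    shifted b = β ℤ.+ Δ ℤ.* (+ toℕ b ℤ.* + toℕ b)
    value : Fin (suc half) ⊎ Fin (suc half) → Fin p
    value = [ residue ∘ square , residue ∘ shifted ]′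
    more : p < suc half + suc half
    more = begin-strict
      p                 ≡⟨ m≡m%n+[m/n]*n p 2 ⟩
      p % 2 + half * 2  <⟨ +-monoˡ-< (half * 2) (m%n<n p 2) ⟩
      2 + half * 2      ≡⟨ double half ⟩
      suc half + suc half ∎
      where
      open ≤-Reasoning
      double : ∀ h → 2 + h * 2 ≡ suc h + suc h
      double = ℕSolver.solve-∀
    solution : ∀ a b → + p ∣ᶻ square a ℤ.- shifted b → ∃₂ λ x v → + p ∣ᶻ normForm Δ (+ x) (+ v) ℤ.- β
    solution a b d = toℕ a , toℕ b , subst (+ p ∣ᶻ_) (regroup (square a) β (Δ ℤ.* (+ toℕ b ℤ.* + toℕ b))) d
      where
      regroup : ∀ s β t → s ℤ.- (β ℤ.+ t) ≡ s ℤ.- t ℤ.- β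
      regroup = ℤSolver.solve-∀
    collision : ∀ s t → s ≢ t → value s ≡ value t → ∃₂ λ x v → + p ∣ᶻ normForm Δ (+ x) (+ v) ℤ.- β
    collision (inj₁ a) (inj₁ b) s≢t eq = contradiction (cong inj₁ (half-squares-injective 2∤p a b (residue-≡ (square a) (square b) eq))) s≢t
    collision (inj₁ a) (inj₂ b) s≢t eq = solution a b (residue-≡ (square a) (shifted b) eq)
    collision (inj₂ b) (inj₁ a) s≢t eq = solution a b (residue-≡ (square a) (shifted b) (sym eq))
    collision (inj₂ a) (inj₂ b) s≢t eq = contradiction (cong inj₂ (half-squares-injective 2∤p a b
      ([ (λ p∣Δ → contradiction p∣Δ p∤Δ) , (λ d → d) ]′ (euclidℤ Δ (square a ℤ.- square b) pp
        (subst (+ p ∣ᶻ_) (difference β Δ (square a) (square b)) (residue-≡ (shifted a) (shifted b) eq)))))) s≢t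
      where
      difference : ∀ β Δ s t → (β ℤ.+ Δ ℤ.* s) ℤ.- (β ℤ.+ Δ ℤ.* t) ≡ Δ ℤ.* (s ℤ.- t)
      difference = ℤSolver.solve-∀
    from-collision : _ → _
    from-collision (i , j , i<j , eq) = collision (splitAt (suc half) i) (splitAt (suc half) j)
      (λ same → Fin.<⇒≢ i<j (trans (sym (Fin.join-splitAt (suc half) (suc half) i))
        (trans (cong (join (suc half) (suc half)) same) (Fin.join-splitAt (suc half) (suc half) j)))) eq

normForm-cong : ∀ {c} Δ x x′ v v′ → c ∣ᶻ x ℤ.- x′ → c ∣ᶻ v ℤ.- v′ → c ∣ᶻ normForm Δ x v ℤ.- normForm Δ x′ v′
normForm-cong {c} Δ x x′ v v′ p q = subst (c ∣ᶻ_) (difference Δ x x′ v v′)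
  (∣m∣n⇒∣m-n (∣m⇒∣m*n (x ℤ.+ x′) p) (∣n⇒∣m*n Δ (∣m⇒∣m*n (v ℤ.+ v′) q)))
  where
  difference : ∀ Δ x x′ v v′ →
    (x ℤ.- x′) ℤ.* (x ℤ.+ x′) ℤ.- Δ ℤ.* ((v ℤ.- v′) ℤ.* (v ℤ.+ v′)) ≡
    (x ℤ.* x ℤ.- Δ ℤ.* (v ℤ.* v)) ℤ.- (x′ ℤ.* x′ ℤ.- Δ ℤ.* (v′ ℤ.* v′))
  difference = ℤSolver.solve-∀

*-cong-mod : ∀ {c} x x′ v v′ → c ∣ᶻ x ℤ.- x′ → c ∣ᶻ v ℤ.- v′ → c ∣ᶻ x ℤ.* v ℤ.- x′ ℤ.* v′
*-cong-mod {c} x x′ v v′ p q = subst (c ∣ᶻ_) (difference x x′ v v′) (∣m∣n⇒∣m+n (∣m⇒∣m*n v p) (∣n⇒∣m*n x′ q))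
  where
  difference : ∀ x x′ v v′ → (x ℤ.- x′) ℤ.* v ℤ.+ x′ ℤ.* (v ℤ.- v′) ≡ x ℤ.* v ℤ.- x′ ℤ.* v′
  difference = ℤSolver.solve-∀

≡1-^ : ∀ {c} T n → c ∣ᶻ + T ℤ.- 1ℤ → c ∣ᶻ + (T ^ n) ℤ.- 1ℤ
≡1-^ T zero    d = ℤ∣.divides 0ℤ refl
≡1-^ {c} T (suc n) d = subst (λ z → c ∣ᶻ z ℤ.- 1ℤ) (sym (ℤ.pos-* T (T ^ n))) (*-cong-mod (+ T) 1ℤ (+ (T ^ n)) 1ℤ d (≡1-^ T n d))

∣-resp-mod : ∀ {c} x y → c ∣ᶻ x ℤ.- y → c ∣ᶻ x → c ∣ᶻ y
∣-resp-mod {c} x y d c∣x = subst (c ∣ᶻ_) (cancel x y) (∣m∣n⇒∣m-n c∣x d)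
  where
  cancel : ∀ x y → x ℤ.- (x ℤ.- y) ≡ y
  cancel = ℤSolver.solve-∀

prime∤1 : ∀ {q} → Prime q → ¬ + q ∣ᶻ 1ℤ
prime∤1 pq q∣1 = ¬prime[1] (subst Prime (∣1⇒≡1 (∣⇒∣ᵤ q∣1)) pq)

+-progression : ∀ {c} X₀ W n → c ∣ W → + c ∣ᶻ + (X₀ + W * n) ℤ.- + X₀
+-progression {c} X₀ W n c∣W = subst (+ c ∣ᶻ_)
  (sym (trans (cong (λ z → + X₀ ℤ.+ z ℤ.- + X₀) (ℤ.pos-* W n)) (cancel (+ X₀) (+ W ℤ.* + n)))) (∣m⇒∣m*n (+ n) (+∣+ c∣W))
  where
  cancel : ∀ x y → x ℤ.+ y ℤ.- x ≡ y
  cancel = ℤSolver.solve-∀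

-- Squarefree values of the norm form in a residue class

module _ {p : ℕ} (pp : Prime p) (M : ℕ) {{_ : NonZero M}} (p∤M : ¬ p ∣ M) where
  private instance
    p≢0′ : NonZero p
    p≢0′ = prime⇒nonZero pp

  -- The ratio of consecutive columns: congruent to 1 mod p so that multiplying by it preserves the
  -- class of v, and divisible by M so that Δ V² vanishes mod M.
  scale : ∃ λ T → 2 ≤ T × + p ∣ᶻ + T ℤ.- 1ℤ × M ∣ T
  scale = let T , 2≤T , T≡1 , M∣T = chineseRemainder p M 2 (prime-coprime pp p∤M) 1ℤ 0ℤ in
    T , 2≤T , T≡1 , ∣⇒∣ᵤ (subst (+ M ∣ᶻ_) (ℤ.+-identityʳ (+ T)) M∣T)

  p∤T : ∀ {T} → + p ∣ᶻ + T ℤ.- 1ℤ → ¬ p ∣ T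
  p∤T {T} T≡1 p∣T = prime∤1 pp (∣-resp-mod (+ T) 1ℤ T≡1 (+∣+ p∣T))

  -- The bound that `X₀` must exceed involves the largest column coordinate and therefore `v`; so
  -- `v` is fixed first and `X₀` is supplied for every `B`.
  CoprimeLift : ℕ → ℕ → ℕ → Set
  CoprimeLift T x₀ v₀ = ∃ λ v → NonZero v × + p ∣ᶻ + v ℤ.- + v₀ × (∀ B → ∃ λ X₀ →
    B ≤ X₀ × + p ∣ᶻ + X₀ ℤ.- + x₀ × + T ∣ᶻ + X₀ ℤ.- 1ℤ × (∀ q → Prime q → q ∣ v → ¬ + q ∣ᶻ + X₀))

  coprimeLift : ∀ T .{{_ : NonZero T}} → + p ∣ᶻ + T ℤ.- 1ℤ → ∀ x₀ v₀ → (p ∣ v₀ → ¬ + p ∣ᶻ + x₀) →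
    CoprimeLift T x₀ v₀
  coprimeLift T T≡1 x₀ v₀ p∤x₀ = by-cases (p ∣? v₀)
    where
    by-cases : Dec (p ∣ v₀) → CoprimeLift T x₀ v₀
    -- Here `v₀` may be 0, so p replaces it. Then `X₀` is prime to `v` because x₀ is prime to p.
    by-cases (yes p∣v₀) = p , p≢0′ , ∣m∣n⇒∣m-n {m = + p} {n = + v₀} (+∣+ (∣-refl {p})) (+∣+ p∣v₀) , λ B →
      let X₀ , B≤X₀ , X≡x₀ , X≡1 = chineseRemainder p T B (prime-coprime pp (p∤T T≡1)) (+ x₀) 1ℤ in
      X₀ , B≤X₀ , X≡x₀ , X≡1 , λ q pq q∣p q∣X → p∤x₀ p∣v₀
        (∣-resp-mod (+ X₀) (+ x₀) X≡x₀ (subst (λ q → + q ∣ᶻ + X₀) (prime∣prime pq pp q∣p) q∣X))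
    -- Now `v₀` itself is kept, and asking for X₀ ≡ 1 mod v₀ T gives both the condition at `T` and
    -- coprimality to `v₀`.
    by-cases (no p∤v₀) = v₀ , v₀≢0 , subst (+ p ∣ᶻ_) (sym (ℤ.+-inverseʳ (+ v₀))) (ℤ∣.divides 0ℤ refl) , λ B →
      let X₀ , B≤X₀ , X≡x₀ , X≡1 = chineseRemainder p (v₀ * T) B {{it}} {{m*n≢0 v₀ T {{v₀≢0}}}} (prime-coprime pp p∤v₀T) (+ x₀) 1ℤ in
      X₀ , B≤X₀ , X≡x₀ , ℤ∣.∣-trans (+∣+ (n∣m*n v₀)) X≡1 , λ q pq q∣v₀ q∣X →
        prime∤1 pq (∣-resp-mod (+ X₀) 1ℤ (ℤ∣.∣-trans (+∣+ (∣-trans q∣v₀ (m∣m*n T))) X≡1) q∣X)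
      where
      v₀≢0 : NonZero v₀
      v₀≢0 = ≢-nonZero λ { refl → p∤v₀ (divides 0 refl) }
      p∤v₀T : ¬ p ∣ v₀ * T
      p∤v₀T d = [ p∤v₀ , p∤T T≡1 ]′ (euclidsLemma v₀ T pp d)

  squarefree-normForm : ∀ Δ β B → 6 ∣ M → ∣ Δ ∣ ∣ M → ¬ + p ∣ᶻ β → ∃₂ λ x v → v ≢ 0 ×
    B < ∣ normForm Δ (+ x) (+ v) ∣ × Squarefree (normForm Δ (+ x) (+ v)) ×
    + M ∣ᶻ normForm Δ (+ x) (+ v) ℤ.- 1ℤ × + p ∣ᶻ normForm Δ (+ x) (+ v) ℤ.- β
  squarefree-normForm Δ β B 6∣M Δ∣M p∤β =
    X n₁ , V j₁ , ≢-nonZero⁻¹ (V j₁) {{V≢0 j₁}} , B<G , squarefree-by-primes (G j₁ n₁) (λ eq → n≮0 (subst (B <_) eq B<G)) (proj₂ free) ,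
    ℤ∣.∣-trans (+∣+ M∣T) (G≡1 j₁ n₁) , G≡β j₁ n₁
    where
    2∤p : ¬ 2 ∣ p
    2∤p 2∣p = p∤M (subst (_∣ M) (prime∣prime prime[2] pp 2∣p) (∣-trans (divides 3 refl) 6∣M))
    p∤Δ : ¬ + p ∣ᶻ Δ
    p∤Δ p∣Δ = p∤M (∣-trans (∣⇒∣ᵤ p∣Δ) Δ∣M)
    conic = normForm-surjective-mod pp 2∤p Δ p∤Δ β
    x₀ v₀ : ℕ
    x₀ = proj₁ conic
    v₀ = proj₁ (proj₂ conic)
    conic≡β : + p ∣ᶻ normForm Δ (+ x₀) (+ v₀) ℤ.- β
    conic≡β = proj₂ (proj₂ conic)
    T : ℕ
    T = proj₁ scale
    2≤T : 2 ≤ T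
    2≤T = proj₁ (proj₂ scale)
    T≡1 : + p ∣ᶻ + T ℤ.- 1ℤ
    T≡1 = proj₁ (proj₂ (proj₂ scale))
    M∣T : M ∣ T
    M∣T = proj₂ (proj₂ (proj₂ scale))
    instance
      T≢0 : NonZero T
      T≢0 = >-nonZero (≤-trans (s≤s z≤n) 2≤T)
    p∤x₀ : p ∣ v₀ → ¬ + p ∣ᶻ + x₀
    p∤x₀ p∣v₀ p∣x₀ = p∤β (∣-resp-mod (normForm Δ (+ x₀) (+ v₀)) β conic≡β
      (∣m∣n⇒∣m-n (∣m⇒∣m*n (+ x₀) p∣x₀) (∣n⇒∣m*n Δ (∣m⇒∣m*n (+ v₀) (+∣+ p∣v₀)))))
    st = coprimeLift T T≡1 x₀ v₀ p∤x₀
    v W Vmax X₀ : ℕ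
    v = proj₁ st
    -- The values avoid every prime factor of `W`: they are ≡ β mod p and ≡ 1 mod T, and modulo a
    -- prime factor of v they reduce to the square of `X₀`, which is prime to v.
    W = p * (v * T)
    Vmax = v * T ^ suc (8 * W)
    instance
      v≢0 : NonZero v
      v≢0 = proj₁ (proj₂ st)
      vT≢0 : NonZero (v * T)
      vT≢0 = m*n≢0 v T
      W≢0 : NonZero W
      W≢0 = m*n≢0 p (v * T)
    v≡v₀ : + p ∣ᶻ + v ℤ.- + v₀
    v≡v₀ = proj₁ (proj₂ (proj₂ st))
    startX = proj₂ (proj₂ (proj₂ st)) (∣ Δ ∣ * (Vmax * Vmax) + suc B)
    X₀ = proj₁ startX
    X₀-large : ∣ Δ ∣ * (Vmax * Vmax) + suc B ≤ X₀
    X₀-large = proj₁ (proj₂ startX)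
    X₀≡x₀ : + p ∣ᶻ + X₀ ℤ.- + x₀
    X₀≡x₀ = proj₁ (proj₂ (proj₂ startX))
    X₀≡1 : + T ∣ᶻ + X₀ ℤ.- 1ℤ
    X₀≡1 = proj₁ (proj₂ (proj₂ (proj₂ startX)))
    X₀-apart : ∀ q → Prime q → q ∣ v → ¬ + q ∣ᶻ + X₀
    X₀-apart = proj₂ (proj₂ (proj₂ (proj₂ startX)))
    T∣W : T ∣ W
    T∣W = ∣-trans (n∣m*n v) (n∣m*n p)
    open NormFormSieve Δ W v T X₀ (∣-trans 6∣M (∣-trans M∣T T∣W)) (∣-trans Δ∣M (∣-trans M∣T T∣W)) (n∣m*n p) 2≤T
    V≢0 : ∀ j → NonZero (V j)
    V≢0 j = m*n≢0 v (T ^ suc j) {{it}} {{m^n≢0 T (suc j)}}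
    V≡v₀ : ∀ j → + p ∣ᶻ + V j ℤ.- + v₀
    V≡v₀ j = subst₂ (λ a b → + p ∣ᶻ a ℤ.- b) (sym (ℤ.pos-* v (T ^ suc j))) (ℤ.*-identityʳ (+ v₀))
      (*-cong-mod (+ v) (+ v₀) (+ (T ^ suc j)) 1ℤ v≡v₀ (≡1-^ T (suc j) T≡1))
    G≡β : ∀ j n → + p ∣ᶻ G j n ℤ.- β
    G≡β j n = shift-∣ (G j n) (normForm Δ (+ x₀) (+ v₀)) β
      (normForm-cong Δ (+ X n) (+ x₀) (+ V j) (+ v₀)
        (shift-∣ (+ X n) (+ X₀) (+ x₀) (+-progression X₀ W n (m∣m*n (v * T))) X₀≡x₀) (V≡v₀ j)) conic≡β
    G≡1 : ∀ j n → + T ∣ᶻ G j n ℤ.- 1ℤ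
    G≡1 j n = subst (λ z → + T ∣ᶻ G j n ℤ.- z) (unit Δ)
      (normForm-cong Δ (+ X n) 1ℤ (+ V j) 0ℤ
        (shift-∣ (+ X n) (+ X₀) 1ℤ (+-progression X₀ W n T∣W) X₀≡1)
        (subst (+ T ∣ᶻ_) (sym (ℤ.+-identityʳ (+ V j))) (+∣+ (∣-trans (m∣m*n (T ^ j)) (n∣m*n v)))))
      where
      unit : ∀ Δ → 1ℤ ℤ.* 1ℤ ℤ.- Δ ℤ.* (0ℤ ℤ.* 0ℤ) ≡ 1ℤ
      unit Δ = cong (λ z → 1ℤ ℤ.- z) (ℤ.*-zeroʳ Δ)
    W-apart : ∀ q → Prime q → q ∣ W → ∀ j n → ¬ + q ∣ᶻ G j n
    W-apart q pq q∣W j n q∣G = [ at-p , [ at-v , at-T ]′ ∘ euclidsLemma v T pq ]′ (euclidsLemma p (v * T) pq q∣W)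
      where
      at-p : ¬ q ∣ p
      at-p q∣p = p∤β (∣-resp-mod (G j n) β (G≡β j n) (subst (λ q → + q ∣ᶻ G j n) (prime∣prime pq pp q∣p) q∣G))
      at-T : ¬ q ∣ T
      at-T q∣T = prime∤1 pq (∣-resp-mod (G j n) 1ℤ (ℤ∣.∣-trans (+∣+ q∣T) (G≡1 j n)) q∣G)
      at-v : ¬ q ∣ v
      at-v q∣v = X₀-apart q pq q∣v (∣-resp-mod (+ X n) (+ X₀) (+-progression X₀ W n (∣-trans q∣v (∣-trans (m∣m*n T) (n∣m*n p))))
        (euclidℤ² (+ X n) pq (subst (+ q ∣ᶻ_) (rest (+ X n ℤ.* + X n) (Δ ℤ.* (+ V j ℤ.* + V j)))
          (∣m∣n⇒∣m+n q∣G (∣n⇒∣m*n Δ (∣m⇒∣m*n (+ V j) (+∣+ (∣-trans q∣v (m∣m*n (T ^ suc j))))))))))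
        where
        rest : ∀ a b → a ℤ.- b ℤ.+ b ≡ a
        rest = ℤSolver.solve-∀
    survivor = boxed-survivor W-apart Vmax refl (≤-trans (m≤m+n _ (suc B)) X₀-large)
    j₁ n₁ : ℕ
    j₁ = proj₁ survivor
    n₁ = proj₁ (proj₂ survivor)
    free : V j₁ ≤ Vmax × (∀ k → Prime k → ¬ k * k ∣ ∣ G j₁ n₁ ∣)
    free = proj₂ (proj₂ survivor)
    -- From |Δ| Vmax² + B < X ≤ X² = Δ V² + G and V ≤ Vmax, the triangle inequality leaves more than
    -- B for |G|.
    B<G : B < ∣ G j₁ n₁ ∣
    B<G = +-cancelˡ-≤ (∣ Δ ∣ * (Vmax * Vmax)) _ _ (begin
      ∣ Δ ∣ * (Vmax * Vmax) + suc B              ≤⟨ X₀-large ⟩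
      X₀                                         ≤⟨ m≤m+n X₀ (W * n₁) ⟩
      X n₁                                        ≤⟨ m≤m*n (X n₁) (X n₁) {{>-nonZero (≤-trans (≤-trans (s≤s z≤n) (m≤n+m
          (suc B) _)) (≤-trans X₀-large (m≤m+n X₀ (W * n₁))))}} ⟩
      X n₁ * X n₁                                  ≡⟨ ℤ.abs-* (+ X n₁) (+ X n₁) ⟨
      ∣ + X n₁ ℤ.* + X n₁ ∣                         ≡⟨ cong ∣_∣ (split (+ X n₁ ℤ.* + X n₁) (Δ ℤ.* (+ V j₁ ℤ.* + V j₁))) ⟩
      ∣ Δ ℤ.* (+ V j₁ ℤ.* + V j₁) ℤ.+ G j₁ n₁ ∣       ≤⟨ ℤ.∣i+j∣≤∣i∣+∣j∣ (Δ ℤ.* (+ V j₁ ℤ.* + V j₁)) (G j₁ n₁) ⟩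
      ∣ Δ ℤ.* (+ V j₁ ℤ.* + V j₁) ∣ + ∣ G j₁ n₁ ∣     ≡⟨ cong (_+ ∣ G j₁ n₁ ∣) (trans (ℤ.abs-* Δ _) (cong (∣ Δ ∣ *_) (ℤ.abs-* (+ V j₁) (+ V j₁)))) ⟩
      ∣ Δ ∣ * (V j₁ * V j₁) + ∣ G j₁ n₁ ∣             ≤⟨ +-monoˡ-≤ _ (*-monoʳ-≤ ∣ Δ ∣ (*-mono-≤ (proj₁ free) (proj₁ free))) ⟩
      ∣ Δ ∣ * (Vmax * Vmax) + ∣ G j₁ n₁ ∣           ∎)
      where
      open ≤-Reasoning
      split : ∀ a b → a ≡ b ℤ.+ (a ℤ.- b)
      split = ℤSolver.solve-∀

-- Squarefree parts and residue classes

squarefree-in-class : ∀ {p} → Prime p → ∀ M .{{_ : NonZero M}} → ¬ p ∣ M → 6 ∣ M → ∀ B a c →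
  ¬ + p ∣ᶻ a → (∀ q → Prime q → q ∣ M → ¬ + q ∣ᶻ c) →
  ∃ λ d → B ≤ d × Squarefree (+ d) × + p ∣ᶻ + d ℤ.- a × + M ∣ᶻ + d ℤ.- c
squarefree-in-class {p} pp M p∤M 6∣M B a c p∤a c-apart =
  r + p * M * n , ≤-trans B≤r (m≤m+n r _) , proj₂ found ,
  shift-∣ (+ (r + p * M * n)) (+ r) a (+-progression r (p * M) n (m∣m*n M)) r≡a ,
  shift-∣ (+ (r + p * M * n)) (+ r) c (+-progression r (p * M) n (n∣m*n p)) r≡c
  where
  instance
    _ = prime⇒nonZero pp
    pM≢0 : NonZero (p * M)
    pM≢0 = m*n≢0 p M
  start = chineseRemainder p M B (prime-coprime pp p∤M) a c
  r = proj₁ start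
  B≤r : B ≤ r
  B≤r = proj₁ (proj₂ start)
  r≡a : + p ∣ᶻ + r ℤ.- a
  r≡a = proj₁ (proj₂ (proj₂ start))
  r≡c : + M ∣ᶻ + r ℤ.- c
  r≡c = proj₂ (proj₂ (proj₂ start))
  apart : ∀ q → Prime q → q ∣ p * M → ¬ q ∣ r
  apart q pq q∣pM q∣r = [ at-p , at-M ]′ (euclidsLemma p M pq q∣pM)
    where
    at-p : ¬ q ∣ p
    at-p q∣p = p∤a (∣-resp-mod (+ r) a r≡a (+∣+ (subst (_∣ r) (prime∣prime pq pp q∣p) q∣r)))
    at-M : ¬ q ∣ M
    at-M q∣M = c-apart q pq q∣M (∣-resp-mod (+ r) c (ℤ∣.∣-trans (+∣+ q∣M) r≡c) (+∣+ q∣r))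
  found = squarefree-in-progression r (p * M) (∣-trans 6∣M (n∣m*n p)) apart
  n = proj₁ found

squarefree-part : ∀ a → a ≢ 0ℤ → ∃₂ λ a₀ s → Squarefree a₀ × s ≢ 0 × a ≡ a₀ ℤ.* (+ s ℤ.* + s)
squarefree-part a a≢0 = <-rec P step ∣ a ∣ a refl a≢0
  where
  P : ℕ → Set
  P n = ∀ a → ∣ a ∣ ≡ n → a ≢ 0ℤ → ∃₂ λ a₀ s → Squarefree a₀ × s ≢ 0 × a ≡ a₀ ℤ.* (+ s ℤ.* + s)
  square-factor? : ∀ n → Dec (∃ λ k → k < n × 2 ≤ k × k * k ∣ n)
  square-factor? n = anyUpTo? (λ k → (2 ≤? k) ×-dec (k * k ∣? n)) n
  module _ (n : ℕ) (rec : ∀ {m} → m < n → P m) where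
    decompose : Dec (∃ λ k → k < n × 2 ≤ k × k * k ∣ n) → P n
    decompose (no none) a refl a≢0 = a , 1 , sf , (λ ()) , sym (ℤ.*-identityʳ a)
      where
      n≢0 : NonZero n
      n≢0 = ≢-nonZero (a≢0 ∘ ℤ.∣i∣≡0⇒i≡0)
      sf : Squarefree a
      sf 0 d = contradiction (0∣⇒≡0 d) (≢-nonZero⁻¹ n {{n≢0}})
      sf 1 d = refl
      sf k@(suc (suc _)) d = contradiction (k , <-≤-trans (m<m*n k k (s≤s (s≤s z≤n))) (∣⇒≤ {{n≢0}} d) , s≤s (s≤s z≤n) , d) none
    decompose (yes (k , k<n , 2≤k , k²∣n)) a refl a≢0 = peel (∣ᵤ⇒∣ {+ (k * k)} {a} k²∣n)
      where
      peel : + (k * k) ∣ᶻ a → ∃₂ λ a₀ s → Squarefree a₀ × s ≢ 0 × a ≡ a₀ ℤ.* (+ s ℤ.* + s)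
      peel (ℤ∣.divides b a≡) =
        let a₀ , s , sf , s≢0 , b≡ = rec b<n b refl b≢0 in
        a₀ , s * k , sf , (λ sk≡0 → [ s≢0 , m<n⇒n≢0 2≤k ]′ (m*n≡0⇒m≡0∨n≡0 s sk≡0)) ,
        trans a≡ (trans (cong₂ ℤ._*_ b≡ (ℤ.pos-* k k)) (trans (regroup a₀ (+ s) (+ k)) (cong (λ z → a₀ ℤ.* (z ℤ.* z)) (sym (ℤ.pos-* s k)))))
        where
        regroup : ∀ a s k → (a ℤ.* (s ℤ.* s)) ℤ.* (k ℤ.* k) ≡ a ℤ.* ((s ℤ.* k) ℤ.* (s ℤ.* k))
        regroup = ℤSolver.solve-∀
        b≢0 : b ≢ 0ℤ
        b≢0 refl = a≢0 a≡
        b<n : ∣ b ∣ < ∣ a ∣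
        b<n = subst (∣ b ∣ <_) (sym (trans (cong ∣_∣ a≡) (ℤ.abs-* b (+ (k * k)))))
          (m<m*n ∣ b ∣ (k * k) {{≢-nonZero (b≢0 ∘ ℤ.∣i∣≡0⇒i≡0)}} (≤-trans 2≤k (m≤m*n k k {{>-nonZero (≤-trans (s≤s z≤n) 2≤k)}})))
  step : ∀ n → (∀ {m} → m < n → P m) → P n
  step n rec = decompose n rec (square-factor? n)

infinite-by-size : {P : ℤ → Set} → (∀ B → ∃ λ d → B < ∣ d ∣ × P d) → Infinite P
infinite-by-size {P} unbounded xs = let d , big , Pd = unbounded (bound xs) in
  d , Pd , λ d∈xs → <⇒≱ big (≤bound d∈xs)
  where
  bound : List ℤ → ℕ
  bound []       = 0
  bound (x ∷ xs) = ∣ x ∣ + bound xs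
  ≤bound : ∀ {d xs} → d ∈ xs → ∣ d ∣ ≤ bound xs
  ≤bound {xs = x ∷ xs} (here refl) = m≤m+n ∣ x ∣ (bound xs)
  ≤bound {xs = x ∷ xs} (there d∈)  = ≤-trans (≤bound d∈) (m≤n+m (bound xs) ∣ x ∣)

hits-by-size : ∀ f M .{{_ : NonZero M}} →
  (∀ {p} → Prime p → ¬ p ∣ M → ∀ a → ¬ + p ∣ᶻ a → ∀ B → ∃ λ d → B < ∣ d ∣ × d ∈𝒮 f × + p ∣ᶻ d ℤ.- a) →
  HitsAllNonzeroClasses f
hits-by-size f M unbounded = upTo (suc M) , λ p pp p∉ a p∤a → infinite-by-size λ B →
  let d , big , d∈𝒮 , d≡a = unbounded pp (λ p∣M → p∉ (∈-upTo⁺ (s≤s (∣⇒≤ p∣M)))) a (p∤a ∘ ∣⇒∣ᵤ) B in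
  d , big , d∈𝒮 , ∣⇒∣ᵤ d≡a

-- Rational numbers and polynomials

ℚ-ring : AlmostCommutativeRing _ _
ℚ-ring = fromCommutativeRing ℚ.+-*-commutativeRing λ q → dec⇒maybe (0ℚ ℚ.≟ q)

toℚᵘ-fromℤ : ∀ a → toℚᵘ (fromℤ a) ℚᵘ.≃ ℚᵘ.mkℚᵘ a 0
toℚᵘ-fromℤ a = ℚ.toℚᵘ-fromℚᵘ (ℚᵘ.mkℚᵘ a 0)

fromℤ-+ : ∀ a b → fromℤ (a ℤ.+ b) ≡ fromℤ a ℚ.+ fromℤ b
fromℤ-+ a b = ℚ.toℚᵘ-injective (begin
  toℚᵘ (fromℤ (a ℤ.+ b))                   ≈⟨ toℚᵘ-fromℤ (a ℤ.+ b) ⟩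
  ℚᵘ.mkℚᵘ (a ℤ.+ b) 0                      ≈⟨ ℚᵘ.*≡* (cong (ℤ._* 1ℤ) (cong₂ ℤ._+_ (sym (ℤ.*-identityʳ a)) (sym (ℤ.*-identityʳ b)))) ⟩
  ℚᵘ.mkℚᵘ a 0 ℚᵘ.+ ℚᵘ.mkℚᵘ b 0             ≈⟨ ℚᵘ.+-cong (toℚᵘ-fromℤ a) (toℚᵘ-fromℤ b) ⟨
  toℚᵘ (fromℤ a) ℚᵘ.+ toℚᵘ (fromℤ b)       ≈⟨ ℚ.toℚᵘ-homo-+ (fromℤ a) (fromℤ b) ⟨
  toℚᵘ (fromℤ a ℚ.+ fromℤ b)               ∎)
  where open ℚᵘ.≃-Reasoning

fromℤ-* : ∀ a b → fromℤ (a ℤ.* b) ≡ fromℤ a ℚ.* fromℤ b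
fromℤ-* a b = ℚ.toℚᵘ-injective (begin
  toℚᵘ (fromℤ (a ℤ.* b))                   ≈⟨ toℚᵘ-fromℤ (a ℤ.* b) ⟩
  ℚᵘ.mkℚᵘ a 0 ℚᵘ.* ℚᵘ.mkℚᵘ b 0             ≈⟨ ℚᵘ.*-cong (toℚᵘ-fromℤ a) (toℚᵘ-fromℤ b) ⟨
  toℚᵘ (fromℤ a) ℚᵘ.* toℚᵘ (fromℤ b)       ≈⟨ ℚ.toℚᵘ-homo-* (fromℤ a) (fromℤ b) ⟨
  toℚᵘ (fromℤ a ℚ.* fromℤ b)               ∎)
  where open ℚᵘ.≃-Reasoning

fromℤ-injective : ∀ {a b} → fromℤ a ≡ fromℤ b → a ≡ b
fromℤ-injective {a} {b} eq with ℚ./-injective-≃ (ℚᵘ.mkℚᵘ a 0) (ℚᵘ.mkℚᵘ b 0) eq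
... | ℚᵘ.*≡* a1≡b1 = trans (sym (ℤ.*-identityʳ a)) (trans a1≡b1 (ℤ.*-identityʳ b))

fromℤ-neg : ∀ a → fromℤ (ℤ.- a) ≡ ℚ.- fromℤ a
fromℤ-neg a = begin
  fromℤ (ℤ.- a)                                       ≡⟨ cancel (fromℤ (ℤ.- a)) (fromℤ a) ⟩
  fromℤ (ℤ.- a) ℚ.+ fromℤ a ℚ.- fromℤ a               ≡⟨ cong (ℚ._- fromℤ a) (sym (fromℤ-+ (ℤ.- a) a)) ⟩
  fromℤ (ℤ.- a ℤ.+ a) ℚ.- fromℤ a                     ≡⟨ cong (λ z → fromℤ z ℚ.- fromℤ a) (ℤ.+-inverseˡ a) ⟩
  0ℚ ℚ.- fromℤ a                                      ≡⟨ ℚ.+-identityˡ (ℚ.- fromℤ a) ⟩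
  ℚ.- fromℤ a                                         ∎
  where
  open ≡-Reasoning
  cancel : ∀ x y → x ≡ x ℚ.+ y ℚ.- y
  cancel = RingSolver.solve-∀ ℚ-ring

infix 9 #_
#_ : ℕ → ℚ
# n = fromℤ (+ n)

fromℤ≢0 : ∀ {a} → a ≢ 0ℤ → fromℤ a ≢ 0ℚ
fromℤ≢0 a≢0 eq = a≢0 (fromℤ-injective eq)

ℚ-inverse : ∀ q → q ≢ 0ℚ → ∃ λ q⁻¹ → q ℚ.* q⁻¹ ≡ 1ℚ
ℚ-inverse q q≢0 = (ℚ.1/ q) {{ℚ.≢-nonZero q≢0}} , ℚ.*-inverseʳ q {{ℚ.≢-nonZero q≢0}}

ℚ-*-cancel-0 : ∀ q r → q ≢ 0ℚ → q ℚ.* r ≡ 0ℚ → r ≡ 0ℚ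
ℚ-*-cancel-0 q r q≢0 qr≡0 = let q⁻¹ , inv = ℚ-inverse q q≢0 in begin
  r                    ≡⟨ sym (ℚ.*-identityˡ r) ⟩
  1ℚ ℚ.* r             ≡⟨ cong (ℚ._* r) (sym inv) ⟩
  q ℚ.* q⁻¹ ℚ.* r      ≡⟨ swap q q⁻¹ r ⟩
  q ℚ.* r ℚ.* q⁻¹      ≡⟨ cong (ℚ._* q⁻¹) qr≡0 ⟩
  0ℚ ℚ.* q⁻¹           ≡⟨ ℚ.*-zeroˡ q⁻¹ ⟩
  0ℚ                   ∎
  where
  open ≡-Reasoning
  swap : ∀ q s r → q ℚ.* s ℚ.* r ≡ q ℚ.* r ℚ.* s
  swap = RingSolver.solve-∀ ℚ-ring

ℚ-*-≢0 : ∀ {q r} → q ≢ 0ℚ → r ≢ 0ℚ → q ℚ.* r ≢ 0ℚ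
ℚ-*-≢0 {q} {r} q≢0 r≢0 eq = r≢0 (ℚ-*-cancel-0 q r q≢0 eq)

squarefree≢0 : ∀ {d} → Squarefree d → d ≢ 0ℤ
squarefree≢0 sf refl with sf 2 (divides 0 refl)
... | ()

∈𝒮-intro : ∀ f d r q → Squarefree d → q ≢ 0ℚ → eval (toℚ[x] f) r ≡ fromℤ d ℚ.* (q ℚ.* q) → d ∈𝒮 f
∈𝒮-intro f d r q sf q≢0 eq =
  r , (λ eval≡0 → ℚ-*-≢0 (fromℤ≢0 {d} (squarefree≢0 sf)) (ℚ-*-≢0 q≢0 q≢0) (trans (sym eq) eval≡0)) , sf , q , eq

horner : (ℕ → ℚ) → ℕ → ℚ → ℚ
horner c zero    x = c 0
horner c (suc n) x = c 0 ℚ.+ x ℚ.* horner (c ∘ suc) n x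

horner-cong : ∀ {c c′} n x → (∀ i → c i ≡ c′ i) → horner c n x ≡ horner c′ n x
horner-cong zero    x c≗c′ = c≗c′ 0
horner-cong (suc n) x c≗c′ = cong₂ (λ a b → a ℚ.+ x ℚ.* b) (c≗c′ 0) (horner-cong n x (c≗c′ ∘ suc))

eval-zero : ∀ f x → (∀ i → coeff f i ≡ 0ℚ) → eval f x ≡ 0ℚ
eval-zero []      x f≡0 = refl
eval-zero (a ∷ f) x f≡0 = trans (cong₂ (λ a b → a ℚ.+ x ℚ.* b) (f≡0 0) (eval-zero f x (f≡0 ∘ suc)))
  (trans (ℚ.+-identityˡ _) (ℚ.*-zeroʳ x))

-- Lists for one polynomial may differ by trailing zeros. The nested form of fixed depth `n` makes
-- the value an explicit expression in n + 1 coefficients, to which the ring solver applies.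
eval-horner : ∀ f n x → (∀ m → n < m → coeff f m ≡ 0ℚ) → eval f x ≡ horner (coeff f) n x
eval-horner []      zero    x tail≡0 = refl
eval-horner []      (suc n) x tail≡0 = sym (trans (ℚ.+-identityˡ _)
  (trans (cong (x ℚ.*_) (sym (eval-horner [] n x λ _ _ → refl))) (ℚ.*-zeroʳ x)))
eval-horner (a ∷ f) zero    x tail≡0 = trans (cong (λ b → a ℚ.+ x ℚ.* b) (eval-zero f x λ i → tail≡0 (suc i) (s≤s z≤n)))
  (trans (cong (a ℚ.+_) (ℚ.*-zeroʳ x)) (ℚ.+-identityʳ a))
eval-horner (a ∷ f) (suc n) x tail≡0 = cong (λ b → a ℚ.+ x ℚ.* b) (eval-horner f n x λ m n<m → tail≡0 (suc m) (s≤s n<m))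

eval-⊕ : ∀ f g x → eval (f ⊕ g) x ≡ eval f x ℚ.+ eval g x
eval-⊕ []      g       x = sym (ℚ.+-identityˡ (eval g x))
eval-⊕ (a ∷ f) []      x = sym (ℚ.+-identityʳ (eval (a ∷ f) x))
eval-⊕ (a ∷ f) (b ∷ g) x = trans (cong (λ z → a ℚ.+ b ℚ.+ x ℚ.* z) (eval-⊕ f g x)) (regroup a b x (eval f x) (eval g x))
  where
  regroup : ∀ a b x s t → a ℚ.+ b ℚ.+ x ℚ.* (s ℚ.+ t) ≡ a ℚ.+ x ℚ.* s ℚ.+ (b ℚ.+ x ℚ.* t)
  regroup = RingSolver.solve-∀ ℚ-ring

eval-scale : ∀ a g x → eval (map (a ℚ.*_) g) x ≡ a ℚ.* eval g x
eval-scale a []      x = sym (ℚ.*-zeroʳ a)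
eval-scale a (b ∷ g) x = trans (cong (λ z → a ℚ.* b ℚ.+ x ℚ.* z) (eval-scale a g x)) (regroup a b x (eval g x))
  where
  regroup : ∀ a b x s → a ℚ.* b ℚ.+ x ℚ.* (a ℚ.* s) ≡ a ℚ.* (b ℚ.+ x ℚ.* s)
  regroup = RingSolver.solve-∀ ℚ-ring

eval-⊗ : ∀ f g x → eval (f ⊗ g) x ≡ eval f x ℚ.* eval g x
eval-⊗ []      g x = sym (ℚ.*-zeroˡ (eval g x))
eval-⊗ (a ∷ f) g x = begin
  eval (map (a ℚ.*_) g ⊕ (0ℚ ∷ (f ⊗ g))) x                ≡⟨ eval-⊕ (map (a ℚ.*_) g) (0ℚ ∷ (f ⊗ g)) x ⟩
  eval (map (a ℚ.*_) g) x ℚ.+ (0ℚ ℚ.+ x ℚ.* eval (f ⊗ g) x) ≡⟨ cong₂ (λ s t → s ℚ.+ (0ℚ ℚ.+ x ℚ.* t)) (eval-scale a g x) (eval-⊗ f g x) ⟩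
  a ℚ.* eval g x ℚ.+ (0ℚ ℚ.+ x ℚ.* (eval f x ℚ.* eval g x)) ≡⟨ regroup a x (eval f x) (eval g x) ⟩
  (a ℚ.+ x ℚ.* eval f x) ℚ.* eval g x ∎
  where
  open ≡-Reasoning
  regroup : ∀ a x s t → a ℚ.* t ℚ.+ (0ℚ ℚ.+ x ℚ.* (s ℚ.* t)) ≡ (a ℚ.+ x ℚ.* s) ℚ.* t
  regroup = RingSolver.solve-∀ ℚ-ring

-- Evaluate the Bézout identity at the root. In degrees 2 and 4, each degeneracy to be excluded
-- produces a rational double root, and it is in this form that separability is used there.
separable-no-double-root : ∀ f → Separable f → ∀ x → eval f x ≡ 0ℚ → eval (deriv f) x ≢ 0ℚ
separable-no-double-root f (u , v , bezout) x fx≡0 f′x≡0 = ℚ.1≢0 (begin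
  1ℚ                                                      ≡⟨ eval-one ⟨
  eval (u ⊗ f ⊕ v ⊗ deriv f) x                            ≡⟨ eval-⊕ (u ⊗ f) (v ⊗ deriv f) x ⟩
  eval (u ⊗ f) x ℚ.+ eval (v ⊗ deriv f) x                 ≡⟨ cong₂ ℚ._+_ (eval-⊗ u f x) (eval-⊗ v (deriv f) x) ⟩
  eval u x ℚ.* eval f x ℚ.+ eval v x ℚ.* eval (deriv f) x ≡⟨ cong₂ (λ a b → eval u x ℚ.* a ℚ.+ eval v x ℚ.* b) fx≡0 f′x≡0 ⟩
  eval u x ℚ.* 0ℚ ℚ.+ eval v x ℚ.* 0ℚ                     ≡⟨ cong₂ ℚ._+_ (ℚ.*-zeroʳ (eval u x)) (ℚ.*-zeroʳ (eval v x)) ⟩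
  0ℚ ∎)
  where
  open ≡-Reasoning
  eval-one : eval (u ⊗ f ⊕ v ⊗ deriv f) x ≡ 1ℚ
  eval-one = trans (eval-horner (u ⊗ f ⊕ v ⊗ deriv f) 0 x (λ { (suc m) _ → bezout (suc m) })) (bezout 0)

coeff-⊕ : ∀ f g i → coeff (f ⊕ g) i ≡ coeff f i ℚ.+ coeff g i
coeff-⊕ []      g       i       = sym (ℚ.+-identityˡ (coeff g i))
coeff-⊕ (a ∷ f) []      i       = sym (ℚ.+-identityʳ (coeff (a ∷ f) i))
coeff-⊕ (a ∷ f) (b ∷ g) zero    = refl
coeff-⊕ (a ∷ f) (b ∷ g) (suc i) = coeff-⊕ f g i

coeff-deriv : ∀ f i → coeff (deriv f) i ≡ # suc i ℚ.* coeff f (suc i)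
coeff-deriv []      i       = sym (ℚ.*-zeroʳ (# suc i))
coeff-deriv (a ∷ f) zero    = trans (coeff-⊕ f (0ℚ ∷ deriv f) 0) (unit (coeff f 0))
  where
  unit : ∀ x → x ℚ.+ 0ℚ ≡ # 1 ℚ.* x
  unit = RingSolver.solve-∀ ℚ-ring
coeff-deriv (a ∷ f) (suc i) = begin
  coeff (f ⊕ (0ℚ ∷ deriv f)) (suc i)         ≡⟨ coeff-⊕ f (0ℚ ∷ deriv f) (suc i) ⟩
  coeff f (suc i) ℚ.+ coeff (deriv f) i      ≡⟨ cong (coeff f (suc i) ℚ.+_) (coeff-deriv f i) ⟩
  coeff f (suc i) ℚ.+ # suc i ℚ.* coeff f (suc i) ≡⟨ distribute (coeff f (suc i)) (# suc i) ⟩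
  (1ℚ ℚ.+ # suc i) ℚ.* coeff f (suc i)       ≡⟨ cong (ℚ._* coeff f (suc i)) (fromℤ-+ 1ℤ (+ suc i)) ⟨
  # suc (suc i) ℚ.* coeff f (suc i)          ∎
  where
  open ≡-Reasoning
  distribute : ∀ x n → x ℚ.+ n ℚ.* x ≡ (1ℚ ℚ.+ n) ℚ.* x
  distribute = RingSolver.solve-∀ ℚ-ring

eval-deriv : ∀ f n x → (∀ m → suc n < m → coeff f m ≡ 0ℚ) →
  eval (deriv f) x ≡ horner (λ i → # suc i ℚ.* coeff f (suc i)) n x
eval-deriv f n x tail≡0 = trans
  (eval-horner (deriv f) n x λ m n<m →
    trans (coeff-deriv f m) (trans (cong (# suc m ℚ.*_) (tail≡0 (suc m) (s≤s n<m))) (ℚ.*-zeroʳ (# suc m))))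
  (horner-cong n x (coeff-deriv f))

integral-coeff : ∀ f i → ∃ λ a → coeff (toℚ[x] f) i ≡ fromℤ a
integral-coeff []      i       = 0ℤ , refl
integral-coeff (a ∷ f) zero    = a , refl
integral-coeff (a ∷ f) (suc i) = integral-coeff f i

-- Degrees 1 and 2

inverse-mod : ∀ {p} → Prime p → ∀ x → ¬ + p ∣ᶻ x → ∃ λ w → + p ∣ᶻ x ℤ.* w ℤ.- 1ℤ
inverse-mod {p} pp x p∤x = from-multiple (ℤ∣.m∣∣m∣ {x}) (Bézoutℤ (prime-coprime pp (p∤x ∘ ∣ᵤ⇒∣)))
  where
  from-multiple : x ∣ᶻ + ∣ x ∣ → (∃₂ λ u w → u ℤ.* + p ℤ.+ w ℤ.* + ∣ x ∣ ≡ 1ℤ) → ∃ λ w → + p ∣ᶻ x ℤ.* w ℤ.- 1ℤ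
  from-multiple (ℤ∣.divides e ∣x∣≡) (u , w , bez) = w ℤ.* e , ℤ∣.divides (ℤ.- u) (begin
    x ℤ.* (w ℤ.* e) ℤ.- 1ℤ                              ≡⟨ cong (λ y → x ℤ.* (w ℤ.* e) ℤ.- y) (sym bez) ⟩
    x ℤ.* (w ℤ.* e) ℤ.- (u ℤ.* + p ℤ.+ w ℤ.* + ∣ x ∣)   ≡⟨ cong (λ y → x ℤ.* (w ℤ.* e) ℤ.- (u ℤ.* + p ℤ.+ w ℤ.* y)) ∣x∣≡ ⟩
    x ℤ.* (w ℤ.* e) ℤ.- (u ℤ.* + p ℤ.+ w ℤ.* (e ℤ.* x)) ≡⟨ cancel x w e u (+ p) ⟩
    (ℤ.- u) ℤ.* + p                                     ∎)
    where
    open ≡-Reasoning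
    cancel : ∀ x w e u p → x ℤ.* (w ℤ.* e) ℤ.- (u ℤ.* p ℤ.+ w ℤ.* (e ℤ.* x)) ≡ (ℤ.- u) ℤ.* p
    cancel = ℤSolver.solve-∀

linear-hits : ∀ f → HasDegree (toℚ[x] f) 1 → HitsAllNonzeroClasses f
linear-hits f (c₁≢0 , tail≡0) = hits-by-size f 6 λ {p} pp p∤6 a p∤a B →
  let d , B<d , sf , d≡a , _ = squarefree-in-class pp 6 p∤6 ∣-refl (suc B) a 1ℤ p∤a (λ q pq _ → prime∤1 pq) in
  + d , B<d , ∈𝒮-intro f (+ d) (root (+ d)) 1ℚ sf ℚ.1≢0 (value (+ d)) , d≡a
  where
  c = coeff (toℚ[x] f)
  c₁⁻¹ = proj₁ (ℚ-inverse (c 1) c₁≢0)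
  root : ℤ → ℚ
  root d = (fromℤ d ℚ.- c 0) ℚ.* c₁⁻¹
  value : ∀ d → eval (toℚ[x] f) (root d) ≡ fromℤ d ℚ.* (1ℚ ℚ.* 1ℚ)
  value d = begin
    eval (toℚ[x] f) (root d)                              ≡⟨ eval-horner (toℚ[x] f) 1 (root d) tail≡0 ⟩
    c 0 ℚ.+ (fromℤ d ℚ.- c 0) ℚ.* c₁⁻¹ ℚ.* c 1            ≡⟨ regroup (c 0) (fromℤ d) c₁⁻¹ (c 1) ⟩
    c 0 ℚ.+ (fromℤ d ℚ.- c 0) ℚ.* (c 1 ℚ.* c₁⁻¹)          ≡⟨ cong (λ u → c 0 ℚ.+ (fromℤ d ℚ.- c 0) ℚ.* u) (proj₂ (ℚ-inverse (c 1) c₁≢0)) ⟩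
    c 0 ℚ.+ (fromℤ d ℚ.- c 0) ℚ.* 1ℚ                      ≡⟨ collect (c 0) (fromℤ d) ⟩
    fromℤ d ℚ.* (1ℚ ℚ.* 1ℚ)                               ∎
    where
    open ≡-Reasoning
    regroup : ∀ x d i y → x ℚ.+ (d ℚ.- x) ℚ.* i ℚ.* y ≡ x ℚ.+ (d ℚ.- x) ℚ.* (y ℚ.* i)
    regroup = RingSolver.solve-∀ ℚ-ring
    collect : ∀ x d → x ℚ.+ (d ℚ.- x) ℚ.* 1ℚ ≡ d ℚ.* (1ℚ ℚ.* 1ℚ)
    collect = RingSolver.solve-∀ ℚ-ring

module Quadratic (f : ℤ[x]) (sep : Separable (toℚ[x] f)) (deg : HasDegree (toℚ[x] f) 2) where
  a b c Δ : ℤ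
  a = proj₁ (integral-coeff f 2)
  b = proj₁ (integral-coeff f 1)
  c = proj₁ (integral-coeff f 0)
  Δ = b ℤ.* b ℤ.- + 4 ℤ.* (a ℤ.* c)

  A B C : ℚ
  A = fromℤ a
  B = fromℤ b
  C = fromℤ c

  A≢0 : A ≢ 0ℚ
  A≢0 eq = proj₁ deg (trans (proj₂ (integral-coeff f 2)) eq)

  2A≢0 : # 2 ℚ.* A ≢ 0ℚ
  2A≢0 = ℚ-*-≢0 {# 2} (λ ()) A≢0

  4A≢0 : # 4 ℚ.* A ≢ 0ℚ
  4A≢0 = ℚ-*-≢0 {# 4} (λ ()) A≢0

  eval-f : ∀ x → eval (toℚ[x] f) x ≡ C ℚ.+ x ℚ.* (B ℚ.+ x ℚ.* A)
  eval-f x = trans (eval-horner (toℚ[x] f) 2 x (proj₂ deg)) (trans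
    (cong₂ (λ C BA → C ℚ.+ x ℚ.* BA) (proj₂ (integral-coeff f 0))
      (cong₂ (λ B A → B ℚ.+ x ℚ.* A) (proj₂ (integral-coeff f 1)) (proj₂ (integral-coeff f 2)))) refl)

  eval-f′ : ∀ x → eval (deriv (toℚ[x] f)) x ≡ # 1 ℚ.* B ℚ.+ x ℚ.* (# 2 ℚ.* A)
  eval-f′ x = trans (eval-deriv (toℚ[x] f) 1 x (proj₂ deg))
    (cong₂ (λ B A → # 1 ℚ.* B ℚ.+ x ℚ.* (# 2 ℚ.* A)) (proj₂ (integral-coeff f 1)) (proj₂ (integral-coeff f 2)))

  discriminant : fromℤ Δ ≡ B ℚ.* B ℚ.- # 4 ℚ.* (A ℚ.* C)
  discriminant = begin
    fromℤ Δ                                              ≡⟨ fromℤ-+ (b ℤ.* b) (ℤ.- (+ 4 ℤ.* (a ℤ.* c))) ⟩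
    fromℤ (b ℤ.* b) ℚ.+ fromℤ (ℤ.- (+ 4 ℤ.* (a ℤ.* c)))  ≡⟨ cong₂ ℚ._+_ (fromℤ-* b b) (fromℤ-neg (+ 4 ℤ.* (a ℤ.* c))) ⟩
    B ℚ.* B ℚ.- fromℤ (+ 4 ℤ.* (a ℤ.* c))                ≡⟨ cong (λ z → B ℚ.* B ℚ.- z) (trans (fromℤ-* (+ 4) (a ℤ.* c))
        (cong (# 4 ℚ.*_) (fromℤ-* a c))) ⟩
    B ℚ.* B ℚ.- # 4 ℚ.* (A ℚ.* C)                        ∎
    where open ≡-Reasoning

  complete-square : ∀ A B C x →
    (# 4 ℚ.* A) ℚ.* (C ℚ.+ x ℚ.* (B ℚ.+ x ℚ.* A)) ≡
    ((# 2 ℚ.* A) ℚ.* x ℚ.+ B) ℚ.* ((# 2 ℚ.* A) ℚ.* x ℚ.+ B) ℚ.- (B ℚ.* B ℚ.- # 4 ℚ.* (A ℚ.* C))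
  complete-square = RingSolver.solve-∀ ℚ-ring

  Δ≢0 : Δ ≢ 0ℤ
  Δ≢0 Δ≡0 = separable-no-double-root (toℚ[x] f) sep x f≡0 f′≡0
    where
    open ≡-Reasoning
    2A⁻¹ = proj₁ (ℚ-inverse (# 2 ℚ.* A) 2A≢0)
    x = ℚ.- (B ℚ.* 2A⁻¹)
    2Ax+B≡0 : (# 2 ℚ.* A) ℚ.* x ℚ.+ B ≡ 0ℚ
    2Ax+B≡0 = begin
      (# 2 ℚ.* A) ℚ.* (ℚ.- (B ℚ.* 2A⁻¹)) ℚ.+ B    ≡⟨ regroup (# 2 ℚ.* A) B 2A⁻¹ ⟩
      B ℚ.* (1ℚ ℚ.- (# 2 ℚ.* A) ℚ.* 2A⁻¹)         ≡⟨ cong (λ z → B ℚ.* (1ℚ ℚ.- z)) (proj₂ (ℚ-inverse (# 2 ℚ.* A) 2A≢0)) ⟩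
      B ℚ.* (1ℚ ℚ.- 1ℚ)                         ≡⟨ ℚ.*-zeroʳ B ⟩
      0ℚ ∎
      where
      regroup : ∀ D B i → D ℚ.* (ℚ.- (B ℚ.* i)) ℚ.+ B ≡ B ℚ.* (1ℚ ℚ.- D ℚ.* i)
      regroup = RingSolver.solve-∀ ℚ-ring
    f≡0 : eval (toℚ[x] f) x ≡ 0ℚ
    f≡0 = trans (eval-f x) (ℚ-*-cancel-0 (# 4 ℚ.* A) _ 4A≢0
      (trans (complete-square A B C x) (cong₂ (λ s Δ → s ℚ.* s ℚ.- Δ) 2Ax+B≡0 (trans (sym discriminant) (cong fromℤ Δ≡0)))))
    f′≡0 : eval (deriv (toℚ[x] f)) x ≡ 0ℚ
    f′≡0 = trans (eval-f′ x) (trans (regroup A B x) 2Ax+B≡0)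
      where
      regroup : ∀ A B x → # 1 ℚ.* B ℚ.+ x ℚ.* (# 2 ℚ.* A) ≡ (# 2 ℚ.* A) ℚ.* x ℚ.+ B
      regroup = RingSolver.solve-∀ ℚ-ring

  a≢0 : a ≢ 0ℤ
  a≢0 a≡0 = A≢0 (cong fromℤ a≡0)

  part = squarefree-part a a≢0
  a₀ = proj₁ part
  s = proj₁ (proj₂ part)
  a₀-squarefree : Squarefree a₀
  a₀-squarefree = proj₁ (proj₂ (proj₂ part))
  s≢0 : s ≢ 0
  s≢0 = proj₁ (proj₂ (proj₂ (proj₂ part)))
  a≡a₀s² : a ≡ a₀ ℤ.* (+ s ℤ.* + s)
  a≡a₀s² = proj₂ (proj₂ (proj₂ (proj₂ part)))

  a₀∣a : ∣ a₀ ∣ ∣ ∣ a ∣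
  a₀∣a = subst (λ z → ∣ a₀ ∣ ∣ ∣ z ∣) (sym a≡a₀s²) (subst (∣ a₀ ∣ ∣_) (sym (ℤ.abs-* a₀ (+ s ℤ.* + s))) (m∣m*n ∣ + s ℤ.* + s ∣))

  -- With r = (X - B v) / (2 A v) one has (2 A r + B) v = X, so completing the square gives 4 A v²
  -- f(r) = X² - Δ v². Hence f(r) = A (X² - Δ v²) / (2 A v)², and A = a₀ s² moves s into the square.
  represents : ∀ X v → v ≢ 0ℤ → ∃₂ λ r q → q ≢ 0ℚ ×
    eval (toℚ[x] f) r ≡ fromℤ (a₀ ℤ.* normForm Δ X v) ℚ.* (q ℚ.* q)
  represents X v v≢0 = r , q , ℚ-*-≢0 (fromℤ≢0 {+ s} (s≢0 ∘ ℤ.+-injective)) i≢0 , (begin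
    eval (toℚ[x] f) r                    ≡⟨ eval-f r ⟩
    Y                                    ≡⟨ ℚ.*-identityʳ Y ⟨
    Y ℚ.* (1ℚ ℚ.* 1ℚ)                    ≡⟨ cong (λ u → Y ℚ.* (u ℚ.* u)) inv ⟨
    Y ℚ.* (z ℚ.* i ℚ.* (z ℚ.* i))        ≡⟨ split Y A V i ⟩
    V ℚ.* V ℚ.* (4A ℚ.* Y) ℚ.* (A ℚ.* (i ℚ.* i)) ≡⟨ cong₂ (λ g A → g ℚ.* (A ℚ.* (i ℚ.* i))) V²4AY A≡ ⟩
    fromℤ (normForm Δ X v) ℚ.* (fromℤ a₀ ℚ.* (S ℚ.* S) ℚ.* (i ℚ.* i)) ≡⟨ regroup (fromℤ (normForm Δ X v)) (fromℤ a₀) S i ⟩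
    fromℤ a₀ ℚ.* fromℤ (normForm Δ X v) ℚ.* (q ℚ.* q) ≡⟨ cong (ℚ._* (q ℚ.* q)) (fromℤ-* a₀ (normForm Δ X v)) ⟨
    fromℤ (a₀ ℤ.* normForm Δ X v) ℚ.* (q ℚ.* q) ∎)
    where
    open ≡-Reasoning
    V S z i r q 4A Y : ℚ
    V = fromℤ v
    S = fromℤ (+ s)
    z = (# 2 ℚ.* A) ℚ.* V
    z⁻¹ = ℚ-inverse z (ℚ-*-≢0 2A≢0 (fromℤ≢0 v≢0))
    i = proj₁ z⁻¹
    inv : z ℚ.* i ≡ 1ℚ
    inv = proj₂ z⁻¹
    r = (fromℤ X ℚ.- B ℚ.* V) ℚ.* i
    q = S ℚ.* i
    4A = # 4 ℚ.* A
    Y = C ℚ.+ r ℚ.* (B ℚ.+ r ℚ.* A)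
    i≢0 : i ≢ 0ℚ
    i≢0 i≡0 = ℚ.1≢0 (trans (sym inv) (trans (cong (z ℚ.*_) i≡0) (ℚ.*-zeroʳ z)))
    A≡ : A ≡ fromℤ a₀ ℚ.* (S ℚ.* S)
    A≡ = trans (cong fromℤ a≡a₀s²) (trans (fromℤ-* a₀ (+ s ℤ.* + s)) (cong (fromℤ a₀ ℚ.*_) (fromℤ-* (+ s) (+ s))))
    split : ∀ Y A V i → Y ℚ.* ((# 2 ℚ.* A) ℚ.* V ℚ.* i ℚ.* ((# 2 ℚ.* A) ℚ.* V ℚ.* i)) ≡
      V ℚ.* V ℚ.* ((# 4 ℚ.* A) ℚ.* Y) ℚ.* (A ℚ.* (i ℚ.* i))
    split = RingSolver.solve-∀ ℚ-ring
    regroup : ∀ g a S i → g ℚ.* (a ℚ.* (S ℚ.* S) ℚ.* (i ℚ.* i)) ≡ a ℚ.* g ℚ.* (S ℚ.* i ℚ.* (S ℚ.* i))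
    regroup = RingSolver.solve-∀ ℚ-ring
    distribute : ∀ V D r B Δ → V ℚ.* V ℚ.* ((D ℚ.* r ℚ.+ B) ℚ.* (D ℚ.* r ℚ.+ B) ℚ.- Δ) ≡
      (D ℚ.* V ℚ.* r ℚ.+ B ℚ.* V) ℚ.* (D ℚ.* V ℚ.* r ℚ.+ B ℚ.* V) ℚ.- Δ ℚ.* (V ℚ.* V)
    distribute = RingSolver.solve-∀ ℚ-ring
    collect : ∀ z X Y i → z ℚ.* ((X ℚ.- Y) ℚ.* i) ℚ.+ Y ≡ (X ℚ.- Y) ℚ.* (z ℚ.* i) ℚ.+ Y
    collect = RingSolver.solve-∀ ℚ-ring
    cancel : ∀ X Y → (X ℚ.- Y) ℚ.* 1ℚ ℚ.+ Y ≡ X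
    cancel = RingSolver.solve-∀ ℚ-ring
    zr+BV : z ℚ.* r ℚ.+ B ℚ.* V ≡ fromℤ X
    zr+BV = trans (collect z (fromℤ X) (B ℚ.* V) i) (trans (cong (λ u → (fromℤ X ℚ.- B ℚ.* V) ℚ.* u ℚ.+ B ℚ.* V) inv) (cancel (fromℤ X) (B ℚ.* V)))
    norm-ℚ : fromℤ (normForm Δ X v) ≡ fromℤ X ℚ.* fromℤ X ℚ.- fromℤ Δ ℚ.* (V ℚ.* V)
    norm-ℚ = trans (fromℤ-+ (X ℤ.* X) _) (cong₂ ℚ._+_ (fromℤ-* X X)
      (trans (fromℤ-neg (Δ ℤ.* (v ℤ.* v))) (cong ℚ.-_ (trans (fromℤ-* Δ (v ℤ.* v)) (cong (fromℤ Δ ℚ.*_) (fromℤ-* v v))))))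
    V²4AY : V ℚ.* V ℚ.* (4A ℚ.* Y) ≡ fromℤ (normForm Δ X v)
    V²4AY = begin
      V ℚ.* V ℚ.* (4A ℚ.* Y)
        ≡⟨ cong (V ℚ.* V ℚ.*_) (trans (complete-square A B C r) (cong (λ Δ → ((# 2 ℚ.* A) ℚ.* r ℚ.+ B) ℚ.*
            ((# 2 ℚ.* A) ℚ.* r ℚ.+ B) ℚ.- Δ) (sym discriminant))) ⟩
      V ℚ.* V ℚ.* (((# 2 ℚ.* A) ℚ.* r ℚ.+ B) ℚ.* ((# 2 ℚ.* A) ℚ.* r ℚ.+ B) ℚ.- fromℤ Δ)
        ≡⟨ distribute V (# 2 ℚ.* A) r B (fromℤ Δ) ⟩
      (z ℚ.* r ℚ.+ B ℚ.* V) ℚ.* (z ℚ.* r ℚ.+ B ℚ.* V) ℚ.- fromℤ Δ ℚ.* (V ℚ.* V)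
        ≡⟨ cong (λ u → u ℚ.* u ℚ.- fromℤ Δ ℚ.* (V ℚ.* V)) zr+BV ⟩
      fromℤ X ℚ.* fromℤ X ℚ.- fromℤ Δ ℚ.* (V ℚ.* V)
        ≡⟨ norm-ℚ ⟨
      fromℤ (normForm Δ X v) ∎

  M : ℕ
  M = 6 * (∣ a ∣ * ∣ Δ ∣)

  instance
    M≢0 : NonZero M
    M≢0 = m*n≢0 6 (∣ a ∣ * ∣ Δ ∣) {{it}} {{m*n≢0 ∣ a ∣ ∣ Δ ∣ {{≢-nonZero (a≢0 ∘ ℤ.∣i∣≡0⇒i≡0)}} {{≢-nonZero (Δ≢0 ∘ ℤ.∣i∣≡0⇒i≡0)}}}}

  a₀∣M : ∣ a₀ ∣ ∣ M
  a₀∣M = ∣-trans a₀∣a (∣-trans (m∣m*n ∣ Δ ∣) (n∣m*n 6))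

  -- As `a₀` divides `M` and G ≡ 1 mod M, the two squarefree factors have no prime in common.
  a₀-times-squarefree : ∀ G → Squarefree G → + M ∣ᶻ G ℤ.- 1ℤ → Squarefree (a₀ ℤ.* G)
  a₀-times-squarefree G sf G≡1 = squarefree-by-primes (a₀ ℤ.* G)
    (λ eq → [ squarefree≢0 {a₀} a₀-squarefree , squarefree≢0 {G} sf ]′ (ℤ.i*j≡0⇒i≡0∨j≡0 a₀ (ℤ.∣i∣≡0⇒i≡0 eq)))
    λ q pq q²∣ → by-cases q pq (∣ᵤ⇒∣ {+ (q * q)} {a₀ ℤ.* G} q²∣) (+ q ℤ∣.∣? a₀)
    where
    not-square : ∀ q → Prime q → ∀ {d} → Squarefree d → ¬ + (q * q) ∣ᶻ d
    not-square q pq sf d = ¬prime[1] (subst Prime (sf q (∣⇒∣ᵤ d)) pq)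
    by-cases : ∀ q → Prime q → + (q * q) ∣ᶻ a₀ ℤ.* G → ¬ Dec (+ q ∣ᶻ a₀)
    by-cases q pq q²∣ (no q∤a₀)  = not-square q pq sf (prime²-cancel a₀ G pq q∤a₀ q²∣)
    by-cases q pq q²∣ (yes q∣a₀) = not-square q pq a₀-squarefree
      (prime²-cancel G a₀ pq q∤G (subst (+ (q * q) ∣ᶻ_) (ℤ.*-comm a₀ G) q²∣))
      where
      q∤G : ¬ + q ∣ᶻ G
      q∤G q∣G = prime∤1 pq (∣-resp-mod G 1ℤ (ℤ∣.∣-trans (+∣+ (∣-trans (∣⇒∣ᵤ q∣a₀) a₀∣M)) G≡1) q∣G)

  hits : HitsAllNonzeroClasses f
  hits = hits-by-size f M λ {p} pp p∤M α p∤α Bd →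
    let w , a₀w≡1 = inverse-mod pp a₀ (λ p∣a₀ → p∤M (∣-trans (∣⇒∣ᵤ p∣a₀) a₀∣M))
        -- The class of α / a₀ mod p, so that a₀ G falls into the class of α.
        β = w ℤ.* α
        a₀β≡α : + p ∣ᶻ a₀ ℤ.* β ℤ.- α
        a₀β≡α = subst (+ p ∣ᶻ_) (factor a₀ w α) (∣m⇒∣m*n α a₀w≡1)
        X , v , v≢0 , Bd<G , sf , G≡1 , G≡β = squarefree-normForm pp M p∤M Δ β Bd (m∣m*n (∣ a ∣ * ∣ Δ ∣))
          (∣-trans (n∣m*n ∣ a ∣) (n∣m*n 6)) (λ p∣β → p∤α (∣-resp-mod (a₀ ℤ.* β) α a₀β≡α (∣n⇒∣m*n a₀ p∣β)))
        G = normForm Δ (+ X) (+ v)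
        r , q , q≢0 , value = represents (+ X) (+ v) (v≢0 ∘ ℤ.+-injective)
    in a₀ ℤ.* G
     , <-≤-trans Bd<G (subst (∣ G ∣ ≤_) (sym (ℤ.abs-* a₀ G)) (m≤n*m ∣ G ∣ ∣ a₀ ∣ {{≢-nonZero (squarefree≢0 {a₀} a₀-squarefree ∘ ℤ.∣i∣≡0⇒i≡0)}}))
     , ∈𝒮-intro f (a₀ ℤ.* G) r q (a₀-times-squarefree G sf G≡1) q≢0 value
     , shift-∣ (a₀ ℤ.* G) (a₀ ℤ.* β) α (subst (+ p ∣ᶻ_) (distribute a₀ G β) (∣n⇒∣m*n a₀ G≡β)) a₀β≡α
    where
    factor : ∀ a w α → (a ℤ.* w ℤ.- 1ℤ) ℤ.* α ≡ a ℤ.* (w ℤ.* α) ℤ.- α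
    factor = ℤSolver.solve-∀
    distribute : ∀ a G β → a ℤ.* (G ℤ.- β) ≡ a ℤ.* G ℤ.- a ℤ.* β
    distribute = ℤSolver.solve-∀

-- Quadratic twists under the Parity Conjecture

product-map≢0 : ∀ (g : ℕ → ℕ) → (∀ k → NonZero (g k)) → ∀ ks → NonZero (product (map g ks))
product-map≢0 g g≢0 []       = _
product-map≢0 g g≢0 (k ∷ ks) = m*n≢0 (g k) (product (map g ks)) {{g≢0 k}} {{product-map≢0 g g≢0 ks}}

if≢0 : ∀ b {x y} → NonZero x → NonZero y → NonZero (if b then x else y)
if≢0 true  x≢0 y≢0 = x≢0
if≢0 false x≢0 y≢0 = y≢0

-- Every local factor is 1 or a power of a prime, whatever exponent Tate's algorithm returns.
conductor≢0 : ∀ E → NonZero (conductor E)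
conductor≢0 E = product-map≢0 (λ k → Conductor.localFactor W (suc k))
  (λ k → if≢0 (does (prime? (suc k))) (m^n≢0 (suc k) (Conductor.AtPrime.exponent (suc k) W)) _)
  (upTo ∣ Conductor.Model.Δ W ∣)
  where
  W = EllipticCurves.integralModel E

≡1-%ℕ : ∀ n .{{_ : NonZero n}} d → 1 < n → + n ∣ᶻ d ℤ.- 1ℤ → d %ℕ n ≡ 1
≡1-%ℕ n d 1<n d≡1 = congruent-close (shift-∣ (+ (d %ℕ n)) d 1ℤ rem≡d d≡1) (n%ℕd<d d n) 1<n
  where
  cancel : ∀ r x → r ℤ.- (r ℤ.+ x) ≡ ℤ.- x
  cancel = ℤSolver.solve-∀
  rem≡d : + n ∣ᶻ + (d %ℕ n) ℤ.- d
  rem≡d = subst (+ n ∣ᶻ_)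
    (sym (trans (cong (λ z → + (d %ℕ n) ℤ.- z) (a≡a%ℕn+[a/ℕn]*n d n)) (cancel (+ (d %ℕ n)) (d /ℕ n ℤ.* + n))))
    (ℤ∣.∣m⇒∣-m (∣n⇒∣m*n (d /ℕ n) (+∣+ (∣-refl {n}))))

discQuadraticField-≡1 : ∀ d → d %ℕ 4 ≡ 1 → discQuadraticField d ≡ d
discQuadraticField-≡1 d eq with d %ℕ 4
discQuadraticField-≡1 d refl | .1 = refl

kronecker₂-≡1 : ∀ d → d %ℕ 8 ≡ 1 → kronecker₂ d ≡ 1ℤ
kronecker₂-≡1 d eq with d %ℕ 8
kronecker₂-≡1 d refl | .1 = refl

legendre-≡1 : ∀ d q → Prime q → + q ∣ᶻ d ℤ.- 1ℤ → legendre d q ≡ 1ℤ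
legendre-≡1 d q pq d≡1
  rewrite dec-false (q ∣? ∣ d ∣) (λ q∣d → prime∤1 pq (∣-resp-mod d 1ℤ d≡1 (∣ᵤ⇒∣ q∣d)))
        | dec-true (anyUpTo? (λ x → q ∣? ∣ + (x * x) ℤ.- d ∣) q)
            -- The square root of d mod q is 1, which lies in the search range since q > 1.
            (1 , nonTrivial⇒n>1 q {{prime⇒nonTrivial pq}} , subst (q ∣_) (ℤ.∣i-j∣≡∣j-i∣ d 1ℤ) (∣⇒∣ᵤ d≡1))
  = refl

kroneckerPrime-≡1 : ∀ d q → Prime q → + 8 ∣ᶻ d ℤ.- 1ℤ → + q ∣ᶻ d ℤ.- 1ℤ → kroneckerPrime d q ≡ 1ℤ
kroneckerPrime-≡1 d 0 pq 8∣ q∣ = legendre-≡1 d 0 pq q∣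
kroneckerPrime-≡1 d 1 pq 8∣ q∣ = legendre-≡1 d 1 pq q∣
kroneckerPrime-≡1 d 2 pq 8∣ q∣ = kronecker₂-≡1 d (≡1-%ℕ 8 d (s≤s (s≤s z≤n)) 8∣)
kroneckerPrime-≡1 d (suc (suc (suc q))) pq 8∣ q∣ = legendre-≡1 d (suc (suc (suc q))) pq q∣

-- Congruence mod 4 makes d its own discriminant, congruence mod 8 gives symbol 1 at 2, and
-- congruence mod N gives symbol 1 at the odd primes of N. What survives is the factor at -1, the
-- sign of d.
χ-≡1 : ∀ N .{{_ : NonZero N}} d → + (8 * N) ∣ᶻ d ℤ.- 1ℤ → χ d (ℤ.- (+ N)) ≡ kronecker₋₁ d
χ-≡1 (suc n) d d≡1 = begin
  kronecker (discQuadraticField d) -[1+ n ]     ≡⟨ cong (λ D → kronecker D -[1+ n ]) (discQuadraticField-≡1 d (≡1-%ℕ 4 d (s≤s (s≤s z≤n)) 4∣)) ⟩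
  kronecker₋₁ d ℤ.* kroneckerPositive d (suc n) ≡⟨ cong (kronecker₋₁ d ℤ.*_) (positive (factorise (suc n))) ⟩
  kronecker₋₁ d ℤ.* 1ℤ                          ≡⟨ ℤ.*-identityʳ (kronecker₋₁ d) ⟩
  kronecker₋₁ d                                 ∎
  where
  open ≡-Reasoning
  8∣ : + 8 ∣ᶻ d ℤ.- 1ℤ
  8∣ = ℤ∣.∣-trans (+∣+ (m∣m*n (suc n))) d≡1
  4∣ : + 4 ∣ᶻ d ℤ.- 1ℤ
  4∣ = ℤ∣.∣-trans (+∣+ (divides 2 refl)) 8∣
  ones : ∀ qs → All Prime qs → product qs ∣ suc n → foldr ℤ._*_ 1ℤ (map (kroneckerPrime d) qs) ≡ 1ℤ
  ones []       []         _ = refl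
  ones (q ∷ qs) (pq ∷ pqs) q∣ = cong₂ ℤ._*_
    (kroneckerPrime-≡1 d q pq 8∣ (ℤ∣.∣-trans (+∣+ (∣-trans (∣-trans (m∣m*n (product qs)) q∣) (n∣m*n 8))) d≡1))
    (ones qs pqs (∣-trans (n∣m*n q) q∣))
  positive : (F : PrimeFactorisation (suc n)) → foldr ℤ._*_ 1ℤ (map (kroneckerPrime d) (PrimeFactorisation.factors F)) ≡ 1ℤ
  positive F = ones (PrimeFactorisation.factors F) (PrimeFactorisation.factorsPrime F)
    (subst (product (PrimeFactorisation.factors F) ∣_) (sym (PrimeFactorisation.isFactorisation F)) ∣-refl)

-- Points on twists of positive rank

module _ (E : EllipticCurve) (d : ℤ) where
  open EllipticCurves using (Point; O; aff)
  open EllipticCurves.Twist E d using (_⊞_; _×ℤ_; Independent; IndependentFamily; OnCurve)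

  drop-point : ∀ {r} → IndependentFamily (suc r) → IndependentFamily r
  drop-point {r} (P , on , independent) = P ∘ suc , on ∘ suc , λ n sum≡O i → independent (extend n) sum≡O (suc i)
    where
    extend : (Fin r → ℤ) → Fin (suc r) → ℤ
    extend n zero    = 0ℤ
    extend n (suc i) = n i

  drop-points : ∀ {r s} → r ≤′ s → IndependentFamily s → IndependentFamily r
  drop-points (≤′-reflexive refl) F = F
  drop-points (≤′-step r≤s)       F = drop-points r≤s (drop-point F)

  -- The conjecture hands out a rank of `E` anew for each d. Uniqueness identifies it with the rank
  -- from which the sign of d was chosen.
  rank-unique : ∀ {r s} → HasRank E d r → HasRank E d s → r ≡ s
  rank-unique {r} {s} (F , ¬F⁺) (F′ , ¬F′⁺) with <-cmp r s
  ... | tri< r<s _ _ = contradiction (drop-points (≤⇒≤′ r<s) F′) ¬F⁺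
  ... | tri≈ _ r≡s _ = r≡s
  ... | tri> _ _ s<r = contradiction (drop-points (≤⇒≤′ s<r) F) ¬F′⁺

  vanishing-sum : ∀ {r} (P : Fin r → Point) → Vector.foldr _⊞_ O (λ i → 0ℤ ×ℤ P i) ≡ O
  vanishing-sum {zero}  P = refl
  vanishing-sum {suc r} P = vanishing-sum (P ∘ suc)

  -- Test independence with the coefficients m, 0, ..., 0. Zero multiples compute to `O` and `O ⊞ Q`
  -- computes to `Q`, so the combination is `O` as soon as the first term is.
  independent⇒non-torsion : ∀ {r} (P : Fin (suc r) → Point) → Independent P → ∀ m → m ×ℤ P zero ≡ O → m ≡ 0ℤ
  independent⇒non-torsion {r} P independent m mP≡O =
    independent n (trans (cong (_⊞ Vector.foldr _⊞_ O (λ i → 0ℤ ×ℤ P (suc i))) mP≡O) (vanishing-sum (P ∘ suc))) zero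
    where
    n : Fin (suc r) → ℤ
    n zero    = m
    n (suc i) = 0ℤ

  double-2-torsion : ∀ x y → y ℚ.+ y ≡ 0ℚ → aff x y ⊞ aff x y ≡ O
  double-2-torsion x y y+y≡0 with x ℚ.≟ x | y ℚ.+ y ℚ.≟ 0ℚ
  ... | yes _  | yes _     = refl
  ... | yes _  | no  y+y≢0 = contradiction y+y≡0 y+y≢0
  ... | no x≢x | _         = contradiction refl x≢x

  positive-rank⇒point : ∀ {r} → IndependentFamily (suc r) →
    ∃₂ λ x y → y ≢ 0ℚ × fromℤ d ℚ.* (y ℚ.* y) ≡ eval (EllipticCurve.g E) x
  positive-rank⇒point (P , on , independent) = at (P zero) (on zero) (independent⇒non-torsion P independent)
    where
    at : ∀ Q → OnCurve Q → (∀ m → m ×ℤ Q ≡ O → m ≡ 0ℤ) → _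
    at O         _  non-torsion with non-torsion (+ 1) refl
    ... | ()
    at (aff x y) on non-torsion = x , y , y≢0 , on
      where
      y≢0 : y ≢ 0ℚ
      -- The multiple `+ 2 ×ℤ Q` is `Q ⊞ (Q ⊞ O)`, which computes to `Q ⊞ Q`.
      y≢0 refl with non-torsion (+ 2) (double-2-torsion x 0ℚ refl)
      ... | ()

-1^-sign : ∀ r → ℤ.-1ℤ ℤ.^ r ≡ 1ℤ ⊎ ℤ.-1ℤ ℤ.^ r ≡ ℤ.-1ℤ
-1^-sign zero    = inj₁ refl
-1^-sign (suc r) = Sum.swap (Sum.map (cong (ℤ.-1ℤ ℤ.*_)) (cong (ℤ.-1ℤ ℤ.*_)) (-1^-sign r))

TwistPoint : EllipticCurve → ℕ → ℤ → ℕ → Set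
TwistPoint E p a B = ∃ λ d → B < ∣ d ∣ × Squarefree d × + p ∣ᶻ d ℤ.- a ×
  ∃₂ λ x y → y ≢ 0ℚ × fromℤ d ℚ.* (y ℚ.* y) ≡ eval (EllipticCurve.g E) x

-- For d ≡ 1 mod 8N the conjecture reads (-1)^rank(E_d) = (-1)^rank(E) sgn d, so one of the two signs of d
-- makes rank(E_d) odd.
module Parity (parity : ParityConjecture) (E : EllipticCurve) where
  N M : ℕ
  N = conductor E
  -- The factor 8 N controls discriminant and character; the further factor 3 makes M divisible by
  -- 6, as the sieve requires.
  M = 24 * N

  instance
    N≢0 : NonZero N
    N≢0 = conductor≢0 E
    M≢0 : NonZero M
    M≢0 = m*n≢0 24 N

  8N∣M : 8 * N ∣ M
  8N∣M = divides 3 (*-assoc 3 8 N)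

  6∣M : 6 ∣ M
  6∣M = ∣-trans (divides 4 refl) (m∣m*n {24} N)

  odd-rank : ∀ {r} → ℤ.-1ℤ ℤ.^ r ≡ ℤ.-1ℤ → ∃ λ s → r ≡ suc s
  odd-rank {suc s} _ = s , refl

  twist-ranks : ∀ d → Squarefree d → + M ∣ᶻ d ℤ.- 1ℤ →
    ∃₂ λ r r_d → HasRank E 1ℤ r × HasRank E d r_d × ℤ.-1ℤ ℤ.^ r_d ≡ ℤ.-1ℤ ℤ.^ r ℤ.* kronecker₋₁ d
  twist-ranks d sf d≡1 =
    let r , r_d , rank , rank_d , sign = parity E d sf coprime-d coprime-disc in
    r , r_d , rank , rank_d , trans sign (cong (ℤ.-1ℤ ℤ.^ r ℤ.*_) (χ-≡1 N d (ℤ∣.∣-trans (+∣+ 8N∣M) d≡1)))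
    where
    d≢0 : ∣ d ∣ ≢ 0
    d≢0 eq = squarefree≢0 {d} sf (ℤ.∣i∣≡0⇒i≡0 eq)
    apart : ∀ q → Prime q → q ∣ ∣ d ∣ → ¬ q ∣ M
    apart q pq q∣d q∣M = prime∤1 pq (∣-resp-mod d 1ℤ (ℤ∣.∣-trans (+∣+ q∣M) d≡1) (∣ᵤ⇒∣ q∣d))
    coprime-d : Coprime ∣ d ∣ (2 * N)
    coprime-d = coprime-by-primes d≢0 λ q pq q∣d q∣2N → apart q pq q∣d (∣-trans q∣2N (divides 12 (*-assoc 12 2 N)))
    disc≡ : discQuadraticField d ≡ d
    disc≡ = discQuadraticField-≡1 d (≡1-%ℕ 4 d (s≤s (s≤s z≤n)) (ℤ∣.∣-trans (+∣+ (∣-trans (divides 6 refl) (m∣m*n {24} N))) d≡1))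
    coprime-disc : Coprime ∣ discQuadraticField d ∣ N
    coprime-disc = subst (λ D → Coprime ∣ D ∣ N) (sym disc≡) (coprime-by-primes d≢0 λ q pq q∣d q∣N → apart q pq q∣d (∣-trans q∣N (n∣m*n 24)))

  odd-twist-point : ∀ d → Squarefree d → + M ∣ᶻ d ℤ.- 1ℤ → ∀ {r} → HasRank E 1ℤ r →
    ℤ.-1ℤ ℤ.^ r ℤ.* kronecker₋₁ d ≡ ℤ.-1ℤ → ∃₂ λ x y → y ≢ 0ℚ × fromℤ d ℚ.* (y ℚ.* y) ≡ eval (EllipticCurve.g E) x
  odd-twist-point d sf d≡1 {r} rank sign =
    let r′ , r_d , rank′ , rank_d , sign_d = twist-ranks d sf d≡1
        s , r_d≡ = odd-rank {r_d} (trans sign_d (trans (cong (λ r → ℤ.-1ℤ ℤ.^ r ℤ.* kronecker₋₁ d) (rank-unique E 1ℤ rank′ rank)) sign))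
    in positive-rank⇒point E d (subst (EllipticCurves.Twist.IndependentFamily E d) r_d≡ (proj₁ rank_d))

  twist-point : ∀ {p} → Prime p → ¬ p ∣ M → ∀ a → ¬ + p ∣ᶻ a → ∀ B → TwistPoint E p a B
  twist-point {p} pp p∤M a p∤a B =
    -- At d = 1 the conjecture yields the existence of a rank of `E`, whose parity then decides the
    -- sign of d.
    let r , _ , rank , _ = twist-ranks 1ℤ one-squarefree (ℤ∣.divides 0ℤ refl) in
    [ negative rank , positive rank ]′ (-1^-sign r)
    where
    one-squarefree : Squarefree 1ℤ
    one-squarefree k k²∣1 = m*n≡1⇒m≡1 k k (∣1⇒≡1 k²∣1)
    positive : ∀ {r} → HasRank E 1ℤ r → ℤ.-1ℤ ℤ.^ r ≡ ℤ.-1ℤ → TwistPoint E p a B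
    positive {r} rank odd =
      let d , B<d , sf , d≡a , d≡1 = squarefree-in-class pp M p∤M 6∣M (suc B) a 1ℤ p∤a (λ q pq _ → prime∤1 pq) in
      + d , B<d , sf , d≡a , odd-twist-point (+ d) sf d≡1 {r} rank (trans (ℤ.*-identityʳ (ℤ.-1ℤ ℤ.^ r)) odd)
    negative : ∀ {r} → HasRank E 1ℤ r → ℤ.-1ℤ ℤ.^ r ≡ 1ℤ → TwistPoint E p a B
    negative {r} rank even =
      -- The progression gives positive numbers only, so the conditions are imposed on -d: classes
      -- -a mod p and -1 mod M.
      let d , B<d , sf , d≡-a , d≡-1 = squarefree-in-class pp M p∤M 6∣M (suc B) (ℤ.- a) ℤ.-1ℤ
            (λ d → p∤a (subst (+ p ∣ᶻ_) (ℤ.neg-involutive a) (ℤ∣.∣m⇒∣-m d))) (λ q pq _ d → prime∤1 pq (ℤ∣.∣m⇒∣-m d)) in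
      negate d B<d sf (negate-≡ (+ d) a d≡-a) (negate-≡ (+ d) 1ℤ d≡-1)
      where
      negate-≡ : ∀ {c} d a → c ∣ᶻ d ℤ.- (ℤ.- a) → c ∣ᶻ ℤ.- d ℤ.- a
      negate-≡ {c} d a p = subst (c ∣ᶻ_) (flip d a) (ℤ∣.∣m⇒∣-m p)
        where
        flip : ∀ d a → ℤ.- (d ℤ.- (ℤ.- a)) ≡ ℤ.- d ℤ.- a
        flip = ℤSolver.solve-∀
      negate : ∀ d → suc B ≤ d → Squarefree (+ d) → + p ∣ᶻ ℤ.- (+ d) ℤ.- a → + M ∣ᶻ ℤ.- (+ d) ℤ.- 1ℤ → TwistPoint E p a B
      negate (suc d) B<d sf d≡a d≡1 = -[1+ d ] , B<d , sf , d≡a ,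
        odd-twist-point -[1+ d ] sf d≡1 {r} rank (cong (ℤ._* ℤ.-1ℤ) even)

-- abstract keeps the conductor from being unfolded.
abstract
  parity⇒twist-points : ParityConjecture → ∀ E → ∃ λ M → NonZero M ×
    (∀ {p} → Prime p → ¬ p ∣ M → ∀ a → ¬ + p ∣ᶻ a → ∀ B → TwistPoint E p a B)
  parity⇒twist-points parity E = Parity.M parity E , Parity.M≢0 parity E , Parity.twist-point parity E

-- Degrees 3 and 4

denominator-clears : ∀ q → fromℤ (+ ℚ.↧ₙ q) ℚ.* q ≡ fromℤ (ℚ.↥ q)
denominator-clears q@(mkℚ m n-1 _) = ℚ.toℚᵘ-injective (begin
  toℚᵘ (fromℤ (+ suc n-1) ℚ.* q)              ≈⟨ ℚ.toℚᵘ-homo-* (fromℤ (+ suc n-1)) q ⟩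
  toℚᵘ (fromℤ (+ suc n-1)) ℚᵘ.* toℚᵘ q        ≈⟨ ℚᵘ.*-cong (toℚᵘ-fromℤ (+ suc n-1)) ℚᵘ.≃-refl ⟩
  ℚᵘ.mkℚᵘ (+ suc n-1) 0 ℚᵘ.* ℚᵘ.mkℚᵘ m n-1    ≈⟨ ℚᵘ.*≡* (trans (ℤ.*-identityʳ (+ suc n-1 ℤ.* m)) (trans (ℤ.*-comm
      (+ suc n-1) m) (cong (λ k → m ℤ.* + k) (sym (*-identityˡ (suc n-1)))))) ⟩
  ℚᵘ.mkℚᵘ m 0                                 ≈⟨ toℚᵘ-fromℤ m ⟨
  toℚᵘ (fromℤ m)                              ∎)
  where open ℚᵘ.≃-Reasoning

square-divides⇒unit : ∀ {n m d} → n ≢ 0 → Coprime m n → n * n ∣ m * (m * d) → n * n ∣ d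
square-divides⇒unit {n} {m} {d} n≢0 coprime n²∣ = coprime-divisor {n * n} {m} {d} n²⊥m (coprime-divisor {n * n} {m} {m * d} n²⊥m n²∣)
  where
  n²⊥m : Coprime (n * n) m
  n²⊥m = coprime-by-primes (λ eq → [ n≢0 , n≢0 ]′ (m*n≡0⇒m≡0∨n≡0 n eq)) λ q pq q∣n² q∣m →
    ¬prime[1] (subst Prime (coprime (q∣m , [ (λ d → d) , (λ d → d) ]′ (euclidsLemma n n pq q∣n²))) pq)

numerator⊥denominator : ∀ q → Coprime ∣ ℚ.↥ q ∣ (ℚ.↧ₙ q)
numerator⊥denominator (mkℚ _ _ coprime) = Coprimality.recompute coprime

-- If a = d q² with a integral, then the denominator of q is 1 as its square divides d.
squarefree-part-bounded : ∀ a d q → a ≢ 0ℤ → Squarefree d → fromℤ a ≡ fromℤ d ℚ.* (q ℚ.* q) → ∣ d ∣ ≤ ∣ a ∣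
squarefree-part-bounded a d q a≢0 sf a≡dq² = ∣⇒≤ {{≢-nonZero (a≢0 ∘ ℤ.∣i∣≡0⇒i≡0)}} (divides (∣ m ∣ * ∣ m ∣) (begin
  ∣ a ∣                        ≡⟨ *-identityʳ ∣ a ∣ ⟨
  ∣ a ∣ * (1 * 1)              ≡⟨ cong (λ k → ∣ a ∣ * (k * k)) n≡1 ⟨
  ∣ a ∣ * (n * n)              ≡⟨ absolute ⟩
  ∣ m ∣ * (∣ m ∣ * ∣ d ∣)      ≡⟨ *-assoc (∣ m ∣) (∣ m ∣) (∣ d ∣) ⟨
  ∣ m ∣ * ∣ m ∣ * ∣ d ∣        ∎))
  where
  open ≡-Reasoning
  n : ℕ
  n = ℚ.↧ₙ q
  m : ℤ
  m = ℚ.↥ q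
  coprime : Coprime ∣ m ∣ n
  coprime = numerator⊥denominator q
  clear : ∀ a n d q → d ℚ.* (q ℚ.* q) ≡ a → a ℚ.* (n ℚ.* n) ≡ (n ℚ.* q) ℚ.* ((n ℚ.* q) ℚ.* d)
  clear _ n d q refl = regroup n d q
    where
    regroup : ∀ n d q → d ℚ.* (q ℚ.* q) ℚ.* (n ℚ.* n) ≡ (n ℚ.* q) ℚ.* ((n ℚ.* q) ℚ.* d)
    regroup = RingSolver.solve-∀ ℚ-ring
  integral : a ℤ.* (+ n ℤ.* + n) ≡ m ℤ.* (m ℤ.* d)
  integral = fromℤ-injective (begin
    fromℤ (a ℤ.* (+ n ℤ.* + n))                    ≡⟨ trans (fromℤ-* a _) (cong (fromℤ a ℚ.*_) (fromℤ-* (+ n) (+ n))) ⟩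
    fromℤ a ℚ.* (fromℤ (+ n) ℚ.* fromℤ (+ n))      ≡⟨ clear (fromℤ a) (fromℤ (+ n)) (fromℤ d) q (sym a≡dq²) ⟩
    (fromℤ (+ n) ℚ.* q) ℚ.* ((fromℤ (+ n) ℚ.* q) ℚ.* fromℤ d) ≡⟨ cong (λ y → y ℚ.* (y ℚ.* fromℤ d)) (denominator-clears q) ⟩
    fromℤ m ℚ.* (fromℤ m ℚ.* fromℤ d)              ≡⟨ trans (fromℤ-* m _) (cong (fromℤ m ℚ.*_) (fromℤ-* m d)) ⟨
    fromℤ (m ℤ.* (m ℤ.* d))                        ∎)
  absolute : ∣ a ∣ * (n * n) ≡ ∣ m ∣ * (∣ m ∣ * ∣ d ∣)
  absolute = begin
    ∣ a ∣ * (n * n)               ≡⟨ cong (∣ a ∣ *_) (ℤ.abs-* (+ n) (+ n)) ⟨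
    ∣ a ∣ * ∣ + n ℤ.* + n ∣       ≡⟨ ℤ.abs-* a (+ n ℤ.* + n) ⟨
    ∣ a ℤ.* (+ n ℤ.* + n) ∣       ≡⟨ cong ∣_∣ integral ⟩
    ∣ m ℤ.* (m ℤ.* d) ∣           ≡⟨ trans (ℤ.abs-* m (m ℤ.* d)) (cong (∣ m ∣ *_) (ℤ.abs-* m d)) ⟩
    ∣ m ∣ * (∣ m ∣ * ∣ d ∣)       ∎
  n≡1 : n ≡ 1
  n≡1 = sf n (square-divides⇒unit (λ ()) coprime (divides ∣ a ∣ (sym absolute)))

module Cubic (parity : ParityConjecture) (f : ℤ[x]) (sep : Separable (toℚ[x] f)) (deg : HasDegree (toℚ[x] f) 3) where
  E : EllipticCurve
  E = record { g = toℚ[x] f ; degree = deg ; separable = sep }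

  hits : HitsAllNonzeroClasses f
  hits = let M , M≢0 , twist-point = parity⇒twist-points parity E in hits-by-size f M {{M≢0}} λ pp p∤M a p∤a B →
    let d , B<d , sf , d≡a , x , y , y≢0 , on = twist-point pp p∤M a p∤a B in
    d , B<d , ∈𝒮-intro f d x y sf y≢0 (sym on) , d≡a

-- For lists of known length every coefficient of the products reduces to an explicit sum padded
-- with zeros. Comparing degrees 0 to 4 turns a Bézout identity for a cubic into five equations in
-- ℚ.
bezout-2-3 : ∀ u₀ u₁ v₀ v₁ v₂ g₀ g₁ g₂ g₃ →
  u₀ ℚ.* g₀ ℚ.+ v₀ ℚ.* g₁ ≡ 1ℚ →
  u₀ ℚ.* g₁ ℚ.+ u₁ ℚ.* g₀ ℚ.+ (v₀ ℚ.* (# 2 ℚ.* g₂) ℚ.+ v₁ ℚ.* g₁) ≡ 0ℚ →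
  u₀ ℚ.* g₂ ℚ.+ u₁ ℚ.* g₁ ℚ.+ (v₀ ℚ.* (# 3 ℚ.* g₃) ℚ.+ v₁ ℚ.* (# 2 ℚ.* g₂) ℚ.+ v₂ ℚ.* g₁) ≡ 0ℚ →
  u₀ ℚ.* g₃ ℚ.+ u₁ ℚ.* g₂ ℚ.+ (v₁ ℚ.* (# 3 ℚ.* g₃) ℚ.+ v₂ ℚ.* (# 2 ℚ.* g₂)) ≡ 0ℚ →
  u₁ ℚ.* g₃ ℚ.+ v₂ ℚ.* (# 3 ℚ.* g₃) ≡ 0ℚ →
  (u₀ ∷ u₁ ∷ []) ⊗ (g₀ ∷ g₁ ∷ g₂ ∷ g₃ ∷ [])
    ⊕ (v₀ ∷ v₁ ∷ v₂ ∷ []) ⊗ deriv (g₀ ∷ g₁ ∷ g₂ ∷ g₃ ∷ []) ≈ 1ℚ ∷ []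
bezout-2-3 u₀ u₁ v₀ v₁ v₂ g₀ g₁ g₂ g₃ e₀ e₁ e₂ e₃ e₄ = λ where
    0 → trans (k₀ u₀ v₀ g₀ g₁) e₀
    1 → trans (k₁ u₀ u₁ v₀ v₁ g₀ g₁ g₂) e₁
    2 → trans (k₂ u₀ u₁ v₀ v₁ v₂ g₁ g₂ g₃) e₂
    3 → trans (k₃ u₀ u₁ v₀ v₁ v₂ g₂ g₃) e₃
    4 → trans (k₄ u₁ v₁ v₂ g₃) e₄
    -- `deriv` keeps the length of its list, so the derivative ends in a padding zero that `v₂`
    -- multiplies in degree 5.
    5 → ℚ.*-zeroʳ v₂
    (suc (suc (suc (suc (suc (suc _)))))) → refl
  where
  k₀ : ∀ u₀ v₀ g₀ g₁ →
    u₀ ℚ.* g₀ ℚ.+ 0ℚ ℚ.+ (v₀ ℚ.* (g₁ ℚ.+ 0ℚ) ℚ.+ 0ℚ) ≡ u₀ ℚ.* g₀ ℚ.+ v₀ ℚ.* g₁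
  k₀ = RingSolver.solve-∀ ℚ-ring
  k₁ : ∀ u₀ u₁ v₀ v₁ g₀ g₁ g₂ →
    u₀ ℚ.* g₁ ℚ.+ (u₁ ℚ.* g₀ ℚ.+ 0ℚ) ℚ.+ (v₀ ℚ.* (g₂ ℚ.+ (g₂ ℚ.+ 0ℚ)) ℚ.+ (v₁ ℚ.* (g₁ ℚ.+ 0ℚ) ℚ.+ 0ℚ)) ≡
    u₀ ℚ.* g₁ ℚ.+ u₁ ℚ.* g₀ ℚ.+ (v₀ ℚ.* (# 2 ℚ.* g₂) ℚ.+ v₁ ℚ.* g₁)
  k₁ = RingSolver.solve-∀ ℚ-ring
  k₂ : ∀ u₀ u₁ v₀ v₁ v₂ g₁ g₂ g₃ →
    u₀ ℚ.* g₂ ℚ.+ u₁ ℚ.* g₁ ℚ.+ (v₀ ℚ.* (g₃ ℚ.+ (g₃ ℚ.+ (g₃ ℚ.+ 0ℚ))) ℚ.+ (v₁ ℚ.* (g₂ ℚ.+ (g₂ ℚ.+ 0ℚ)) ℚ.+ (v₂ ℚ.* (g₁ ℚ.+ 0ℚ) ℚ.+ 0ℚ))) ≡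
    u₀ ℚ.* g₂ ℚ.+ u₁ ℚ.* g₁ ℚ.+ (v₀ ℚ.* (# 3 ℚ.* g₃) ℚ.+ v₁ ℚ.* (# 2 ℚ.* g₂) ℚ.+ v₂ ℚ.* g₁)
  k₂ = RingSolver.solve-∀ ℚ-ring
  k₃ : ∀ u₀ u₁ v₀ v₁ v₂ g₂ g₃ →
    u₀ ℚ.* g₃ ℚ.+ u₁ ℚ.* g₂ ℚ.+ (v₀ ℚ.* 0ℚ ℚ.+ (v₁ ℚ.* (g₃ ℚ.+ (g₃ ℚ.+ (g₃ ℚ.+ 0ℚ))) ℚ.+ v₂ ℚ.* (g₂ ℚ.+ (g₂ ℚ.+ 0ℚ)))) ≡
    u₀ ℚ.* g₃ ℚ.+ u₁ ℚ.* g₂ ℚ.+ (v₁ ℚ.* (# 3 ℚ.* g₃) ℚ.+ v₂ ℚ.* (# 2 ℚ.* g₂))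
  k₃ = RingSolver.solve-∀ ℚ-ring
  k₄ : ∀ u₁ v₁ v₂ g₃ →
    u₁ ℚ.* g₃ ℚ.+ (v₁ ℚ.* 0ℚ ℚ.+ v₂ ℚ.* (g₃ ℚ.+ (g₃ ℚ.+ (g₃ ℚ.+ 0ℚ)))) ≡ u₁ ℚ.* g₃ ℚ.+ v₂ ℚ.* (# 3 ℚ.* g₃)
  k₄ = RingSolver.solve-∀ ℚ-ring

module DepressedCubic (H J : ℚ) where

  cubic : ℚ[x]
  cubic = # 3 ℚ.* J ∷ ℚ.- (# 9 ℚ.* H) ∷ 0ℚ ∷ # 3 ∷ []

  cubic-degree : HasDegree cubic 3
  cubic-degree = (λ ()) , λ where
    1 (s≤s ())
    2 (s≤s (s≤s ()))
    3 (s≤s (s≤s (s≤s ())))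
    (suc (suc (suc (suc _)))) _ → refl

  eval-cubic : ∀ s → eval cubic s ≡ # 3 ℚ.* (s ℚ.* (s ℚ.* s) ℚ.- # 3 ℚ.* (H ℚ.* s) ℚ.+ J)
  eval-cubic s = expand s H J
    where
    expand : ∀ s H J →
      # 3 ℚ.* J ℚ.+ s ℚ.* (ℚ.- (# 9 ℚ.* H) ℚ.+ s ℚ.* (0ℚ ℚ.+ s ℚ.* (# 3 ℚ.+ s ℚ.* 0ℚ))) ≡ # 3 ℚ.* (s ℚ.* (s ℚ.* s) ℚ.- # 3 ℚ.* (H ℚ.* s) ℚ.+ J)
    expand = RingSolver.solve-∀ ℚ-ring

  -- The discriminant of s³ - 3 H s + J is -27 times this number.
  disc : ℚ
  disc = J ℚ.* J ℚ.- # 4 ℚ.* (H ℚ.* H ℚ.* H)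

  -- (J + 2Hs)(s³ - 3Hs + J) + (4H² - Js - 2Hs²)(s² - H) = J² - 4H³
  cubic-separable : disc ≢ 0ℚ → Separable cubic
  cubic-separable disc≢0 =
    (u₀ ∷ u₁ ∷ []) , (v₀ ∷ v₁ ∷ v₂ ∷ []) ,
    bezout-2-3 u₀ u₁ v₀ v₁ v₂ (# 3 ℚ.* J) (ℚ.- (# 9 ℚ.* H)) 0ℚ (# 3)
      (trans (e₀ H J z) inv) (e₁ H J z) (e₂ H J z) (e₃ H J z) (e₄ H z)
    where
    z⁻¹ = ℚ-inverse (# 9 ℚ.* disc) (ℚ-*-≢0 {# 9} (λ ()) disc≢0)
    z : ℚ
    z = proj₁ z⁻¹
    inv : # 9 ℚ.* disc ℚ.* z ≡ 1ℚ
    inv = proj₂ z⁻¹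
    u₀ u₁ v₀ v₁ v₂ : ℚ
    -- The curve uses 3 (s³ - 3 H s + J), with derivative 9 (s² - H). Multiplying the first cofactor
    -- of the identity by 3 therefore puts a common factor 9 on both products, and z divides by 9
    -- times `disc`.
    u₀ = # 3 ℚ.* (J ℚ.* z)
    u₁ = # 6 ℚ.* (H ℚ.* z)
    v₀ = # 4 ℚ.* (H ℚ.* H ℚ.* z)
    v₁ = ℚ.- (J ℚ.* z)
    v₂ = ℚ.- (# 2 ℚ.* (H ℚ.* z))
    e₀ : ∀ H J z → # 3 ℚ.* (J ℚ.* z) ℚ.* (# 3 ℚ.* J) ℚ.+ # 4 ℚ.* (H ℚ.* H ℚ.* z) ℚ.* (ℚ.- (# 9 ℚ.* H)) ≡ # 9 ℚ.*
        (J ℚ.* J ℚ.- # 4 ℚ.* (H ℚ.* H ℚ.* H)) ℚ.* z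
    e₀ = RingSolver.solve-∀ ℚ-ring
    e₁ : ∀ H J z → # 3 ℚ.* (J ℚ.* z) ℚ.* (ℚ.- (# 9 ℚ.* H)) ℚ.+ # 6 ℚ.* (H ℚ.* z) ℚ.* (# 3 ℚ.* J)
      ℚ.+ (# 4 ℚ.* (H ℚ.* H ℚ.* z) ℚ.* (# 2 ℚ.* 0ℚ) ℚ.+ (ℚ.- (J ℚ.* z)) ℚ.* (ℚ.- (# 9 ℚ.* H))) ≡ 0ℚ
    e₁ = RingSolver.solve-∀ ℚ-ring
    e₂ : ∀ H J z → # 3 ℚ.* (J ℚ.* z) ℚ.* 0ℚ ℚ.+ # 6 ℚ.* (H ℚ.* z) ℚ.* (ℚ.- (# 9 ℚ.* H))
      ℚ.+ (# 4 ℚ.* (H ℚ.* H ℚ.* z) ℚ.* (# 3 ℚ.* # 3) ℚ.+ (ℚ.- (J ℚ.* z)) ℚ.* (# 2 ℚ.* 0ℚ) ℚ.+ (ℚ.- (# 2 ℚ.* (H ℚ.* z))) ℚ.* (ℚ.- (# 9 ℚ.* H))) ≡ 0ℚ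
    e₂ = RingSolver.solve-∀ ℚ-ring
    e₃ : ∀ H J z → # 3 ℚ.* (J ℚ.* z) ℚ.* # 3 ℚ.+ # 6 ℚ.* (H ℚ.* z) ℚ.* 0ℚ ℚ.+ ((ℚ.- (J ℚ.* z)) ℚ.* (# 3 ℚ.* # 3) ℚ.+ (ℚ.-
        (# 2 ℚ.* (H ℚ.* z))) ℚ.* (# 2 ℚ.* 0ℚ)) ≡ 0ℚ
    e₃ = RingSolver.solve-∀ ℚ-ring
    e₄ : ∀ H z → # 6 ℚ.* (H ℚ.* z) ℚ.* # 3 ℚ.+ (ℚ.- (# 2 ℚ.* (H ℚ.* z))) ℚ.* (# 3 ℚ.* # 3) ≡ 0ℚ
    e₄ = RingSolver.solve-∀ ℚ-ring

  -- The double root is J / 2H, or 0 if H vanishes.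
  double-root : disc ≡ 0ℚ → ∃ λ s → s ℚ.* s ≡ H × # 2 ℚ.* H ℚ.* s ≡ J
  double-root disc≡0 = by-cases (H ℚ.≟ 0ℚ)
    where
    open ≡-Reasoning
    by-cases : Dec (H ≡ 0ℚ) → ∃ λ s → s ℚ.* s ≡ H × # 2 ℚ.* H ℚ.* s ≡ J
    by-cases (yes H≡0) = 0ℚ , sym H≡0 , trans (ℚ.*-zeroʳ (# 2 ℚ.* H)) (sym J≡0)
      where
      drop : ∀ J → J ℚ.* J ≡ J ℚ.* J ℚ.- # 4 ℚ.* (0ℚ ℚ.* 0ℚ ℚ.* 0ℚ)
      drop = RingSolver.solve-∀ ℚ-ring
      J²≡0 : J ℚ.* J ≡ 0ℚ
      J²≡0 = trans (drop J) (trans (cong (λ H → J ℚ.* J ℚ.- # 4 ℚ.* (H ℚ.* H ℚ.* H)) (sym H≡0)) disc≡0)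
      J≡0 : J ≡ 0ℚ
      J≡0 = decidable-stable (J ℚ.≟ 0ℚ) λ J≢0 → ℚ-*-≢0 J≢0 J≢0 J²≡0
    by-cases (no H≢0) = J ℚ.* i , s²≡H , 2Hs≡J
      where
      2H⁻¹ = ℚ-inverse (# 2 ℚ.* H) (ℚ-*-≢0 {# 2} (λ ()) H≢0)
      i : ℚ
      i = proj₁ 2H⁻¹
      inv : # 2 ℚ.* H ℚ.* i ≡ 1ℚ
      inv = proj₂ 2H⁻¹
      2Hs≡J : # 2 ℚ.* H ℚ.* (J ℚ.* i) ≡ J
      2Hs≡J = trans (swap (# 2 ℚ.* H) J i) (trans (cong (J ℚ.*_) inv) (ℚ.*-identityʳ J))
        where
        swap : ∀ D J i → D ℚ.* (J ℚ.* i) ≡ J ℚ.* (D ℚ.* i)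
        swap = RingSolver.solve-∀ ℚ-ring
      s²≡H : J ℚ.* i ℚ.* (J ℚ.* i) ≡ H
      s²≡H = begin
        J ℚ.* i ℚ.* (J ℚ.* i)                                  ≡⟨ split J i H ⟩
        disc ℚ.* (i ℚ.* i) ℚ.+ H ℚ.* (# 2 ℚ.* H ℚ.* i ℚ.* (# 2 ℚ.* H ℚ.* i)) ≡⟨ cong₂ (λ D u → D ℚ.* (i ℚ.* i) ℚ.+ H ℚ.* (u ℚ.* u)) disc≡0 inv ⟩
        0ℚ ℚ.* (i ℚ.* i) ℚ.+ H ℚ.* (1ℚ ℚ.* 1ℚ)                     ≡⟨ tidy i H ⟩
        H                                                ∎
        where
        split : ∀ J i H → J ℚ.* i ℚ.* (J ℚ.* i) ≡ (J ℚ.* J ℚ.- # 4 ℚ.* (H ℚ.* H ℚ.* H)) ℚ.* (i ℚ.* i) ℚ.+ H ℚ.*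
            (# 2 ℚ.* H ℚ.* i ℚ.* (# 2 ℚ.* H ℚ.* i))
        split = RingSolver.solve-∀ ℚ-ring
        tidy : ∀ i H → 0ℚ ℚ.* (i ℚ.* i) ℚ.+ H ℚ.* (1ℚ ℚ.* 1ℚ) ≡ H
        tidy = RingSolver.solve-∀ ℚ-ring

-- The substitution x = ρ + 1/t turns t⁴ f(x) into the cubic A t³ + B t² + C t + L, and 3A t + B = s
-- depresses it: 27A² (A t³ + B t² + C t + L) = s³ - 3H s + J.  The factor 3 in the curve y² = 3 (s³ - 3H s + J)
-- makes 81A² a square.
module QuarticWithRoot (f : ℤ[x]) (sep : Separable (toℚ[x] f)) (deg : HasDegree (toℚ[x] f) 4)
  (ρ : ℚ) (root : eval (toℚ[x] f) ρ ≡ 0ℚ) where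

  c₀ c₁ c₂ c₃ c₄ A B C L H J : ℚ
  c₀ = coeff (toℚ[x] f) 0
  c₁ = coeff (toℚ[x] f) 1
  c₂ = coeff (toℚ[x] f) 2
  c₃ = coeff (toℚ[x] f) 3
  c₄ = coeff (toℚ[x] f) 4
  -- `A`, `B`, `C`, `L` are the Taylor coefficients of f at ρ in degrees 1 to 4. The factor `# 1`
  -- lets `A` match the expression that `eval-f′` gives for the derivative at ρ.
  A = # 1 ℚ.* c₁ ℚ.+ ρ ℚ.* (# 2 ℚ.* c₂ ℚ.+ ρ ℚ.* (# 3 ℚ.* c₃ ℚ.+ ρ ℚ.* (# 4 ℚ.* c₄)))
  B = c₂ ℚ.+ ρ ℚ.* (# 3 ℚ.* c₃ ℚ.+ ρ ℚ.* (# 6 ℚ.* c₄))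
  C = c₃ ℚ.+ ρ ℚ.* (# 4 ℚ.* c₄)
  L = c₄
  H = B ℚ.* B ℚ.- # 3 ℚ.* (A ℚ.* C)
  J = # 2 ℚ.* (B ℚ.* (B ℚ.* B)) ℚ.- # 9 ℚ.* (A ℚ.* (B ℚ.* C)) ℚ.+ # 27 ℚ.* (A ℚ.* A ℚ.* L)

  open DepressedCubic H J

  g g′ : ℚ → ℚ
  g  t = L ℚ.+ t ℚ.* (C ℚ.+ t ℚ.* (B ℚ.+ t ℚ.* A))
  g′ t = C ℚ.+ t ℚ.* (# 2 ℚ.* B ℚ.+ t ℚ.* (# 3 ℚ.* A))

  eval-f : ∀ x → eval (toℚ[x] f) x ≡ c₀ ℚ.+ x ℚ.* (c₁ ℚ.+ x ℚ.* (c₂ ℚ.+ x ℚ.* (c₃ ℚ.+ x ℚ.* c₄)))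
  eval-f x = eval-horner (toℚ[x] f) 4 x (proj₂ deg)

  eval-f′ : ∀ x → eval (deriv (toℚ[x] f)) x ≡ # 1 ℚ.* c₁ ℚ.+ x ℚ.* (# 2 ℚ.* c₂ ℚ.+ x ℚ.* (# 3 ℚ.* c₃ ℚ.+ x ℚ.* (# 4 ℚ.* c₄)))
  eval-f′ x = eval-deriv (toℚ[x] f) 3 x (proj₂ deg)

  A≢0 : A ≢ 0ℚ
  A≢0 A≡0 = separable-no-double-root (toℚ[x] f) sep ρ root (trans (eval-f′ ρ) A≡0)

  f-near-root : ∀ w → eval (toℚ[x] f) (ρ ℚ.+ w) ≡ w ℚ.* (A ℚ.+ w ℚ.* (B ℚ.+ w ℚ.* (C ℚ.+ w ℚ.* L)))
  f-near-root w = begin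
    eval (toℚ[x] f) (ρ ℚ.+ w)              ≡⟨ eval-f (ρ ℚ.+ w) ⟩
    c₀ ℚ.+ (ρ ℚ.+ w) ℚ.* (c₁ ℚ.+ (ρ ℚ.+ w) ℚ.* (c₂ ℚ.+ (ρ ℚ.+ w) ℚ.* (c₃ ℚ.+ (ρ ℚ.+ w) ℚ.* c₄)))
                                           ≡⟨ taylor ρ w c₀ c₁ c₂ c₃ c₄ ⟩
    c₀ ℚ.+ ρ ℚ.* (c₁ ℚ.+ ρ ℚ.* (c₂ ℚ.+ ρ ℚ.* (c₃ ℚ.+ ρ ℚ.* c₄))) ℚ.+ w ℚ.* (A ℚ.+ w ℚ.* (B ℚ.+ w ℚ.* (C ℚ.+ w ℚ.* L)))
                                           ≡⟨ cong (ℚ._+ w ℚ.* (A ℚ.+ w ℚ.* (B ℚ.+ w ℚ.* (C ℚ.+ w ℚ.* L)))) (trans (sym (eval-f ρ)) root) ⟩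
    0ℚ ℚ.+ w ℚ.* (A ℚ.+ w ℚ.* (B ℚ.+ w ℚ.* (C ℚ.+ w ℚ.* L))) ≡⟨ ℚ.+-identityˡ _ ⟩
    w ℚ.* (A ℚ.+ w ℚ.* (B ℚ.+ w ℚ.* (C ℚ.+ w ℚ.* L))) ∎
    where
    open ≡-Reasoning
    taylor : ∀ ρ w c₀ c₁ c₂ c₃ c₄ →
      c₀ ℚ.+ (ρ ℚ.+ w) ℚ.* (c₁ ℚ.+ (ρ ℚ.+ w) ℚ.* (c₂ ℚ.+ (ρ ℚ.+ w) ℚ.* (c₃ ℚ.+ (ρ ℚ.+ w) ℚ.* c₄))) ≡
      c₀ ℚ.+ ρ ℚ.* (c₁ ℚ.+ ρ ℚ.* (c₂ ℚ.+ ρ ℚ.* (c₃ ℚ.+ ρ ℚ.* c₄)))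
        ℚ.+ w ℚ.* (# 1 ℚ.* c₁ ℚ.+ ρ ℚ.* (# 2 ℚ.* c₂ ℚ.+ ρ ℚ.* (# 3 ℚ.* c₃ ℚ.+ ρ ℚ.* (# 4 ℚ.* c₄)))
        ℚ.+ w ℚ.* (c₂ ℚ.+ ρ ℚ.* (# 3 ℚ.* c₃ ℚ.+ ρ ℚ.* (# 6 ℚ.* c₄)) ℚ.+ w ℚ.* (c₃ ℚ.+ ρ ℚ.* (# 4 ℚ.* c₄) ℚ.+ w ℚ.* c₄)))
    taylor = RingSolver.solve-∀ ℚ-ring

  f′-near-root : ∀ w → eval (deriv (toℚ[x] f)) (ρ ℚ.+ w) ≡
    A ℚ.+ w ℚ.* (# 2 ℚ.* B ℚ.+ w ℚ.* (# 3 ℚ.* C ℚ.+ w ℚ.* (# 4 ℚ.* L)))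
  f′-near-root w = trans (eval-f′ (ρ ℚ.+ w)) (taylor′ ρ w c₁ c₂ c₃ c₄)
    where
    taylor′ : ∀ ρ w c₁ c₂ c₃ c₄ →
      # 1 ℚ.* c₁ ℚ.+ (ρ ℚ.+ w) ℚ.* (# 2 ℚ.* c₂ ℚ.+ (ρ ℚ.+ w) ℚ.* (# 3 ℚ.* c₃ ℚ.+ (ρ ℚ.+ w) ℚ.* (# 4 ℚ.* c₄))) ≡
      # 1 ℚ.* c₁ ℚ.+ ρ ℚ.* (# 2 ℚ.* c₂ ℚ.+ ρ ℚ.* (# 3 ℚ.* c₃ ℚ.+ ρ ℚ.* (# 4 ℚ.* c₄)))
        ℚ.+ w ℚ.* (# 2 ℚ.* (c₂ ℚ.+ ρ ℚ.* (# 3 ℚ.* c₃ ℚ.+ ρ ℚ.* (# 6 ℚ.* c₄))) ℚ.+ w ℚ.* (# 3 ℚ.* (c₃ ℚ.+ ρ ℚ.* (# 4 ℚ.* c₄)) ℚ.+ w ℚ.* (# 4 ℚ.* c₄)))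
    taylor′ = RingSolver.solve-∀ ℚ-ring

  depress : ∀ A B C L t →
    (# 3 ℚ.* A ℚ.* t ℚ.+ B) ℚ.* ((# 3 ℚ.* A ℚ.* t ℚ.+ B) ℚ.* (# 3 ℚ.* A ℚ.* t ℚ.+ B))
      ℚ.- # 3 ℚ.* ((B ℚ.* B ℚ.- # 3 ℚ.* (A ℚ.* C)) ℚ.* (# 3 ℚ.* A ℚ.* t ℚ.+ B))
      ℚ.+ (# 2 ℚ.* (B ℚ.* (B ℚ.* B)) ℚ.- # 9 ℚ.* (A ℚ.* (B ℚ.* C)) ℚ.+ # 27 ℚ.* (A ℚ.* A ℚ.* L)) ≡
    # 27 ℚ.* (A ℚ.* A ℚ.* (L ℚ.+ t ℚ.* (C ℚ.+ t ℚ.* (B ℚ.+ t ℚ.* A))))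
  depress = RingSolver.solve-∀ ℚ-ring

  depress′ : ∀ A B C t →
    (# 3 ℚ.* A ℚ.* t ℚ.+ B) ℚ.* (# 3 ℚ.* A ℚ.* t ℚ.+ B) ℚ.- (B ℚ.* B ℚ.- # 3 ℚ.* (A ℚ.* C)) ≡ # 3 ℚ.* (A ℚ.* (C ℚ.+ t ℚ.*
        (# 2 ℚ.* B ℚ.+ t ℚ.* (# 3 ℚ.* A))))
  depress′ = RingSolver.solve-∀ ℚ-ring

  undepress : ∀ s → ∃ λ t → # 3 ℚ.* A ℚ.* t ℚ.+ B ≡ s
  undepress s = (s ℚ.- B) ℚ.* i , trans (regroup (# 3 ℚ.* A) s B i) (trans (cong (λ u → (s ℚ.- B) ℚ.* u ℚ.+ B) inv) (cancel s B))
    where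
    3A⁻¹ = ℚ-inverse (# 3 ℚ.* A) (ℚ-*-≢0 {# 3} (λ ()) A≢0)
    i : ℚ
    i = proj₁ 3A⁻¹
    inv : # 3 ℚ.* A ℚ.* i ≡ 1ℚ
    inv = proj₂ 3A⁻¹
    regroup : ∀ D s B i → D ℚ.* ((s ℚ.- B) ℚ.* i) ℚ.+ B ≡ (s ℚ.- B) ℚ.* (D ℚ.* i) ℚ.+ B
    regroup = RingSolver.solve-∀ ℚ-ring
    cancel : ∀ s B → (s ℚ.- B) ℚ.* 1ℚ ℚ.+ B ≡ s
    cancel = RingSolver.solve-∀ ℚ-ring

  -- Inserting powers of t w = 1 makes all terms divisible by w⁴; the claim then becomes a
  -- polynomial identity in t and w without inverses.
  f-at-1/t : ∀ t w → t ℚ.* w ≡ 1ℚ → eval (toℚ[x] f) (ρ ℚ.+ w) ≡ w ℚ.* w ℚ.* (w ℚ.* w) ℚ.* g t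
  f-at-1/t t w tw≡1 = begin
    eval (toℚ[x] f) (ρ ℚ.+ w)                                      ≡⟨ f-near-root w ⟩
    w ℚ.* (A ℚ.+ w ℚ.* (B ℚ.+ w ℚ.* (C ℚ.+ w ℚ.* L)))              ≡⟨ insert A B C L w ⟩
    weighted 1ℚ                                                    ≡⟨ cong weighted tw≡1 ⟨
    weighted (t ℚ.* w)                                             ≡⟨ reverse A B C L t w ⟩
    w ℚ.* w ℚ.* (w ℚ.* w) ℚ.* g t                                  ∎
    where
    open ≡-Reasoning
    weighted : ℚ → ℚ
    weighted u = w ℚ.* (A ℚ.* (u ℚ.* u ℚ.* u) ℚ.+ w ℚ.* (B ℚ.* (u ℚ.* u) ℚ.+ w ℚ.* (C ℚ.* u ℚ.+ w ℚ.* L)))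
    insert : ∀ A B C L w → w ℚ.* (A ℚ.+ w ℚ.* (B ℚ.+ w ℚ.* (C ℚ.+ w ℚ.* L))) ≡
      w ℚ.* (A ℚ.* (1ℚ ℚ.* 1ℚ ℚ.* 1ℚ) ℚ.+ w ℚ.* (B ℚ.* (1ℚ ℚ.* 1ℚ) ℚ.+ w ℚ.* (C ℚ.* 1ℚ ℚ.+ w ℚ.* L)))
    insert = RingSolver.solve-∀ ℚ-ring
    reverse : ∀ A B C L t w →
      w ℚ.* (A ℚ.* (t ℚ.* w ℚ.* (t ℚ.* w) ℚ.* (t ℚ.* w)) ℚ.+ w ℚ.* (B ℚ.* (t ℚ.* w ℚ.* (t ℚ.* w)) ℚ.+ w ℚ.* (C ℚ.* (t ℚ.* w) ℚ.+ w ℚ.* L))) ≡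
      w ℚ.* w ℚ.* (w ℚ.* w) ℚ.* (L ℚ.+ t ℚ.* (C ℚ.+ t ℚ.* (B ℚ.+ t ℚ.* A)))
    reverse = RingSolver.solve-∀ ℚ-ring

  -- This is the w-derivative of w⁴ g(1/w), namely 4 w³ g - w² g′, with w³ factored out by means of
  -- t w = 1.
  f′-at-1/t : ∀ t w → t ℚ.* w ≡ 1ℚ →
    eval (deriv (toℚ[x] f)) (ρ ℚ.+ w) ≡ w ℚ.* (w ℚ.* w) ℚ.* (# 4 ℚ.* g t ℚ.- t ℚ.* g′ t)
  f′-at-1/t t w tw≡1 = begin
    eval (deriv (toℚ[x] f)) (ρ ℚ.+ w)                              ≡⟨ f′-near-root w ⟩
    A ℚ.+ w ℚ.* (# 2 ℚ.* B ℚ.+ w ℚ.* (# 3 ℚ.* C ℚ.+ w ℚ.* (# 4 ℚ.* L))) ≡⟨ insert A B C L w ⟩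
    weighted 1ℚ                                                    ≡⟨ cong weighted tw≡1 ⟨
    weighted (t ℚ.* w)                                             ≡⟨ reverse A B C L t w ⟩
    w ℚ.* (w ℚ.* w) ℚ.* (# 4 ℚ.* g t ℚ.- t ℚ.* g′ t) ∎
    where
    open ≡-Reasoning
    weighted : ℚ → ℚ
    weighted u = A ℚ.* (u ℚ.* u ℚ.* u) ℚ.+ w ℚ.* (# 2 ℚ.* B ℚ.* (u ℚ.* u) ℚ.+ w ℚ.* (# 3 ℚ.* C ℚ.* u ℚ.+ w ℚ.* (# 4 ℚ.* L)))
    insert : ∀ A B C L w → A ℚ.+ w ℚ.* (# 2 ℚ.* B ℚ.+ w ℚ.* (# 3 ℚ.* C ℚ.+ w ℚ.* (# 4 ℚ.* L))) ≡
      A ℚ.* (1ℚ ℚ.* 1ℚ ℚ.* 1ℚ) ℚ.+ w ℚ.* (# 2 ℚ.* B ℚ.* (1ℚ ℚ.* 1ℚ) ℚ.+ w ℚ.* (# 3 ℚ.* C ℚ.* 1ℚ ℚ.+ w ℚ.* (# 4 ℚ.* L)))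
    insert = RingSolver.solve-∀ ℚ-ring
    reverse : ∀ A B C L t w →
      A ℚ.* (t ℚ.* w ℚ.* (t ℚ.* w) ℚ.* (t ℚ.* w)) ℚ.+ w ℚ.* (# 2 ℚ.* B ℚ.* (t ℚ.* w ℚ.* (t ℚ.* w)) ℚ.+ w ℚ.* (# 3 ℚ.* C ℚ.*
          (t ℚ.* w) ℚ.+ w ℚ.* (# 4 ℚ.* L))) ≡
      w ℚ.* (w ℚ.* w) ℚ.* (# 4 ℚ.* (L ℚ.+ t ℚ.* (C ℚ.+ t ℚ.* (B ℚ.+ t ℚ.* A))) ℚ.- t ℚ.* (C ℚ.+ t ℚ.* (# 2 ℚ.* B ℚ.+ t ℚ.* (# 3 ℚ.* A))))
    reverse = RingSolver.solve-∀ ℚ-ring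

  g-at-0 : g 0ℚ ≡ c₄
  g-at-0 = constant A B C L
    where
    constant : ∀ A B C L → L ℚ.+ 0ℚ ℚ.* (C ℚ.+ 0ℚ ℚ.* (B ℚ.+ 0ℚ ℚ.* A)) ≡ L
    constant = RingSolver.solve-∀ ℚ-ring

  no-double-root : ∀ t → g t ≡ 0ℚ → g′ t ≢ 0ℚ
  no-double-root t g≡0 g′≡0 = by-cases (t ℚ.≟ 0ℚ)
    where
    by-cases : ¬ Dec (t ≡ 0ℚ)
    -- The value t = 0 corresponds to x at infinity, where g takes the leading coefficient of f as
    -- its value.
    by-cases (yes t≡0) = proj₁ deg (trans (sym g-at-0) (trans (cong g (sym t≡0)) g≡0))
    by-cases (no t≢0) = separable-no-double-root (toℚ[x] f) sep (ρ ℚ.+ w)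
      (trans (f-at-1/t t w inv) (trans (cong (w ℚ.* w ℚ.* (w ℚ.* w) ℚ.*_) g≡0) (ℚ.*-zeroʳ (w ℚ.* w ℚ.* (w ℚ.* w)))))
      (trans (f′-at-1/t t w inv) (trans (cong₂ (λ a b → w ℚ.* (w ℚ.* w) ℚ.* (# 4 ℚ.* a ℚ.- t ℚ.* b)) g≡0 g′≡0) (vanish t w)))
      where
      t⁻¹ = ℚ-inverse t t≢0
      w : ℚ
      w = proj₁ t⁻¹
      inv : t ℚ.* w ≡ 1ℚ
      inv = proj₂ t⁻¹
      vanish : ∀ t w → w ℚ.* (w ℚ.* w) ℚ.* (# 4 ℚ.* 0ℚ ℚ.- t ℚ.* 0ℚ) ≡ 0ℚ
      vanish = RingSolver.solve-∀ ℚ-ring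

  -- A vanishing discriminant gives a rational double root of the depressed cubic; undoing the
  -- linear change 3 A t + B = s makes it a double root of g.
  disc≢0 : disc ≢ 0ℚ
  disc≢0 disc≡0 = no-double-root t g≡0 g′≡0
    where
    s t : ℚ
    s = proj₁ (double-root disc≡0)
    t = proj₁ (undepress s)
    s≡ : # 3 ℚ.* A ℚ.* t ℚ.+ B ≡ s
    s≡ = proj₂ (undepress s)
    s²≡H : s ℚ.* s ≡ H
    s²≡H = proj₁ (proj₂ (double-root disc≡0))
    2Hs≡J : # 2 ℚ.* H ℚ.* s ≡ J
    2Hs≡J = proj₂ (proj₂ (double-root disc≡0))
    cubic≡0 : s ℚ.* (s ℚ.* s) ℚ.- # 3 ℚ.* (H ℚ.* s) ℚ.+ J ≡ 0ℚ
    cubic≡0 = trans (cong₂ (λ a b → s ℚ.* a ℚ.- # 3 ℚ.* (H ℚ.* s) ℚ.+ b) s²≡H (sym 2Hs≡J)) (collect s H)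
      where
      collect : ∀ s H → s ℚ.* H ℚ.- # 3 ℚ.* (H ℚ.* s) ℚ.+ # 2 ℚ.* H ℚ.* s ≡ 0ℚ
      collect = RingSolver.solve-∀ ℚ-ring
    g≡0 : g t ≡ 0ℚ
    g≡0 = ℚ-*-cancel-0 (A ℚ.* A) (g t) (ℚ-*-≢0 A≢0 A≢0) (ℚ-*-cancel-0 (# 27) _ (λ ())
      (trans (sym (depress A B C L t)) (trans (cong (λ s → s ℚ.* (s ℚ.* s) ℚ.- # 3 ℚ.* (H ℚ.* s) ℚ.+ J) s≡) cubic≡0)))
    g′≡0 : g′ t ≡ 0ℚ
    g′≡0 = ℚ-*-cancel-0 A (g′ t) A≢0 (ℚ-*-cancel-0 (# 3) _ (λ ())
      (trans (sym (depress′ A B C t)) (trans (cong (λ s → s ℚ.* s ℚ.- H) s≡) (trans (cong (ℚ._- H) s²≡H) (ℚ.+-inverseʳ H)))))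

  E : EllipticCurve
  E = record { g = cubic ; degree = cubic-degree ; separable = cubic-separable disc≢0 }

  9A : ℚ
  9A = # 9 ℚ.* A

  9A≢0 : 9A ≢ 0ℚ
  9A≢0 = ℚ-*-≢0 {# 9} (λ ()) A≢0

  1/9A : ℚ
  1/9A = proj₁ (ℚ-inverse 9A 9A≢0)

  9A-inverse : 9A ℚ.* 1/9A ≡ 1ℚ
  9A-inverse = proj₂ (ℚ-inverse 9A 9A≢0)

  1/9A≢0 : 1/9A ≢ 0ℚ
  1/9A≢0 eq = ℚ.1≢0 (trans (sym 9A-inverse) (trans (cong (9A ℚ.*_) eq) (ℚ.*-zeroʳ 9A)))

  g-at-point : ∀ δ s y t → δ ℚ.* (y ℚ.* y) ≡ eval cubic s → # 3 ℚ.* A ℚ.* t ℚ.+ B ≡ s →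
    g t ≡ δ ℚ.* (y ℚ.* 1/9A ℚ.* (y ℚ.* 1/9A))
  g-at-point δ s y t on s≡ = begin
    g t                                                   ≡⟨ ℚ.*-identityˡ (g t) ⟨
    1ℚ ℚ.* g t                                            ≡⟨ cong (λ u → u ℚ.* u ℚ.* g t) 9A-inverse ⟨
    9A ℚ.* 1/9A ℚ.* (9A ℚ.* 1/9A) ℚ.* g t                 ≡⟨ regroup A 1/9A (g t) ⟩
    # 3 ℚ.* (# 27 ℚ.* (A ℚ.* A ℚ.* g t)) ℚ.* (1/9A ℚ.* 1/9A)
      ≡⟨ cong (λ u → # 3 ℚ.* u ℚ.* (1/9A ℚ.* 1/9A)) (trans (sym (depress A B C L t)) (cong (λ s → s ℚ.* (s ℚ.* s) ℚ.- # 3 ℚ.* (H ℚ.* s) ℚ.+ J) s≡)) ⟩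
    # 3 ℚ.* (s ℚ.* (s ℚ.* s) ℚ.- # 3 ℚ.* (H ℚ.* s) ℚ.+ J) ℚ.* (1/9A ℚ.* 1/9A)
      ≡⟨ cong (ℚ._* (1/9A ℚ.* 1/9A)) (trans (sym (eval-cubic s)) (sym on)) ⟩
    δ ℚ.* (y ℚ.* y) ℚ.* (1/9A ℚ.* 1/9A)                   ≡⟨ collect δ y 1/9A ⟩
    δ ℚ.* (y ℚ.* 1/9A ℚ.* (y ℚ.* 1/9A))                   ∎
    where
    open ≡-Reasoning
    regroup : ∀ A i g → # 9 ℚ.* A ℚ.* i ℚ.* (# 9 ℚ.* A ℚ.* i) ℚ.* g ≡ # 3 ℚ.* (# 27 ℚ.* (A ℚ.* A ℚ.* g)) ℚ.* (i ℚ.* i)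
    regroup = RingSolver.solve-∀ ℚ-ring
    collect : ∀ δ y i → δ ℚ.* (y ℚ.* y) ℚ.* (i ℚ.* i) ≡ δ ℚ.* (y ℚ.* i ℚ.* (y ℚ.* i))
    collect = RingSolver.solve-∀ ℚ-ring

  a : ℤ
  a = proj₁ (integral-coeff f 4)

  c₄≡a : c₄ ≡ fromℤ a
  c₄≡a = proj₂ (integral-coeff f 4)

  a≢0 : a ≢ 0ℤ
  a≢0 a≡0 = proj₁ deg (trans c₄≡a (cong fromℤ a≡0))

  -- A point with t = 0 would make d the squarefree part of the leading coefficient.
  twist⇒∈𝒮 : ∀ d → Squarefree d → ∣ a ∣ < ∣ d ∣ → ∀ s y → y ≢ 0ℚ → fromℤ d ℚ.* (y ℚ.* y) ≡ eval cubic s → d ∈𝒮 f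
  twist⇒∈𝒮 d sf a<d s y y≢0 on = by-cases (t ℚ.≟ 0ℚ)
    where
    t : ℚ
    t = proj₁ (undepress s)
    g≡ : g t ≡ fromℤ d ℚ.* (y ℚ.* 1/9A ℚ.* (y ℚ.* 1/9A))
    g≡ = g-at-point (fromℤ d) s y t on (proj₂ (undepress s))
    by-cases : Dec (t ≡ 0ℚ) → d ∈𝒮 f
    by-cases (yes t≡0) = contradiction (squarefree-part-bounded a d (y ℚ.* 1/9A) a≢0 sf
      (trans (sym c₄≡a) (trans (sym g-at-0) (trans (cong g (sym t≡0)) g≡)))) (<⇒≱ a<d)
    by-cases (no t≢0) = ∈𝒮-intro f d (ρ ℚ.+ w) (y ℚ.* 1/9A ℚ.* (w ℚ.* w)) sf
      (ℚ-*-≢0 (ℚ-*-≢0 y≢0 1/9A≢0) (ℚ-*-≢0 w≢0 w≢0))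
      (trans (f-at-1/t t w inv) (trans (cong (w ℚ.* w ℚ.* (w ℚ.* w) ℚ.*_) g≡) (regroup (fromℤ d) (y ℚ.* 1/9A) w)))
      where
      t⁻¹ = ℚ-inverse t t≢0
      w : ℚ
      w = proj₁ t⁻¹
      inv : t ℚ.* w ≡ 1ℚ
      inv = proj₂ t⁻¹
      w≢0 : w ≢ 0ℚ
      w≢0 w≡0 = ℚ.1≢0 (trans (sym inv) (trans (cong (t ℚ.*_) w≡0) (ℚ.*-zeroʳ t)))
      regroup : ∀ δ z w → w ℚ.* w ℚ.* (w ℚ.* w) ℚ.* (δ ℚ.* (z ℚ.* z)) ≡ δ ℚ.* (z ℚ.* (w ℚ.* w) ℚ.* (z ℚ.* (w ℚ.* w)))
      regroup = RingSolver.solve-∀ ℚ-ring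

  module _ (parity : ParityConjecture) where

    hits : HitsAllNonzeroClasses f
    hits = let M , M≢0 , twist-point = parity⇒twist-points parity E in hits-by-size f M {{M≢0}} λ pp p∤M α p∤α bound →
      -- Adding |a| to the bound makes d too large to be the squarefree part of the leading
      -- coefficient.
      let d , big , sf , d≡α , s , y , y≢0 , on = twist-point pp p∤M α p∤α (bound + ∣ a ∣) in
      d , ≤-<-trans (m≤m+n bound ∣ a ∣) big , twist⇒∈𝒮 d sf (≤-<-trans (m≤n+m ∣ a ∣ bound) big) s y y≢0 on , d≡α

theorem1p3 : (f : ℤ[x]) → Separable (toℚ[x] f) → Nonconstant (toℚ[x] f) →
    (HasDegree (toℚ[x] f) 1 ⊎ HasDegree (toℚ[x] f) 2 → HitsAllNonzeroClasses f)
    × (ParityConjecture →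
    HasDegree (toℚ[x] f) 3
    ⊎ (HasDegree (toℚ[x] f) 4 × ∃ λ r → eval (toℚ[x] f) r ≡ 0ℚ) →
    HitsAllNonzeroClasses f)
theorem1p3 f sep _ =
  [ linear-hits f , Quadratic.hits f sep ]′ ,
  λ parity → [ Cubic.hits parity f sep , (λ (deg , ρ , root) → QuarticWithRoot.hits f sep deg ρ root parity) ]′
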